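{- Let $C$ be any chain. Then either $sib(C)=1$ or $sib(C)\geq \aleph_0$.
   Context: A chain is a linearly ordered set. An embedding of a chain $A$ into a chain $B$ is an injective map $f:A\to B$ with $x<y \iff f(x)<f(y)$. Two chains are equimorphic if each embeds into the other. For a chain $C$, $sib(C)$ denotes the number (a cardinal) of isomorphism classes of chains equimorphic to $C$. -}

module Defs where

open import Level using (Level; suc)
open import Data.Nat using (ℕ)
open import Data.Product using (Σ; _×_; ∃)
open import Data.Sum using (_⊎_)
open import Relation.Binary.Core using (Rel)
open import Relation.Binary.Structures using (IsStrictTotalOrder)
open import Relation.Binary.PropositionalEquality using (_≡_)
open import Relation.Nullary using (¬_)
open import Function.Bundles using (_⇔_)
open import Function.Definitions using (Injective; Surjective)

record Chain (ℓ : Level) : Set (suc ℓ) where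
  field
    Carrier : Set ℓ
    _<_     : Rel Carrier ℓ
    isStrictTotalOrder : IsStrictTotalOrder _≡_ _<_

open Chain public

record Embedding {ℓ : Level} (A B : Chain ℓ) : Set ℓ where
  field
    map       : Carrier A → Carrier B
    injective : Injective _≡_ _≡_ map
    order     : ∀ x y → (_<_ A x y ⇔ _<_ B (map x) (map y))

record Isomorphic {ℓ : Level} (A B : Chain ℓ) : Set ℓ where
  field
    embedding  : Embedding A B
    surjective : Surjective _≡_ _≡_ (Embedding.map embedding)

Equimorphic : {ℓ : Level} → Chain ℓ → Chain ℓ → Set ℓ
Equimorphic A B = Embedding A B × Embedding B A

-- sib(C) = 1 : every chain equimorphic to C is isomorphic to C
-- (C itself is always a sibling, so sib(C) ≥ 1).
SibIsOne : {ℓ : Level} → Chain ℓ → Set (suc ℓ)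
SibIsOne {ℓ} C = (D : Chain ℓ) → Equimorphic C D → Isomorphic C D

SibInfinite : {ℓ : Level} → Chain ℓ → Set (suc ℓ)
SibInfinite {ℓ} C =
  Σ (ℕ → Chain ℓ) λ S →
    ((n : ℕ) → Equimorphic C (S n)) ×
    ((m n : ℕ) → ¬ (m ≡ n) → ¬ Isomorphic (S m) (S n))

{-# OPTIONS --safe #-}
-- Call a self-embedding "right-moving" at x when x < f x.  If an interval [x, f x] contains
-- ω*·ω, then ω + k + ω*·ω can be inserted there, after all old clusters of this shape have
-- been deleted, and k distinguishes the siblings.  If this never happens but some [x, f x]
-- contains both ω and ω*, clusters ω + k are inserted along the orbit of x; now isomorphisms
-- must respect the supremum of the orbit, so again k is an invariant.  Otherwise every orbit
-- has well-ordered or reversely well-ordered steps, and the maximal well-ordered-interval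
-- classes met by infinite well-ordered orbits to the left matter: either such a class can be
-- enlarged by ω + k on top, or its orbit grows without bound and the orbit can be thinned out
-- in infinitely many ways, or the class is eventually a periodic sum of one indecomposable
-- ordinal.  If, up to duality, only the last possibility occurs, every g : C → D ⊆ C can be
-- straightened to an isomorphism of C onto D.
--
-- Excluded middle for all types provides choice functions, but no choice of representatives
-- of equivalence classes; isomorphisms on pieces of C are therefore made canonical, as
-- pointwise least ones.
module Submission where

open import Defs
open import Level using (Level; Lift; lift; lower; 0ℓ) renaming (suc to lsuc)
open import Axiom.ExcludedMiddle using (ExcludedMiddle)
open import Data.Nat as ℕ using (ℕ; zero; suc)
import Data.Nat.Properties as ℕₚ
open import Data.Nat.Divisibility using (_∣_; m∣m*n; _∣0; ∣m+n∣m⇒∣n; ∣⇒≤)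
open import Data.Product using (Σ; _×_; _,_; proj₁; proj₂)
open import Data.Sum using (_⊎_; inj₁; inj₂)
open import Data.Empty using (⊥; ⊥-elim; ⊥-elim-irr)
open import Data.Unit using (⊤; tt)
open import Function.Base using (_∘_; id; case_of_)
open import Function.Bundles using (mk⇔; Equivalence)
open import Relation.Nullary using (¬_; Dec; yes; no)
open import Relation.Binary.Definitions using (Tri; tri<; tri≈; tri>)
open import Relation.Binary.Structures using (IsStrictTotalOrder)
open import Relation.Binary.PropositionalEquality
  using (_≡_; refl; sym; trans; cong; subst; subst₂; isEquivalence; resp₂)

-- Most siblings are compared indirectly. Each comes with an embedding back into `C`, so an
-- isomorphism between two of them, composed with these embeddings, is a self-embedding of `C`. This
-- dictates the order of the cases: once an earlier case fails, its failure is a statement about all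
-- self-embeddings of `C`, and that statement is what stops an isomorphism from crossing the cut
-- (the supremum of an orbit, the top of a class) at which `k` is read off.
--
-- For the case of one sibling the obstacle is surjectivity, as no inverse is at hand. It comes from
-- minimality: values are chosen from a set without descending sequences, and if the pointwise least
-- competitor missed an admissible `d`, its value at the first point sent above `d` could be lowered
-- to `d`. The bounds imposed on the competitors serve two purposes, to make the least value exist
-- and to survive this lowering. On the classes with infinite well-ordered orbits such bounds are
-- not given by `g`, and the decomposition into copies of an indecomposable set supplies them.

module Classical {ℓ : Level} (em₁ : ExcludedMiddle (lsuc ℓ)) where

  -- Consequences of excluded middle; iteration.

  opaque
    em : (P : Set ℓ) → Dec P
    em P with em₁ {Lift (lsuc ℓ) P}
    ... | yes (lift p) = yes p
    ... | no ¬p = no λ p → ¬p (lift p)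

    dne : {P : Set ℓ} → ¬ ¬ P → P
    dne {P} ¬¬p with em P
    ... | yes p = p
    ... | no ¬p = ⊥-elim (¬¬p ¬p)

    ¬∀⇒∃¬ : {P : ℕ → Set ℓ} → ¬ (∀ n → P n) → Σ ℕ λ n → ¬ P n
    ¬∀⇒∃¬ ¬∀ = dne λ ¬∃ → ¬∀ λ x → dne λ ¬Px → ¬∃ (x , ¬Px)

    leastℕ : (P : ℕ → Set ℓ) → Σ ℕ P → Σ ℕ λ n → P n × (∀ m → P m → n ℕ.≤ m)
    leastℕ P (n , pn) = go n n pn ℕₚ.≤-refl
      where
      go : ∀ k n → P n → n ℕ.≤ k → Σ ℕ λ n → P n × (∀ m → P m → n ℕ.≤ m)
      go k n pn n≤k with em (Σ ℕ λ m → P m × m ℕ.< n)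
      ... | no ¬s = n , pn , λ m pm → ℕₚ.≮⇒≥ λ m<n → ¬s (m , pm , m<n)
      go zero .zero pn ℕ.z≤n | yes (m , pm , ())
      go (suc k) n pn n≤k | yes (m , pm , m<n) =
        go k m pm (ℕₚ.≤-pred (ℕₚ.≤-trans m<n n≤k))

  iter : {A : Set ℓ} → ℕ → (A → A) → A → A
  iter zero f x = x
  iter (suc n) f x = f (iter n f x)

  iter-+ : {A : Set ℓ} (m n : ℕ) (f : A → A) (x : A) → iter (m ℕ.+ n) f x ≡ iter m f (iter n f x)
  iter-+ zero n f x = refl
  iter-+ (suc m) n f x = cong f (iter-+ m n f x)

  iter-suc : {A : Set ℓ} (n : ℕ) (f : A → A) (x : A) → iter n f (f x) ≡ f (iter n f x)
  iter-suc zero f x = refl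
  iter-suc (suc n) f x = cong f (iter-suc n f x)

  opaque
    -- `F` may give different values for different proofs of `P x`. Feeding it the proof found by
    -- `em` leaves a function of `x` alone; outside `P` the value `x` is a default.
    choose : {A : Set ℓ} {P : A → Set ℓ} {Q : A → A → Set ℓ} → (∀ x → P x → Σ A (Q x)) →
      Σ (A → A) λ f → ∀ {x} → P x → Q x (f x)
    choose {A} {P} {Q} F = (λ x → f x (em (P x))) , λ {x} p → spec p (em (P x))
      where
      f : ∀ x → Dec (P x) → A
      f x (yes p) = proj₁ (F x p)
      f x (no _) = x
      spec : ∀ {x} → P x → (d : Dec (P x)) → Q x (f x d)
      spec p (yes q) = proj₂ (F _ q)
      spec p (no ¬p) = ⊥-elim (¬p p)

  -- Linear orders, sequences, and comparison of well-ordered subsets.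

  module Order (C : Chain ℓ) where

    A : Set ℓ
    A = Carrier C

    infix 4 _≺_ _≼_

    _≺_ : A → A → Set ℓ
    _≺_ = _<_ C

    _≼_ : A → A → Set ℓ
    x ≼ y = ¬ (y ≺ x)

    private module S = IsStrictTotalOrder (isStrictTotalOrder C)

    ≺-trans : ∀ {x y z} → x ≺ y → y ≺ z → x ≺ z
    ≺-trans = S.trans

    ≺-irr : ∀ {x} → ¬ (x ≺ x)
    ≺-irr = S.irrefl refl

    tri : ∀ x y → Tri (x ≺ y) (x ≡ y) (y ≺ x)
    tri = S.compare

    split : ∀ x y → x ≺ y ⊎ y ≼ x
    split x y with tri x y
    ... | tri< a _ _ = inj₁ a
    ... | tri≈ ¬a _ _ = inj₂ ¬a
    ... | tri> ¬a _ _ = inj₂ ¬a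

    ≺⇒≼ : ∀ {x y} → x ≺ y → x ≼ y
    ≺⇒≼ p q = ≺-irr (≺-trans p q)

    ≼-refl : ∀ {x} → x ≼ x
    ≼-refl = ≺-irr

    ≡⇒≼ : ∀ {x y} → x ≡ y → x ≼ y
    ≡⇒≼ refl = ≺-irr

    ≺-≼ : ∀ {x y z} → x ≺ y → y ≼ z → x ≺ z
    ≺-≼ {x} {y} {z} p q with tri y z
    ... | tri< a _ _ = ≺-trans p a
    ... | tri≈ _ refl _ = p
    ... | tri> _ _ c = ⊥-elim (q c)

    ≼-≺ : ∀ {x y z} → x ≼ y → y ≺ z → x ≺ z
    ≼-≺ {x} {y} {z} p q with tri x y
    ... | tri< a _ _ = ≺-trans a q
    ... | tri≈ _ refl _ = q
    ... | tri> _ _ c = ⊥-elim (p c)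

    ≼-trans : ∀ {x y z} → x ≼ y → y ≼ z → x ≼ z
    ≼-trans p q r = q (≺-≼ r p)

    ≼-antisym : ∀ {x y} → x ≼ y → y ≼ x → x ≡ y
    ≼-antisym {x} {y} p q with tri x y
    ... | tri< a _ _ = ⊥-elim (q a)
    ... | tri≈ _ e _ = e
    ... | tri> _ _ c = ⊥-elim (p c)

    ≼⇒≺⊎≡ : ∀ {x y} → x ≼ y → x ≺ y ⊎ x ≡ y
    ≼⇒≺⊎≡ {x} {y} p with tri x y
    ... | tri< a _ _ = inj₁ a
    ... | tri≈ _ e _ = inj₂ e
    ... | tri> _ _ c = ⊥-elim (p c)

    ≼-total : ∀ x y → x ≼ y ⊎ y ≼ x
    ≼-total x y with split x y
    ... | inj₁ p = inj₁ (≺⇒≼ p)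
    ... | inj₂ p = inj₂ p

    NoDesc : (A → Set ℓ) → Set ℓ
    NoDesc P = ¬ Σ (ℕ → A) λ s → (∀ n → P (s n)) × (∀ n → s (suc n) ≺ s n)

    opaque
      least : (P : A → Set ℓ) → NoDesc P → Σ A P → Σ A λ m → P m × (∀ z → P z → m ≼ z)
      least P nd (a , pa) = dne λ none →
        let
          step : (u : Σ A P) → Σ (Σ A P) λ v → proj₁ v ≺ proj₁ u
          step (x , px) = dne λ ¬v → none (x , px , λ z pz z≺x → ¬v ((z , pz) , z≺x))
          seq : ℕ → Σ A P
          seq n = iter n (λ u → proj₁ (step u)) (a , pa)
        in nd ((λ n → proj₁ (seq n)) , (λ n → proj₂ (seq n)) , λ n → proj₂ (step (seq n)))

    Asc : A → A → Set ℓ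
    Asc x y = Σ (ℕ → A) λ s → (∀ n → s n ≺ s (suc n)) × (∀ n → x ≼ s n) × (∀ n → s n ≼ y)

    Desc : A → A → Set ℓ
    Desc x y = Σ (ℕ → A) λ s → (∀ n → s (suc n) ≺ s n) × (∀ n → s n ≼ y) × (∀ n → x ≼ s n)

    Desc-mono : ∀ {x x′ y y′} → x′ ≼ x → y ≼ y′ → Desc x y → Desc x′ y′
    Desc-mono p q (s , d , u , l) = s , d , (λ n → ≼-trans (u n) q) , λ n → ≼-trans p (l n)

    Asc-mono : ∀ {x x′ y y′} → x′ ≼ x → y ≼ y′ → Asc x y → Asc x′ y′
    Asc-mono p q (s , d , l , u) = s , d , (λ n → ≼-trans p (l n)) , λ n → ≼-trans (u n) q

    Desc-bounds : ∀ {x y} → Desc x y → x ≺ y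
    Desc-bounds (s , d , u , l) = ≼-≺ (l 1) (≺-≼ (d 0) (u 0))

    Desc-split : ∀ {x z} y → Desc x z → Desc x y ⊎ Desc y z
    Desc-split {x} {z} y (s , d , u , l) with em (Σ ℕ λ n → s n ≼ y)
    ... | no ¬n = inj₂ (s , d , u , λ n sn<y → ¬n (n , ≺⇒≼ sn<y))
    ... | yes (k , sk≼y) = inj₁ ((λ n → s (n ℕ.+ k)) , (λ n → d (n ℕ.+ k)) , up , λ n → l (n ℕ.+ k))
      where
      up : ∀ n → s (n ℕ.+ k) ≼ y
      up zero = sk≼y
      up (suc n) = ≼-trans (≺⇒≼ (d (n ℕ.+ k))) (up n)

    interval-NoDesc : ∀ {x y} → ¬ Desc x y → (P : A → Set ℓ) → (∀ {z} → P z → x ≼ z × z ≼ y) → NoDesc P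
    interval-NoDesc nd P bd (s , p , d) = nd (s , d , (λ n → proj₂ (bd (p n))) , λ n → proj₁ (bd (p n)))

    Mono : (A → A) → Set ℓ
    Mono f = ∀ {x y} → x ≺ y → f x ≺ f y

    module _ {f : A → A} (fm : Mono f) where

      mono-≼ : ∀ {x y} → x ≼ y → f x ≼ f y
      mono-≼ {x} {y} p with ≼⇒≺⊎≡ p
      ... | inj₁ q = ≺⇒≼ (fm q)
      ... | inj₂ refl = ≼-refl

      iter-mono : ∀ n → Mono (iter n f)
      iter-mono zero p = p
      iter-mono (suc n) p = fm (iter-mono n p)

      Desc-map : ∀ {x y} → Desc x y → Desc (f x) (f y)
      Desc-map (s , d , u , l) = (λ n → f (s n)) , (λ n → fm (d n)) , (λ n → mono-≼ (u n)) , λ n → mono-≼ (l n)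

      Asc-map : ∀ {x y} → Asc x y → Asc (f x) (f y)
      Asc-map (s , d , u , l) = (λ n → f (s n)) , (λ n → fm (d n)) , (λ n → mono-≼ (u n)) , λ n → mono-≼ (l n)

      orbit-up : ∀ {x} → x ≺ f x → ∀ n → iter n f x ≺ iter (suc n) f x
      orbit-up p zero = p
      orbit-up p (suc n) = fm (orbit-up p n)

    mono-seq : (s : ℕ → A) → (∀ n → s n ≺ s (suc n)) → ∀ {m n} → m ℕ.≤ n → s m ≼ s n
    mono-seq s up {m} {n} m≤n = go (ℕₚ.≤⇒≤′ m≤n)
      where
      go : ∀ {n} → m ℕ.≤′ n → s m ≼ s n
      go ℕ.≤′-refl = ≼-refl
      go (ℕ.≤′-step p) = ≼-trans (go p) (≺⇒≼ (up _))

    mono-seq-< : (s : ℕ → A) → (∀ n → s n ≺ s (suc n)) → ∀ {m n} → m ℕ.< n → s m ≺ s n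
    mono-seq-< s up {m} p = ≺-≼ (up m) (mono-seq s up p)

    inflationary : (P : A → Set ℓ) → NoDesc P → (f : A → A) → (∀ {z} → P z → P (f z)) →
      (∀ {y z} → P y → P z → y ≺ z → f y ≺ f z) → ∀ {z} → P z → z ≼ f z
    inflationary P nd f pf fm {z} pz fz≺z = nd ((λ n → iter n f z) , inP , down)
      where
      inP : ∀ n → P (iter n f z)
      inP zero = pz
      inP (suc n) = pf (inP n)
      down : ∀ n → iter (suc n) f z ≺ iter n f z
      down zero = fz≺z
      down (suc n) = fm (inP (suc n)) (inP n) (down n)

    record Emb (X Y : A → Set ℓ) : Set ℓ where
      field
        fn : A → A
        into : ∀ {x} → X x → Y (fn x)
        incr : ∀ {x y} → X x → X y → x ≺ y → fn x ≺ fn y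

      weak : ∀ {x y} → X x → X y → x ≼ y → fn x ≼ fn y
      weak p q r with ≼⇒≺⊎≡ r
      ... | inj₁ s = ≺⇒≼ (incr p q s)
      ... | inj₂ refl = ≼-refl

    open Emb public

    Emb-mono : {X X′ Y Y′ : A → Set ℓ} → (∀ {x} → X′ x → X x) → (∀ {y} → Y y → Y′ y) → Emb X Y → Emb X′ Y′
    Emb-mono i j e = record { fn = fn e ; into = λ p → j (into e (i p)) ; incr = λ p q → incr e (i p) (i q) }

    Emb-trans : {X Y Z : A → Set ℓ} → Emb X Y → Emb Y Z → Emb X Z
    Emb-trans e f = record { fn = λ x → fn f (fn e x) ; into = λ p → into f (into e p)
                           ; incr = λ p q r → incr f (into e p) (into e q) (incr e p q r) }

    Emb-map : (f : A → A) → Mono f → {X Y : A → Set ℓ} → (∀ {x} → X x → Y (f x)) → Emb X Y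
    Emb-map f fm i = record { fn = f ; into = i ; incr = λ _ _ → fm }

    -- f sends x to the least y such that the initial segment up to x embeds in the one up to y;
    -- taking least values makes f monotone and its image an initial segment.
    module _ (X Y : A → Set ℓ) (wX : NoDesc X) (wY : NoDesc Y) where

      private
        E : A → A → Set ℓ
        E x y = Emb (λ z → X z × z ≼ x) (λ z → Y z × z ≼ y)

        Good : A → Set ℓ
        Good x = Σ A λ y → Y y × E x y

        best : ∀ x → Good x → Σ A λ y → (Y y × E x y) × (∀ z → Y z × E x z → y ≼ z)
        best x g = least (λ y → Y y × E x y) (λ (s , p , d) → wY (s , (λ n → proj₁ (p n)) , d)) g

        Best : A → A → Set ℓ
        Best x y = (Y y × E x y) × (∀ z → Y z × E x z → y ≼ z)

        chosen : Σ (A → A) λ f → ∀ {x} → Good x → Best x (f x)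
        chosen = choose best

        f : A → A
        f = proj₁ chosen

        f-spec : ∀ {x} → Good x → Best x (f x)
        f-spec = proj₂ chosen

        -- Restricted to the segment up to `w`, the embedding stays at or below `fn e w`, which is
        -- strictly below the image of `w′`. Hence least bounds increase strictly.
        shrink : ∀ {w w′ y} → X w → X w′ → w ≺ w′ → E w′ y → Σ A λ v → (Y v × E w v) × v ≺ y
        shrink {w} {w′} xw xw′ w≺w′ e =
          fn e w , (proj₁ (into e (xw , ≺⇒≼ w≺w′)) , record
            { fn = fn e
            ; into = λ (xz , z≼w) → proj₁ (into e (xz , ≼-trans z≼w (≺⇒≼ w≺w′))) ,
                weak e (xz , ≼-trans z≼w (≺⇒≼ w≺w′)) (xw , ≺⇒≼ w≺w′) z≼w
            ; incr = λ (xy , y≼w) (xz , z≼w) → incr e (xy , ≼-trans y≼w (≺⇒≼ w≺w′)) (xz , ≼-trans z≼w (≺⇒≼ w≺w′)) }) ,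
          ≺-≼ (incr e (xw , ≺⇒≼ w≺w′) (xw′ , ≼-refl) w≺w′) (proj₂ (into e (xw′ , ≼-refl)))

        f-incr : ∀ {w w′} → X w → X w′ → Good w′ → w ≺ w′ → Good w × f w ≺ f w′
        f-incr xw xw′ g w≺w′ with shrink xw xw′ w≺w′ (proj₂ (proj₁ (f-spec g)))
        ... | v , yev , v≺ = (v , yev) , ≼-≺ (proj₂ (f-spec (v , yev)) v yev) v≺

        -- The least bounds `f w` already embed the points before `x`; only `x` needs a new value,
        -- namely `y`.
        extend : ∀ {x y} → X x → Y y → (∀ {w} → X w → w ≺ x → Good w × f w ≺ y) → E x y
        extend {x} {y} xx yy h = record { fn = g ; into = g-into ; incr = g-incr }
          where
          g : A → A
          g w with split w x
          ... | inj₁ _ = f w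
          ... | inj₂ _ = y
          g-into : ∀ {z} → X z × z ≼ x → Y (g z) × g z ≼ y
          g-into {z} (xz , z≼x) with split z x
          ... | inj₁ z≺x = proj₁ (proj₁ (f-spec (proj₁ (h xz z≺x)))) , ≺⇒≼ (proj₂ (h xz z≺x))
          ... | inj₂ _ = yy , ≼-refl
          g-incr : ∀ {u v} → X u × u ≼ x → X v × v ≼ x → u ≺ v → g u ≺ g v
          g-incr {u} {v} (xu , _) (xv , v≼x) u≺v with split u x | split v x
          ... | inj₁ u≺x | inj₁ v≺x = proj₂ (f-incr xu xv (proj₁ (h xv v≺x)) u≺v)
          ... | inj₁ u≺x | inj₂ _ = proj₂ (h xu u≺x)
          ... | inj₂ x≼u | _ = ⊥-elim (x≼u (≺-≼ u≺v v≼x))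

      opaque
        compare-wo : Emb X Y ⊎ Σ A λ x → X x × Emb Y (λ z → X z × z ≺ x)
        compare-wo with em (∀ x → X x → Good x)
        ... | yes all = inj₁ record
          { fn = f ; into = λ {x} p → proj₁ (proj₁ (f-spec (all x p)))
          ; incr = λ p q r → proj₂ (f-incr p q (all _ q) r) }
        ... | no ¬all with least (λ x → X x × ¬ Good x) (λ (s , p , d) → wX (s , (λ n → proj₁ (p n)) , d))
                            (dne λ ¬e → ¬all λ x p → dne λ ¬g → ¬e (x , p , ¬g))
        ... | x₀ , (xx₀ , bad) , min = inj₂ (x₀ , xx₀ , record { fn = k ; into = λ p → proj₁ (k-spec p) ; incr = k-incr })
          where
          good : ∀ {w} → X w → w ≺ x₀ → Good w
          good xw w≺x₀ = dne λ ¬g → min _ (xw , ¬g) w≺x₀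
          Hit : A → A → Set ℓ
          Hit y z = (X z × z ≺ x₀) × f z ≡ y
          -- If all values below `x₀` were below `y`, `extend` would make `x₀` good. At the first
          -- `z` whose value reaches `y`, the same extension shows that `y` is already a bound for
          -- `z`, so `f z` is `y`.
          hit : ∀ y → Y y → Σ A (Hit y)
          hit y yy with least (λ z → (X z × z ≺ x₀) × y ≼ f z) (λ (s , p , d) → wX (s , (λ n → proj₁ (proj₁ (p n))) , d))
                 (dne λ ¬e → bad (y , yy , extend xx₀ yy λ {w} xw w≺x₀ → good xw w≺x₀ ,
                    dne λ ¬p → ¬e (w , (xw , w≺x₀) , ¬p)))
          ... | z , ((xz , z≺x₀) , y≼fz) , zmin = z , (xz , z≺x₀) , ≼-antisym
                 (proj₂ (f-spec (good xz z≺x₀)) y (yy , extend xz yy λ {w} xw w≺z →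
                    good xw (≺-trans w≺z z≺x₀) , dne λ ¬p → zmin w ((xw , ≺-trans w≺z z≺x₀) , ¬p) w≺z))
                 y≼fz
          inv : Σ (A → A) λ k → ∀ {y} → Y y → Hit y (k y)
          inv = choose hit
          k : A → A
          k = proj₁ inv
          k-spec : ∀ {y} → Y y → Hit y (k y)
          k-spec = proj₂ inv
          k-incr : ∀ {u v} → Y u → Y v → u ≺ v → k u ≺ k v
          k-incr {u} {v} yu yv u≺v = case split (k u) (k v) of λ where
            (inj₁ p) → p
            (inj₂ q) → ⊥-elim (case ≼⇒≺⊎≡ q of λ where
              (inj₁ r) → ≺-irr (≺-trans u≺v (subst₂ _≺_ (proj₂ (k-spec yv)) (proj₂ (k-spec yu))
                (proj₂ (f-incr (proj₁ (proj₁ (k-spec yv))) (proj₁ (proj₁ (k-spec yu)))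
                  (good (proj₁ (proj₁ (k-spec yu))) (proj₂ (proj₁ (k-spec yu)))) r))))
              (inj₂ r) → ≺-irr (subst₂ _≺_ (trans (sym (proj₂ (k-spec yu))) (cong f (sym r))) (sym (proj₂ (k-spec yv))) u≺v))

  -- Embeddings, isomorphisms and opposite chains.

  infix 3 _↪_

  record _↪_ (X Y : Chain ℓ) : Set ℓ where
    constructor mk↪
    field
      app : Carrier X → Carrier Y
      app-mono : ∀ {x y} → _<_ X x y → _<_ Y (app x) (app y)

  open _↪_ public

  _∘↪_ : {X Y Z : Chain ℓ} → Y ↪ Z → X ↪ Y → X ↪ Z
  f ∘↪ g = mk↪ (λ x → app f (app g x)) λ p → app-mono f (app-mono g p)

  module _ {X Y : Chain ℓ} where

    private
      module X = Order X
      module Y = Order Y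

    ↪-≼ : (f : X ↪ Y) → ∀ {x y} → x X.≼ y → app f x Y.≼ app f y
    ↪-≼ f {x} {y} p with X.≼⇒≺⊎≡ p
    ... | inj₁ q = Y.≺⇒≼ (app-mono f q)
    ... | inj₂ refl = Y.≼-refl

    ↪-reflect : (f : X ↪ Y) → ∀ {x y} → app f x Y.≺ app f y → x X.≺ y
    ↪-reflect f {x} {y} p with X.split x y
    ... | inj₁ q = q
    ... | inj₂ q = ⊥-elim (↪-≼ f q p)

    ↪-Desc : (f : X ↪ Y) → ∀ {x y} → X.Desc x y → Y.Desc (app f x) (app f y)
    ↪-Desc f (s , d , u , l) = (λ n → app f (s n)) , (λ n → app-mono f (d n)) , (λ n → ↪-≼ f (u n)) , λ n → ↪-≼ f (l n)

    ↪-Asc : (f : X ↪ Y) → ∀ {x y} → X.Asc x y → Y.Asc (app f x) (app f y)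
    ↪-Asc f (s , d , u , l) = (λ n → app f (s n)) , (λ n → app-mono f (d n)) , (λ n → ↪-≼ f (u n)) , λ n → ↪-≼ f (l n)

    toEmbedding : X ↪ Y → Embedding X Y
    toEmbedding f = record
      { map = app f
      ; injective = inj
      ; order = λ x y → mk⇔ (app-mono f) (↪-reflect f) }
      where
      inj : ∀ {x y} → app f x ≡ app f y → x ≡ y
      inj {x} {y} e with X.tri x y
      ... | tri< a _ _ = ⊥-elim (Y.≺-irr (subst (λ t → app f x Y.≺ t) (sym e) (app-mono f a)))
      ... | tri≈ _ e′ _ = e′
      ... | tri> _ _ c = ⊥-elim (Y.≺-irr (subst (λ t → app f y Y.≺ t) e (app-mono f c)))

    fromEmbedding : Embedding X Y → X ↪ Y
    fromEmbedding e = mk↪ (Embedding.map e) λ {x} {y} → Equivalence.to (Embedding.order e x y)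

  record Iso (X Y : Chain ℓ) : Set ℓ where
    field
      fwd : X ↪ Y
      bwd : Y ↪ X
      bwd-fwd : ∀ x → app bwd (app fwd x) ≡ x
      fwd-bwd : ∀ y → app fwd (app bwd y) ≡ y

  open Iso public

  Iso-sym : {X Y : Chain ℓ} → Iso X Y → Iso Y X
  Iso-sym φ = record { fwd = bwd φ ; bwd = fwd φ ; bwd-fwd = fwd-bwd φ ; fwd-bwd = bwd-fwd φ }

  fromIsomorphic : {X Y : Chain ℓ} → Isomorphic X Y → Iso X Y
  fromIsomorphic {X} {Y} φ = record
    { fwd = f
    ; bwd = mk↪ g λ {x} {y} p → ↪-reflect f (subst₂ (_<_ Y) (sym (fg x)) (sym (fg y)) p)
    ; bwd-fwd = λ x → Embedding.injective (Isomorphic.embedding φ) (fg (app f x))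
    ; fwd-bwd = fg }
    where
    f = fromEmbedding (Isomorphic.embedding φ)
    g : Carrier Y → Carrier X
    g y = proj₁ (Isomorphic.surjective φ y)
    fg : ∀ y → app f (g y) ≡ y
    fg y = proj₂ (Isomorphic.surjective φ y) refl

  toIsomorphic : {X Y : Chain ℓ} (f : X ↪ Y) → (∀ y → Σ (Carrier X) λ x → app f x ≡ y) → Isomorphic X Y
  toIsomorphic f s = record
    { embedding = toEmbedding f
    ; surjective = λ y → proj₁ (s y) , λ { refl → proj₂ (s y) } }

  op : Chain ℓ → Chain ℓ
  op C = record
    { Carrier = Carrier C
    ; _<_ = λ x y → _<_ C y x
    ; isStrictTotalOrder = record
      { isStrictPartialOrder = record
        { isEquivalence = isEquivalence
        ; irrefl = λ { refl p → ≺-irr p }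
        ; trans = λ p q → ≺-trans q p
        ; <-resp-≈ = resp₂ _ }
      ; compare = cmp } }
    where
    open Order C
    cmp : ∀ x y → Tri (y ≺ x) (x ≡ y) (x ≺ y)
    cmp x y with tri x y
    ... | tri< a b c = tri> c b a
    ... | tri≈ a b c = tri≈ c b a
    ... | tri> a b c = tri< c b a

  op↪ : {X Y : Chain ℓ} → X ↪ Y → op X ↪ op Y
  op↪ f = mk↪ (app f) (app-mono f)

  SibInf : Chain ℓ → Set (lsuc ℓ)
  SibInf C = Σ (ℕ → Chain ℓ) λ S → ((n : ℕ) → (C ↪ S n) × (S n ↪ C)) × ((m n : ℕ) → Iso (S m) (S n) → m ≡ n)

  toSibInfinite : {C : Chain ℓ} → SibInf C → SibInfinite C
  toSibInfinite (S , e , i) = S , (λ n → toEmbedding (proj₁ (e n)) , toEmbedding (proj₂ (e n))) ,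
    λ m n m≢n φ → m≢n (i m n (fromIsomorphic φ))

  SibInf-equi : {C D : Chain ℓ} → C ↪ D → D ↪ C → SibInf D → SibInf C
  SibInf-equi f g (S , e , i) = S , (λ n → (proj₁ (e n) ∘↪ f) , (g ∘↪ proj₂ (e n))) , i

  SibInf-op : {C : Chain ℓ} → SibInf (op C) → SibInf C
  SibInf-op {C} (S , e , i) = (λ n → op (S n)) ,
    (λ n → mk↪ (app (proj₁ (e n))) (app-mono (proj₁ (e n))) , mk↪ (app (proj₂ (e n))) (app-mono (proj₂ (e n)))) ,
    λ m n φ → i m n record
      { fwd = mk↪ (app (fwd φ)) (app-mono (fwd φ)) ; bwd = mk↪ (app (bwd φ)) (app-mono (bwd φ))
      ; bwd-fwd = bwd-fwd φ ; fwd-bwd = fwd-bwd φ }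

  -- Constructions: subchains, sums, lexicographic products, insertions.

  mkChain : {l : Level} (A : Set l) (_<_ : A → A → Set l) → (∀ {x} → ¬ (x < x)) →
    (∀ {x y z} → x < y → y < z → x < z) → (∀ x y → Tri (x < y) (x ≡ y) (y < x)) → Chain l
  mkChain A _<_ irr tr cmp = record
    { Carrier = A
    ; _<_ = _<_
    ; isStrictTotalOrder = record
      { isStrictPartialOrder = record
        { isEquivalence = isEquivalence
        ; irrefl = λ { refl → irr }
        ; trans = tr
        ; <-resp-≈ = resp₂ _ }
      ; compare = cmp } }

  module _ {l : Level} (C : Chain l) where
    private module S = IsStrictTotalOrder (isStrictTotalOrder C)
    chain-irr : ∀ {x} → ¬ (_<_ C x x)
    chain-irr = S.irrefl refl
    chain-trans : ∀ {x y z} → _<_ C x y → _<_ C y z → _<_ C x z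
    chain-trans = S.trans
    chain-cmp : ∀ x y → Tri (_<_ C x y) (x ≡ y) (_<_ C y x)
    chain-cmp = S.compare

  -- Membership is irrelevant, so that points with equal values are equal; `relevant` recovers a
  -- usable proof classically.
  record SubCarrier {l : Level} (A : Set l) (P : A → Set l) : Set l where
    constructor sub
    field
      val : A
      .prf : P val

  open SubCarrier public using (val)

  Sub : {l : Level} (C : Chain l) → (Carrier C → Set l) → Chain l
  Sub C P = mkChain (SubCarrier (Carrier C) P) (λ x y → _<_ C (val x) (val y)) (chain-irr C) (chain-trans C) cmp
    where
    cmp : ∀ x y → Tri (_<_ C (val x) (val y)) (x ≡ y) (_<_ C (val y) (val x))
    cmp x y with chain-cmp C (val x) (val y)
    ... | tri< a b c = tri< a (λ e → b (cong val e)) c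
    ... | tri≈ a refl c = tri≈ a refl c
    ... | tri> a b c = tri> a (λ e → b (cong val e)) c

  relevant : {P : Set ℓ} → .P → P
  relevant {P} p = dne λ ¬p → ⊥-elim-irr (¬p p)

  prf′ : {A : Set ℓ} {P : A → Set ℓ} (x : SubCarrier A P) → P (val x)
  prf′ (sub _ p) = relevant p

  sub-≡ : {l : Level} {A : Set l} {P : A → Set l} {x y : SubCarrier A P} → val x ≡ val y → x ≡ y
  sub-≡ {x = sub a _} {sub .a _} refl = refl

  ω : Chain 0ℓ
  ω = mkChain ℕ ℕ._<_ (ℕₚ.<-irrefl refl) ℕₚ.<-trans ℕₚ.<-cmp

  ω* : Chain 0ℓ
  ω* = mkChain ℕ (λ m n → n ℕ.< m) (ℕₚ.<-irrefl refl) (λ p q → ℕₚ.<-trans q p) cmp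
    where
    cmp : ∀ m n → Tri (n ℕ.< m) (m ≡ n) (m ℕ.< n)
    cmp m n with ℕₚ.<-cmp m n
    ... | tri< a b c = tri> c b a
    ... | tri≈ a b c = tri≈ c b a
    ... | tri> a b c = tri< c b a

  _⊕_ : Chain 0ℓ → Chain 0ℓ → Chain 0ℓ
  X ⊕ Y = mkChain (Carrier X ⊎ Carrier Y) lt (λ {x} → irr x) (λ {x} {y} {z} → tr x y z) cmp
    where
    lt : Carrier X ⊎ Carrier Y → Carrier X ⊎ Carrier Y → Set
    lt (inj₁ x) (inj₁ y) = _<_ X x y
    lt (inj₁ x) (inj₂ y) = ⊤
    lt (inj₂ x) (inj₁ y) = ⊥
    lt (inj₂ x) (inj₂ y) = _<_ Y x y
    irr : ∀ x → ¬ lt x x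
    irr (inj₁ x) = chain-irr X
    irr (inj₂ x) = chain-irr Y
    tr : ∀ x y z → lt x y → lt y z → lt x z
    tr (inj₁ x) (inj₁ y) (inj₁ z) p q = chain-trans X p q
    tr (inj₁ x) (inj₁ y) (inj₂ z) p q = tt
    tr (inj₁ x) (inj₂ y) (inj₂ z) p q = tt
    tr (inj₂ x) (inj₂ y) (inj₂ z) p q = chain-trans Y p q
    cmp : ∀ x y → Tri (lt x y) (x ≡ y) (lt y x)
    cmp (inj₁ x) (inj₁ y) with chain-cmp X x y
    ... | tri< a b c = tri< a (λ { refl → b refl }) c
    ... | tri≈ a refl c = tri≈ a refl c
    ... | tri> a b c = tri> a (λ { refl → b refl }) c
    cmp (inj₁ x) (inj₂ y) = tri< tt (λ ()) λ ()
    cmp (inj₂ x) (inj₁ y) = tri> (λ ()) (λ ()) tt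
    cmp (inj₂ x) (inj₂ y) with chain-cmp Y x y
    ... | tri< a b c = tri< a (λ { refl → b refl }) c
    ... | tri≈ a refl c = tri≈ a refl c
    ... | tri> a b c = tri> a (λ { refl → b refl }) c

  _⊗_ : Chain 0ℓ → Chain 0ℓ → Chain 0ℓ
  X ⊗ Y = mkChain (Carrier X × Carrier Y) lt irr tr cmp
    where
    lt : Carrier X × Carrier Y → Carrier X × Carrier Y → Set
    lt (x , y) (x′ , y′) = _<_ X x x′ ⊎ (x ≡ x′ × _<_ Y y y′)
    irr : ∀ {p} → ¬ lt p p
    irr (inj₁ p) = chain-irr X p
    irr (inj₂ (_ , p)) = chain-irr Y p
    tr : ∀ {p q r} → lt p q → lt q r → lt p r
    tr (inj₁ p) (inj₁ q) = inj₁ (chain-trans X p q)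
    tr (inj₁ p) (inj₂ (refl , q)) = inj₁ p
    tr (inj₂ (refl , p)) (inj₁ q) = inj₁ q
    tr (inj₂ (refl , p)) (inj₂ (refl , q)) = inj₂ (refl , chain-trans Y p q)
    cmp : ∀ p q → Tri (lt p q) (p ≡ q) (lt q p)
    cmp (x , y) (x′ , y′) with chain-cmp X x x′
    ... | tri< a b c = tri< (inj₁ a) (λ { refl → b refl }) λ { (inj₁ d) → c d ; (inj₂ (e , _)) → b (sym e) }
    ... | tri> a b c = tri> (λ { (inj₁ d) → a d ; (inj₂ (e , _)) → b e }) (λ { refl → b refl }) (inj₁ c)
    ... | tri≈ a refl c with chain-cmp Y y y′
    ...   | tri< d e f = tri< (inj₂ (refl , d)) (λ { refl → e refl }) λ { (inj₁ g) → c g ; (inj₂ (_ , g)) → f g }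
    ...   | tri≈ d refl f = tri≈ (λ { (inj₁ g) → c g ; (inj₂ (_ , g)) → f g }) refl λ { (inj₁ g) → c g ; (inj₂ (_ , g)) → f g }
    ...   | tri> d e f = tri> (λ { (inj₁ g) → a g ; (inj₂ (_ , g)) → d g }) (λ { refl → e refl }) (inj₂ (refl , f))

  upTo : ℕ → Chain 0ℓ
  upTo k = Sub ω (ℕ._≤ k)

  -- Below c y states that the old point c lies to the left of the new point y.
  record Insertion (C : Chain ℓ) (Y : Chain 0ℓ) : Set (lsuc ℓ) where
    field
      Below : Carrier C → Carrier Y → Set ℓ
      below-down : ∀ {c d y} → _<_ C c d → Below d y → Below c y
      below-up : ∀ {c y z} → Below c y → _<_ Y y z → Below c z

  module _ {C : Chain ℓ} {Y : Chain 0ℓ} (I : Insertion C Y) where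
    open Insertion I

    _<ᴵ_ : Carrier C ⊎ Carrier Y → Carrier C ⊎ Carrier Y → Set ℓ
    inj₁ c <ᴵ inj₁ d = _<_ C c d
    inj₁ c <ᴵ inj₂ y = Below c y
    inj₂ y <ᴵ inj₁ c = ¬ Below c y
    inj₂ y <ᴵ inj₂ z = Lift ℓ (_<_ Y y z)

    private
      tr : ∀ x y z → x <ᴵ y → y <ᴵ z → x <ᴵ z
      tr (inj₁ a) (inj₁ b) (inj₁ c) p q = chain-trans C p q
      tr (inj₁ a) (inj₁ b) (inj₂ c) p q = below-down p q
      tr (inj₁ a) (inj₂ b) (inj₁ c) p q with chain-cmp C a c
      ... | tri< r _ _ = r
      ... | tri≈ _ refl _ = ⊥-elim (q p)
      ... | tri> _ _ r = ⊥-elim (q (below-down r p))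
      tr (inj₁ a) (inj₂ b) (inj₂ c) p (lift q) = below-up p q
      tr (inj₂ a) (inj₁ b) (inj₁ c) p q r = p (below-down q r)
      tr (inj₂ a) (inj₁ b) (inj₂ c) p q with chain-cmp Y a c
      ... | tri< r _ _ = lift r
      ... | tri≈ _ refl _ = ⊥-elim (p q)
      ... | tri> _ _ r = ⊥-elim (p (below-up q r))
      tr (inj₂ a) (inj₂ b) (inj₁ c) (lift p) q r = q (below-up r p)
      tr (inj₂ a) (inj₂ b) (inj₂ c) (lift p) (lift q) = lift (chain-trans Y p q)

      irr : ∀ x → ¬ (x <ᴵ x)
      irr (inj₁ x) = chain-irr C
      irr (inj₂ x) (lift p) = chain-irr Y p

      cmp : ∀ x y → Tri (x <ᴵ y) (x ≡ y) (y <ᴵ x)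
      cmp (inj₁ x) (inj₁ y) with chain-cmp C x y
      ... | tri< a b c = tri< a (λ { refl → b refl }) c
      ... | tri≈ a refl c = tri≈ a refl c
      ... | tri> a b c = tri> a (λ { refl → b refl }) c
      cmp (inj₁ x) (inj₂ y) with em (Below x y)
      ... | yes b = tri< b (λ ()) λ ¬b → ¬b b
      ... | no ¬b = tri> ¬b (λ ()) ¬b
      cmp (inj₂ x) (inj₁ y) with em (Below y x)
      ... | yes b = tri> (λ ¬b → ¬b b) (λ ()) b
      ... | no ¬b = tri< ¬b (λ ()) ¬b
      cmp (inj₂ x) (inj₂ y) with chain-cmp Y x y
      ... | tri< a b c = tri< (lift a) (λ { refl → b refl }) λ (lift d) → c d
      ... | tri≈ a refl c = tri≈ (λ (lift d) → a d) refl λ (lift d) → c d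
      ... | tri> a b c = tri> (λ (lift d) → a d) (λ { refl → b refl }) (lift c)

    Insert : Chain ℓ
    Insert = mkChain (Carrier C ⊎ Carrier Y) _<ᴵ_ (λ {x} → irr x) (λ {x} {y} {z} → tr x y z) cmp

    insert↪ : C ↪ Insert
    insert↪ = mk↪ inj₁ id

  -- Finite clusters and patterns as isomorphism invariants.

  module Clusters (C : Chain ℓ) where
    open Order C

    infix 4 _⋖_

    _⋖_ : A → A → Set ℓ
    x ⋖ y = x ≺ y × (∀ z → ¬ (x ≺ z × z ≺ y))

    ⋖-unique : ∀ {x x′ y} → x ⋖ y → x′ ⋖ y → x ≡ x′
    ⋖-unique {x} {x′} (p , e) (p′ , e′) with tri x x′
    ... | tri< a _ _ = ⊥-elim (e _ (a , p′))
    ... | tri≈ _ b _ = b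
    ... | tri> _ _ c = ⊥-elim (e′ _ (c , p))

    -- Counts how often one can pass from `u` to an immediate predecessor before there is none. A
    -- point with infinitely many iterated predecessors has no `Run`.
    data Run : ℕ → A → Set ℓ where
      stop : ∀ {u} → (∀ v → ¬ (v ⋖ u)) → Run zero u
      step : ∀ {n u v} → v ⋖ u → Run n v → Run (suc n) u

    Run-unique : ∀ {m n u} → Run m u → Run n u → m ≡ n
    Run-unique (stop _) (stop _) = refl
    Run-unique (stop e) (step p _) = ⊥-elim (e _ p)
    Run-unique (step p _) (stop e) = ⊥-elim (e _ p)
    Run-unique {suc m} (step p r) (step q s) =
      cong suc (Run-unique r (subst (Run _) (⋖-unique q p) s))

  module _ {X Y : Chain ℓ} (φ : Iso X Y) where
    private
      module X = Clusters X
      module Y = Clusters Y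

    Iso-⋖ : ∀ {x y} → x X.⋖ y → app (fwd φ) x Y.⋖ app (fwd φ) y
    Iso-⋖ {x} {y} (p , e) = app-mono (fwd φ) p , λ z (q , r) → e (app (bwd φ) z)
      ( subst (λ t → _<_ X t (app (bwd φ) z)) (bwd-fwd φ x) (app-mono (bwd φ) q)
      , subst (_<_ X (app (bwd φ) z)) (bwd-fwd φ y) (app-mono (bwd φ) r))

    Iso-⋖⁻ : ∀ {x v} → v Y.⋖ app (fwd φ) x → app (bwd φ) v X.⋖ x
    Iso-⋖⁻ {x} {v} (p , e) =
      subst (_<_ X (app (bwd φ) v)) (bwd-fwd φ x) (app-mono (bwd φ) p) , λ z (q , r) → e (app (fwd φ) z)
        ( subst (λ t → _<_ Y t (app (fwd φ) z)) (fwd-bwd φ v) (app-mono (fwd φ) q)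
        , app-mono (fwd φ) r)

    Iso-Run : ∀ {n u} → X.Run n u → Y.Run n (app (fwd φ) u)
    Iso-Run (X.stop e) = Y.stop λ v p → e _ (Iso-⋖⁻ p)
    Iso-Run (X.step p r) = Y.step (Iso-⋖ p) (Iso-Run r)

  module Patterns (C : Chain ℓ) where
    open Order C
    open Clusters C
    private module Up = Clusters (op C)

    Limit : A → Set ℓ
    Limit p = (Σ A λ z → z ≺ p) × (∀ z → z ≺ p → Σ A λ z′ → z ≺ z′ × z′ ≺ p)

    Valid : ℕ → ℕ → ℕ → Set
    Valid i m n = m ≡ 0 → n ℕ.≤ i

    valid-suc : ∀ {i m n} → Valid i (suc m) n
    valid-suc ()

    valid-down : ∀ {i m n n′} → n′ ℕ.≤ n → Valid i m n → Valid i m n′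
    valid-down p v e = ℕₚ.≤-trans p (v e)

    -- A convex copy of (i + 1) + ω*·ω starting at p: the m-th block is … < e m 1 < e m 0,
    -- block 0 being cut off below e 0 i.
    record Pat (i : ℕ) (p : A) : Set ℓ where
      field
        e : ℕ → ℕ → A
        e-first : e 0 i ≡ p
        e-in : ∀ {m n} → Valid i m (suc n) → e m (suc n) ≺ e m n
        e-out : ∀ {m n n′} → Valid i m n → e m n ≺ e (suc m) n′
        convex : ∀ {z m n} → Valid i m n → p ≼ z → z ≼ e m n →
          Σ ℕ λ m′ → Σ ℕ λ n′ → Valid i m′ n′ × z ≡ e m′ n′

      e-in< : ∀ {m n n′} → n ℕ.< n′ → Valid i m n′ → e m n′ ≺ e m n
      e-in< {m} {n} p v = go (ℕₚ.<⇒<′ p) v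
        where
        go : ∀ {n′} → n ℕ.<′ n′ → Valid i m n′ → e m n′ ≺ e m n
        go ℕ.≤′-refl v = e-in v
        go (ℕ.≤′-step q) v = ≺-trans (e-in v) (go q (valid-down (ℕₚ.n≤1+n _) v))

      e-out< : ∀ {m m′ n n′} → m ℕ.< m′ → Valid i m n → e m n ≺ e m′ n′
      e-out< {m} {n = n} p v = go (ℕₚ.<⇒<′ p)
        where
        go : ∀ {m′ n′} → m ℕ.<′ m′ → e m n ≺ e m′ n′
        go ℕ.≤′-refl = e-out v
        go (ℕ.≤′-step q) = ≺-trans (go {n′ = 0} q) (e-out λ _ → ℕ.z≤n)

      e-order : ∀ {m n m′ n′} → Valid i m n → Valid i m′ n′ → e m n ≺ e m′ n′ → m ℕ.< m′ ⊎ (m ≡ m′ × n′ ℕ.< n)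
      e-order {m} {n} {m′} {n′} v v′ lt with ℕₚ.<-cmp m m′
      ... | tri< a _ _ = inj₁ a
      ... | tri> _ _ c = ⊥-elim (≺-irr (≺-trans lt (e-out< c v′)))
      ... | tri≈ _ refl _ with ℕₚ.<-cmp n n′
      ...   | tri< a _ _ = ⊥-elim (≺-irr (≺-trans lt (e-in< a v′)))
      ...   | tri≈ _ refl _ = ⊥-elim (≺-irr lt)
      ...   | tri> _ _ c = inj₂ (refl , c)

      first≼ : ∀ {m n} → Valid i m n → p ≼ e m n
      first≼ {zero} {n} v lt with e-order v (λ _ → ℕₚ.≤-refl) (subst (e 0 n ≺_) (sym e-first) lt)
      ... | inj₂ (_ , i<n) = ℕₚ.<⇒≱ i<n (v refl)
      first≼ {suc m} {n} v lt with e-order v (λ _ → ℕₚ.≤-refl) (subst (e (suc m) n ≺_) (sym e-first) lt)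
      ... | inj₁ ()
      ... | inj₂ ()

      pred-covers : ∀ {m n} → Valid i m (suc n) → e m (suc n) ⋖ e m n
      pred-covers {m} {n} v = e-in v , no-between
        where
        no-between : ∀ z → ¬ (e m (suc n) ≺ z × z ≺ e m n)
        no-between z (a , b) with convex {z} (valid-down (ℕₚ.n≤1+n n) v) (≼-trans (first≼ v) (≺⇒≼ a)) (≺⇒≼ b)
        ... | m′ , n′ , v′ , refl with e-order v v′ a | e-order v′ (valid-down (ℕₚ.n≤1+n n) v) b
        ...   | inj₁ p | inj₁ q = ℕₚ.<-asym p q
        ...   | inj₁ p | inj₂ (refl , _) = ℕₚ.<-irrefl refl p
        ...   | inj₂ (refl , _) | inj₁ q = ℕₚ.<-irrefl refl q
        ...   | inj₂ (refl , p) | inj₂ (_ , q) = ℕₚ.<⇒≱ q (ℕₚ.≤-pred p)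

      -- All points but the first have an immediate predecessor in the pattern. This is what singles
      -- out the first point of a pattern.
      not-limit : ∀ {m n} → Valid i m n → e m n ≡ p ⊎ ¬ Limit (e m n)
      not-limit {m} {n} v with valid? m
        where
        valid? : ∀ m → Valid i m n → (m ≡ 0 × n ≡ i) ⊎ Valid i m (suc n)
        valid? zero v with ℕₚ.m≤n⇒m<n∨m≡n (v refl)
        ... | inj₁ n<i = inj₂ λ _ → n<i
        ... | inj₂ n≡i = inj₁ (refl , n≡i)
        valid? (suc m) v = inj₂ λ ()
      ... | f with f v
      ...   | inj₁ (refl , refl) = inj₁ e-first
      ...   | inj₂ v′ = inj₂ λ (_ , lim) → case lim _ (e-in v′) of λ (z , a , b) → proj₂ (pred-covers v′) z (a , b)

      -- Block 1 descends towards `e 0 0` with nothing else in between, so the finite block visibly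
      -- ends there.
      no-succ : ∀ y → ¬ (e 0 0 ⋖ y)
      no-succ y (lt , nb) with split (e 1 0) y
      ... | inj₁ a = nb _ (e-out (λ _ → ℕ.z≤n) , a)
      ... | inj₂ a with convex {y} valid-suc (≼-trans (first≼ (λ _ → ℕ.z≤n)) (≺⇒≼ lt)) a
      ...   | zero , n , v , refl with e-order (λ _ → ℕ.z≤n) v lt
      ...     | inj₂ (_ , ())
      no-succ y (lt , nb) | inj₂ a | suc m , n , v , refl =
        nb (e (suc m) (suc n)) (e-out< (ℕ.s≤s ℕ.z≤n) (λ _ → ℕ.z≤n) , e-in valid-suc)

      -- Counted in the opposite chain, because the finite block is closed off at its upper end;
      -- with `Run-unique` this reads `i` off from `p`.
      run-up : ∀ n → n ℕ.≤ i → Up.Run n (e 0 n)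
      run-up zero _ = Up.stop λ y (lt , nb) → no-succ y (lt , λ z (a , b) → nb z (b , a))
      run-up (suc n) p = Up.step
        (proj₁ cov , λ z (a , b) → proj₂ cov z (b , a)) (run-up n (ℕₚ.≤-trans (ℕₚ.n≤1+n n) p))
        where
        cov : e 0 (suc n) ⋖ e 0 n
        cov = pred-covers λ _ → p

      -- From `e m n` only `n` consecutive steps upwards are possible: they end at `e m 0`, to which
      -- the next block descends. So no `ω` of consecutive points starts inside a pattern.
      no-chain : ∀ k (u : ℕ → A) → (∀ j → u j ⋖ u (suc j)) → ∀ m n → n ℕ.≤ k → Valid i m n → ¬ (u 0 ≡ e m n)
      no-chain k u cov m n n≤k v eq₀ with subst (_⋖ u 1) eq₀ (cov 0)
      ... | lt , nb with split (e (suc m) 0) (u 1)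
      ... | inj₁ a = nb _ (e-out v , a)
      ... | inj₂ a with convex {u 1} valid-suc (≼-trans (first≼ v) (≺⇒≼ lt)) a
      ...   | m′ , n′ , v′ , eq with e-order v v′ (subst (e m n ≺_) eq lt)
      ...     | inj₁ p = nb (e m′ (suc n′)) (e-out< p v , subst (e m′ (suc n′) ≺_) (sym eq) (e-in λ { refl → ⊥-elim (ℕₚ.<⇒≱ p ℕ.z≤n) }))
      no-chain zero u cov m .zero ℕ.z≤n v eq₀ | lt , nb | inj₂ a | m′ , n′ , v′ , eq | inj₂ (refl , ())
      no-chain (suc k) u cov m n n≤k v eq₀ | lt , nb | inj₂ a | m′ , n′ , v′ , eq | inj₂ (refl , p) =
        no-chain k (λ j → u (suc j)) (λ j → cov (suc j)) m n′ (ℕₚ.≤-pred (ℕₚ.≤-trans p n≤k)) v′ eq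

    open Pat public

    Pat-unique : ∀ {i j p} → Pat i p → Pat j p → i ≡ j
    Pat-unique {i} {j} h h′ = Up.Run-unique
      (subst (Up.Run i) (e-first h) (run-up h i ℕₚ.≤-refl)) (subst (Up.Run j) (e-first h′) (run-up h′ j ℕₚ.≤-refl))

    PatAt : A → Set ℓ
    PatAt p = Limit p × Σ ℕ λ i → Pat i p

    -- A copy of `ω*·ω` that, unlike a pattern, need not be convex.
    record Big (x y : A) : Set ℓ where
      field
        t : ℕ → ℕ → A
        t-in : ∀ m n → t m (suc n) ≺ t m n
        t-out : ∀ m n n′ → t m n ≺ t (suc m) n′
        t-lower : ∀ m n → x ≼ t m n
        t-upper : ∀ m n → t m n ≼ y

  module _ {X Y : Chain ℓ} (φ : Iso X Y) where
    private
      module X = Order X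
      module Y = Order Y
      module PX = Patterns X
      module PY = Patterns Y

    Iso-≼⁻ : ∀ {x y} → app (fwd φ) x Y.≼ y → x X.≼ app (bwd φ) y
    Iso-≼⁻ {x} {y} p q = p (subst (Y._≺ app (fwd φ) x) (fwd-bwd φ y) (app-mono (fwd φ) q))

    Iso-≼⁻′ : ∀ {x y} → y Y.≼ app (fwd φ) x → app (bwd φ) y X.≼ x
    Iso-≼⁻′ {x} {y} p q = p (subst (app (fwd φ) x Y.≺_) (fwd-bwd φ y) (app-mono (fwd φ) q))

    Iso-PatAt : ∀ {i p} → PX.Limit p → PX.Pat i p → PY.Limit (app (fwd φ) p) × PY.Pat i (app (fwd φ) p)
    Iso-PatAt {i} {p} ((z₀ , z₀≺) , lim) h = ((f z₀ , app-mono (fwd φ) z₀≺) , lim′) , record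
      { e = λ m n → f (PX.e h m n)
      ; e-first = cong f (PX.e-first h)
      ; e-in = λ v → app-mono (fwd φ) (PX.e-in h v)
      ; e-out = λ v → app-mono (fwd φ) (PX.e-out h v)
      ; convex = λ {z} v a b → case PX.convex h v (Iso-≼⁻ a) (Iso-≼⁻′ b) of
          λ (m , n , v′ , eq) → m , n , v′ , trans (sym (fwd-bwd φ z)) (cong f eq) }
      where
      f = app (fwd φ)
      lim′ : ∀ z → z Y.≺ f p → Σ (Carrier Y) λ z′ → z Y.≺ z′ × z′ Y.≺ f p
      lim′ z q with lim (app (bwd φ) z) (subst (app (bwd φ) z X.≺_) (bwd-fwd φ p) (app-mono (bwd φ) q))
      ... | z′ , a , b = f z′ , subst (Y._≺ f z′) (fwd-bwd φ z) (app-mono (fwd φ) a) , app-mono (fwd φ) b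

  -- Inserting a pattern into a chain that has none, and removing patterns.

  module InsertPattern (C : Chain ℓ) (none : ∀ p → ¬ Patterns.PatAt C p) (f : C ↪ C) (c : Carrier C)
    (big : Patterns.Big C c (app f c)) where
    open Order C
    open Patterns C
    open Big big

    -- The upper side of the cut at the lower end of block 0 of the given copy. It has no least
    -- point, so the insertion creates no new left limit among its points.
    U : A → Set ℓ
    U z = Σ ℕ λ n → t 0 n ≼ z

    Block : ℕ → Chain 0ℓ
    Block k = Sub (ω ⊗ ω*) λ (m , n) → Valid k m n

    ins : ∀ k → Insertion C (ω ⊕ Block k)
    ins k = record { Below = λ z _ → ¬ U z ; below-down = λ p ¬u (n , q) → ¬u (n , ≼-trans q (≺⇒≼ p)) ; below-up = λ b _ → b }

    S : ℕ → Chain ℓ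
    S k = Insert (ins k)

    private
      F : A → A
      F = app f
      F-mono : Mono F
      F-mono = app-mono f
      F-≼ : ∀ {x y} → x ≼ y → F x ≼ F y
      F-≼ = ↪-≼ f

    module _ (k : ℕ) where
      module O = Order (S k)
      module P = Patterns (S k)

      -- Points outside `U` lie below `F c` and stay. Moving `U` by three steps of `f` leaves two
      -- gaps: the new `ω` goes between `F c` and `F (F c)`, the new blocks between `F (F c)` and
      -- `F (F (F c))`, both along images of the given copy.
      retract : S k ↪ C
      retract = mk↪ r λ {x} {y} → r-mono x y
        where
        r₁ : ∀ z → Dec (U z) → A
        r₁ z (yes _) = F (F (F z))
        r₁ z (no _) = z
        r : Carrier (S k) → A
        r (inj₁ z) = r₁ z (em (U z))
        r (inj₂ (inj₁ i)) = F (t (suc i) 0)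
        r (inj₂ (inj₂ (sub (m , n) _))) = F (F (t m n))
        c≺ : ∀ {m n} → c ≺ t (suc m) n
        c≺ {m} {n} = ≼-≺ (t-lower m 0) (t-out m 0 n)
        ≺fc : ∀ {m n} → t m n ≺ F c
        ≺fc {m} {n} = ≺-≼ (t-out m n 0) (t-upper (suc m) 0)
        c≺fc : c ≺ F c
        c≺fc = ≼-≺ (t-lower 0 0) ≺fc
        U-high : ∀ {z} → U z → F (F (F c)) ≼ F (F (F z))
        U-high (n , p) = F-≼ (F-≼ (F-≼ (≼-trans (t-lower 0 n) p)))
        U-low : ∀ {z} → ¬ U z → z ≺ F c
        U-low {z} ¬u = case split z (F c) of λ where
          (inj₁ p) → p
          (inj₂ p) → ⊥-elim (¬u (0 , ≼-trans (≺⇒≼ ≺fc) p))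
        t-mono : ∀ {m n m′ n′} → _<_ (ω ⊗ ω*) (m , n) (m′ , n′) → t m n ≺ t m′ n′
        t-mono {m} {n} (inj₁ p) = go (ℕₚ.<⇒<′ p)
          where
          go : ∀ {m′ n′} → m ℕ.<′ m′ → t m n ≺ t m′ n′
          go ℕ.≤′-refl = t-out m n _
          go (ℕ.≤′-step q) = ≺-trans (go {n′ = 0} q) (t-out _ 0 _)
        t-mono {m} {n} {_} {n′} (inj₂ (refl , p)) = go (ℕₚ.<⇒<′ p)
          where
          go : ∀ {n} → n′ ℕ.<′ n → t m n ≺ t m n′
          go ℕ.≤′-refl = t-in m _
          go (ℕ.≤′-step q) = ≺-trans (t-in m _) (go q)
        r₁-mono : ∀ x y (dx : Dec (U x)) (dy : Dec (U y)) → x ≺ y → r₁ x dx ≺ r₁ y dy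
        r₁-mono x y (yes _) (yes _) p = F-mono (F-mono (F-mono p))
        r₁-mono x y (yes (n , u)) (no ¬v) p = ⊥-elim (¬v (n , ≼-trans u (≺⇒≼ p)))
        r₁-mono x y (no ¬u) (yes v) p = ≺-≼ (U-low ¬u) (≼-trans (≺⇒≼ (≺-trans (F-mono c≺fc) (F-mono (F-mono c≺fc)))) (U-high v))
        r₁-mono x y (no _) (no _) p = p
        r-mono : ∀ x y → x O.≺ y → r x ≺ r y
        r-mono (inj₁ x) (inj₁ y) p = r₁-mono x y (em (U x)) (em (U y)) p
        r-mono (inj₁ x) (inj₂ y) p = ≺-≼ (case em (U x) of λ d → low x d p) (high y)
          where
          low : ∀ x (d : Dec (U x)) → ¬ U x → r₁ x (em (U x)) ≺ F c
          low x _ ¬u with em (U x)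
          ... | yes u = ⊥-elim (¬u u)
          ... | no _ = U-low ¬u
          high : ∀ y → F c ≼ r (inj₂ y)
          high (inj₁ i) = F-≼ (≺⇒≼ c≺)
          high (inj₂ (sub (m , n) _)) = ≼-trans (≺⇒≼ (F-mono c≺fc)) (F-≼ (F-≼ (t-lower m n)))
        r-mono (inj₂ x) (inj₁ y) p = high y p
          where
          low : ∀ x → r (inj₂ x) ≺ F (F (F c))
          low (inj₁ i) = ≺-trans (F-mono ≺fc) (F-mono (F-mono c≺fc))
          low (inj₂ (sub (m , n) _)) = F-mono (F-mono ≺fc)
          high : ∀ y → ¬ ¬ U y → r (inj₂ x) ≺ r₁ y (em (U y))
          high y ¬¬u with em (U y)
          ... | yes u = ≺-≼ (low x) (U-high u)
          ... | no ¬u = ⊥-elim (¬¬u ¬u)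
        r-mono (inj₂ (inj₁ i)) (inj₂ (inj₁ j)) (lift p) = F-mono (t-mono (inj₁ (ℕ.s≤s p)))
        r-mono (inj₂ (inj₁ i)) (inj₂ (inj₂ (sub (m , n) _))) p = ≺-≼ (F-mono ≺fc) (F-≼ (F-≼ (t-lower m n)))
        r-mono (inj₂ (inj₂ x)) (inj₂ (inj₁ i)) (lift ())
        r-mono (inj₂ (inj₂ (sub _ _))) (inj₂ (inj₂ (sub _ _))) (lift p) = F-mono (F-mono (t-mono p))

      -- Makes `blk` total, as `Pat` asks for a function on all pairs: invalid indices of block 0
      -- are cut back to `k`.
      clamp : ∀ m n → Valid k m (case m of λ { zero → n ℕ.⊓ k ; (suc _) → n })
      clamp zero n _ = ℕₚ.m⊓n≤n n k
      clamp (suc m) n ()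

      blk : ℕ → ℕ → Carrier (S k)
      blk m n = inj₂ (inj₂ (sub (m , _) (clamp m n)))

      q : Carrier (S k)
      q = inj₂ (inj₂ (sub (0 , k) (λ _ → ℕₚ.≤-refl)))

      blk-valid : ∀ m n .(v : Valid k m n) → inj₂ (inj₂ (sub (m , n) v)) ≡ blk m n
      blk-valid zero n v = go n (n ℕ.⊓ k) (sym (ℕₚ.m≤n⇒m⊓n≡m n≤k))
        where
        n≤k : n ℕ.≤ k
        n≤k = ℕₚ.≮⇒≥ λ k<n → ⊥-elim-irr (ℕₚ.<⇒≱ k<n (v refl))
        go : ∀ n n′ → n ≡ n′ → .{v : Valid k 0 n} .{v′ : Valid k 0 n′} →
          _≡_ {A = Carrier (S k)} (inj₂ (inj₂ (sub (0 , n) v))) (inj₂ (inj₂ (sub (0 , n′) v′)))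
        go n .n refl = refl
      blk-valid (suc m) n v = refl

      blk-order : ∀ {m n m′ n′} .(v : Valid k m n) .(v′ : Valid k m′ n′) → _<_ (ω ⊗ ω*) (m , n) (m′ , n′) → blk m n O.≺ blk m′ n′
      blk-order {m} {n} {m′} {n′} v v′ p = subst₂ O._≺_ (blk-valid m n v) (blk-valid m′ n′ v′) (lift p)

      -- The new `ω` was put in front of the blocks so as to be cofinal below `q`.
      q-limit : P.Limit q
      q-limit = (inj₂ (inj₁ 0) , lift tt) , lim
        where
        lim : ∀ z → z O.≺ q → Σ O.A λ z′ → z O.≺ z′ × z′ O.≺ q
        lim (inj₁ z) ¬u = inj₂ (inj₁ 0) , ¬u , lift tt
        lim (inj₂ (inj₁ i)) _ = inj₂ (inj₁ (suc i)) , lift ℕₚ.≤-refl , lift tt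
        lim (inj₂ (inj₂ (sub (m , n) _))) (lift (inj₁ ()))
        lim (inj₂ (inj₂ (sub (.0 , n) v))) (lift (inj₂ (refl , k<n))) = ⊥-elim-irr (ℕₚ.<⇒≱ k<n (v refl))

      q-pat : P.Pat k q
      q-pat = record
        { e = blk
        ; e-first = sym (blk-valid 0 k (λ _ → ℕₚ.≤-refl))
        ; e-in = λ v → blk-order v (valid-down (ℕₚ.n≤1+n _) v) (inj₂ (refl , ℕₚ.≤-refl))
        ; e-out = λ v → blk-order v valid-suc (inj₁ ℕₚ.≤-refl)
        ; convex = λ {z} v a b → conv z a b }
        where
        conv : ∀ z {m n} → q O.≼ z → z O.≼ blk m n → Σ ℕ λ m′ → Σ ℕ λ n′ → Valid k m′ n′ × z ≡ blk m′ n′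
        conv (inj₁ z) a b = ⊥-elim (b a)
        conv (inj₂ (inj₁ i)) a b = ⊥-elim (a (lift tt))
        conv (inj₂ (inj₂ (sub (m , n) v))) a b = m , n , vv m v , blk-valid m n v
          where
          vv : ∀ m .(v : Valid k m n) → Valid k m n
          vv zero v _ = ℕₚ.≮⇒≥ λ k<n → ⊥-elim-irr (ℕₚ.<⇒≱ k<n (v refl))
          vv (suc m) v ()

      o-covers : ∀ i → Clusters._⋖_ (S k) (inj₂ (inj₁ i)) (inj₂ (inj₁ (suc i)))
      o-covers i = lift ℕₚ.≤-refl , nb
        where
        nb : ∀ z → ¬ (inj₂ (inj₁ i) O.≺ z × z O.≺ inj₂ (inj₁ (suc i)))
        nb (inj₁ z) (a , b) = a b
        nb (inj₂ (inj₁ j)) (lift a , lift b) = ℕₚ.<⇒≱ a (ℕₚ.≤-pred b)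
        nb (inj₂ (inj₂ _)) (_ , lift ())

      old-pattern : ∀ {i z} → (h : P.Pat i (inj₁ z)) → (∀ {m n} → Valid i m n → Σ A λ y → P.e h m n ≡ inj₁ y) → Pat i z
      old-pattern {i} {z} h old = record
        { e = λ m n → u (P.e h m n)
        ; e-first = cong u (P.e-first h)
        ; e-in = λ v → u-mono (old v) (old (valid-down (ℕₚ.n≤1+n _) v)) (P.e-in h v)
        ; e-out = λ v → u-mono (old v) (old valid-suc) (P.e-out h v)
        ; convex = λ {y} v a b → case P.convex h {inj₁ y} v a (back (old v) b) of λ (m , n , v′ , eq) → m , n , v′ , cong u eq }
        where
        u : Carrier (S k) → A
        u (inj₁ y) = y
        u (inj₂ _) = z
        u-mono : ∀ {x y} → (Σ A λ x′ → x ≡ inj₁ x′) → (Σ A λ y′ → y ≡ inj₁ y′) → x O.≺ y → u x ≺ u y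
        u-mono (_ , refl) (_ , refl) p = p
        back : ∀ {x y} → (Σ A λ x′ → x ≡ inj₁ x′) → y ≼ u x → inj₁ y O.≼ x
        back (_ , refl) p = p

      sort : ∀ (x : Carrier (S k)) → (Σ A λ y → x ≡ inj₁ y) ⊎ (Σ (ℕ ⊎ Carrier (Block k)) λ y → x ≡ inj₂ y)
      sort (inj₁ y) = inj₁ (y , refl)
      sort (inj₂ y) = inj₂ (y , refl)

      -- Starting above the cut, the pattern consists of old points; the points `t 0 n` just above
      -- the cut show that its first point was a left limit before the insertion as well.
      no-right : ∀ {z i} → U z → P.Limit (inj₁ z) → P.Pat i (inj₁ z) → ⊥
      no-right {z} {i} (n₀ , u) lim h = none z (((t 0 (suc n₀) , ≺-≼ (t-in 0 n₀) u) , lim′) , i , old-pattern h old)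
        where
        old : ∀ {m n} → Valid i m n → Σ A λ y → P.e h m n ≡ inj₁ y
        old {m} {n} v = case sort (P.e h m n) of λ where
          (inj₁ r) → r
          (inj₂ (y , eq)) → ⊥-elim (subst (inj₁ z O.≼_) eq (P.first≼ h v) λ ¬u → ¬u (n₀ , u))
        lim″ : ∀ y → (Σ O.A λ y′ → inj₁ y O.≺ y′ × y′ O.≺ inj₁ z) → U y → Σ A λ y′ → y ≺ y′ × y′ ≺ z
        lim″ y (inj₁ y′ , a , b) _ = y′ , a , b
        lim″ y (inj₂ y′ , a , b) u = ⊥-elim (a u)
        lim′ : ∀ y → y ≺ z → Σ A λ y′ → y ≺ y′ × y′ ≺ z
        lim′ y y≺z = case split y (t 0 (suc n₀)) of λ where
          (inj₁ p) → t 0 (suc n₀) , p , ≺-≼ (t-in 0 n₀) u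
          (inj₂ p) → lim″ y (proj₂ lim (inj₁ y) y≺z) (suc n₀ , p)

      -- By convexity a pattern crossing the cut would contain the new `ω`, which `no-chain`
      -- forbids; so it stays to the left and is old.
      no-left : ∀ {z i} → ¬ U z → P.Limit (inj₁ z) → P.Pat i (inj₁ z) → ⊥
      no-left {z} {i} ¬u lim h = none z ((low (proj₁ lim) , λ y y≺z → lim′ y (proj₂ lim (inj₁ y) y≺z)) , i , old-pattern h old)
        where
        low : (Σ O.A λ y → y O.≺ inj₁ z) → Σ A λ y → y ≺ z
        low (inj₁ y , p) = y , p
        low (inj₂ y , p) = ⊥-elim (p ¬u)
        lim′ : ∀ y → (Σ O.A λ y′ → inj₁ y O.≺ y′ × y′ O.≺ inj₁ z) → Σ A λ y′ → y ≺ y′ × y′ ≺ z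
        lim′ y (inj₁ y′ , a , b) = y′ , a , b
        lim′ y (inj₂ y′ , a , b) = ⊥-elim (b ¬u)
        meets : ∀ {m n} → Valid i m n → ¬ (inj₂ (inj₁ 0) O.≼ P.e h m n)
        meets v le = case P.convex h {inj₂ (inj₁ 0)} v (λ p → p ¬u) le of λ (m′ , n′ , v′ , eq) →
          P.no-chain h n′ (λ j → inj₂ (inj₁ j)) o-covers m′ n′ ℕₚ.≤-refl v′ eq
        o-first : ∀ y → inj₂ (inj₁ 0) O.≼ inj₂ y
        o-first (inj₁ i) (lift ())
        o-first (inj₂ _) (lift ())
        old : ∀ {m n} → Valid i m n → Σ A λ y → P.e h m n ≡ inj₁ y
        old {m} {n} v = case sort (P.e h m n) of λ where
          (inj₁ r) → r
          (inj₂ (y , eq)) → ⊥-elim (meets v (subst (inj₂ (inj₁ 0) O.≼_) (sym eq) (o-first y)))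

      valid-irr : ∀ m {n} → .(Valid k m n) → Valid k m n
      valid-irr zero v _ = ℕₚ.≮⇒≥ λ k<n → ⊥-elim-irr (ℕₚ.<⇒≱ k<n (v refl))
      valid-irr (suc m) v ()

      -- Forces an isomorphism to send one `q` to the other, where `Pat-unique` compares the
      -- indices.
      only-q : ∀ p {i} → P.Limit p → P.Pat i p → p ≡ q
      only-q (inj₁ z) lim h = case em (U z) of λ where
        (yes u) → ⊥-elim (no-right u lim h)
        (no ¬u) → ⊥-elim (no-left ¬u lim h)
      only-q (inj₂ (inj₁ j)) {i} lim h = ⊥-elim (P.no-chain h i (λ l → inj₂ (inj₁ (l ℕ.+ j)))
        (λ l → o-covers (l ℕ.+ j)) 0 i ℕₚ.≤-refl (λ _ → ℕₚ.≤-refl) (sym (P.e-first h)))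
      only-q (inj₂ (inj₂ (sub (m , n) v))) lim h = case P.not-limit q-pat {m} {n} (valid-irr m v) of λ where
        (inj₁ eq) → trans (blk-valid m n v) eq
        (inj₂ ¬lim) → ⊥-elim (¬lim (subst P.Limit (blk-valid m n v) lim))

    sibInf : SibInf C
    sibInf = S , (λ k → insert↪ (ins k) , retract k) , distinct
      where
      distinct : ∀ m n → Iso (S m) (S n) → m ≡ n
      distinct m n φ with Iso-PatAt φ (q-limit m) (q-pat m)
      ... | lim , h = Patterns.Pat-unique (S n) (subst (Patterns.Pat (S n) m) (only-q n _ lim h) h) (q-pat n)

  -- Deleting the finite cluster that opens each pattern; the pattern is shifted by one block.
  module Normalise (C : Chain ℓ) where
    open Order C
    open Patterns C

    private
      -- Replaces any proof of `PatAt p` by the one found by `em`, so that all points of a pattern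
      -- are numbered by the same copy.
      get : ∀ {p} → Dec (PatAt p) → PatAt p → PatAt p
      get (yes h) _ = h
      get (no ¬h) h = ⊥-elim (¬h h)

      get-irr : ∀ {p} (d : Dec (PatAt p)) (h h′ : PatAt p) → get d h ≡ get d h′
      get-irr (yes _) _ _ = refl
      get-irr (no ¬h) h _ = ⊥-elim (¬h h)

    index : ∀ {p} → PatAt p → ℕ
    index {p} h = proj₁ (proj₂ (get (em (PatAt p)) h))

    pat : ∀ {p} (h : PatAt p) → Pat (index h) p
    pat {p} h = proj₂ (proj₂ (get (em (PatAt p)) h))

    In : A → A → Set ℓ
    In z p = Σ (PatAt p) λ h → Σ ℕ λ m → Σ ℕ λ n → Valid (index h) m n × z ≡ e (pat h) m n

    In-same : ∀ {z p} (h h′ : PatAt p) {m n} → Valid (index h) m n × z ≡ e (pat h) m n →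
      Valid (index h′) m n × z ≡ e (pat h′) m n
    In-same {z} {p} h h′ {m} {n} = subst (λ g → Valid (proj₁ (proj₂ g)) m n × z ≡ e (proj₂ (proj₂ g)) m n)
      (get-irr (em (PatAt p)) h h′)

    In-first : ∀ {z p} → In z p → p ≼ z
    In-first (h , m , n , v , refl) = first≼ (pat h) v

    In-convex : ∀ {y z p} → In z p → p ≼ y → y ≼ z → In y p
    In-convex (h , m , n , v , refl) a b = h , convex (pat h) v a b

    In-limit : ∀ {z p} → In z p → Limit z → z ≡ p
    In-limit (h , m , n , v , refl) lim with not-limit (pat h) v
    ... | inj₁ eq = eq
    ... | inj₂ ¬lim = ⊥-elim (¬lim lim)

    -- By convexity the later of the two first points lies in the other pattern; being a left limit,
    -- it is the first point there too.
    In-unique : ∀ {z p p′} → In z p → In z p′ → p ≡ p′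
    In-unique {z} {p} {p′} a b with ≼-total p p′
    ... | inj₁ le = sym (In-limit (In-convex a le (In-first b)) (proj₁ (proj₁ b)))
    ... | inj₂ le = In-limit (In-convex b le (In-first a)) (proj₁ (proj₁ a))

    above : ∀ {z p y} → In z p → z ≼ y → ¬ In y p → ∀ {w} → In w p → w ≺ y
    above {z} {p} {y} a le ¬b {w} c with split w y
    ... | inj₁ lt = lt
    ... | inj₂ le′ = ⊥-elim (¬b (In-convex c (≼-trans (In-first a) le) le′))

    Shift : A → A → Set ℓ
    Shift z w = (Σ A λ p → Σ (PatAt p) λ h → Σ ℕ λ m → Σ ℕ λ n →
        (Valid (index h) m n × z ≡ e (pat h) m n) × w ≡ e (pat h) (suc m) n)
      ⊎ ((∀ p → ¬ In z p) × w ≡ z)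

    opaque
      shift : ∀ z → Σ A (Shift z)
      shift z with em (Σ A (In z))
      ... | yes (p , h , m , n , v) = e (pat h) (suc m) n , inj₁ (p , h , m , n , v , refl)
      ... | no ¬in = z , inj₂ ((λ p i → ¬in (p , i)) , refl)

    Shift-≽ : ∀ {z w} → Shift z w → z ≼ w
    Shift-≽ (inj₁ (p , h , m , n , (v , refl) , refl)) = ≺⇒≼ (e-out (pat h) v)
    Shift-≽ (inj₂ (_ , refl)) = ≼-refl

    Shift-mono : ∀ {x y x′ y′} → Shift x x′ → Shift y y′ → x ≺ y → x′ ≺ y′
    Shift-mono (inj₂ (_ , refl)) sy p = ≺-≼ p (Shift-≽ sy)
    Shift-mono {x} {y} (inj₁ (p , h , m , n , (v , refl) , refl)) (inj₂ (¬in , refl)) lt =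
      above (h , m , n , v , refl) (≺⇒≼ lt) (¬in p) (h , suc m , n , valid-suc , refl)
    Shift-mono {x} {y} (inj₁ (p , h , m , n , (v , refl) , refl)) sy@(inj₁ (p′ , h′ , m′ , n′ , v′ , refl)) lt
      with em (In y p)
    ... | no ¬in = ≺-≼ (above (h , m , n , v , refl) (≺⇒≼ lt) ¬in (h , suc m , n , valid-suc , refl)) (Shift-≽ sy)
    ... | yes i with In-unique i (h′ , m′ , n′ , v′)
    ...   | refl with In-same h′ h {m′} {n′} v′
    ...     | w , refl = subst (e (pat h) (suc m) n ≺_) (cong (λ g → e (proj₂ (proj₂ g)) (suc m′) n′) (get-irr (em (PatAt p)) h h′))
                (order (e-order (pat h) v w lt))
      where
      order : m ℕ.< m′ ⊎ (m ≡ m′ × n′ ℕ.< n) → e (pat h) (suc m) n ≺ e (pat h) (suc m′) n′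
      order (inj₁ q) = e-out< (pat h) (ℕ.s≤s q) valid-suc
      order (inj₂ (refl , q)) = e-in< (pat h) q valid-suc

    Deleted : A → Set ℓ
    Deleted z = Σ A λ p → Σ (PatAt p) λ h → Σ ℕ λ n → Valid (index h) 0 n × z ≡ e (pat h) 0 n

    block-kept : ∀ {p} (h : PatAt p) m n → ¬ Deleted (e (pat h) (suc m) n)
    block-kept h m n (p′ , h′ , n′ , v′) with In-unique (h , suc m , n , valid-suc , refl) (h′ , 0 , n′ , v′)
    ... | refl with In-same h′ h {0} {n′} v′
    ...   | w , eq with e-out< (pat h) {n′ = n} (ℕ.s≤s (ℕ.z≤n {m})) w
    ...     | lt = ≺-irr (subst (_≺ e (pat h) (suc m) n) (sym eq) lt)

    Shift-kept : ∀ {z w} → Shift z w → ¬ Deleted w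
    Shift-kept (inj₁ (p , h , m , n , _ , refl)) = block-kept h m n
    Shift-kept (inj₂ (¬in , refl)) (p , h , n , v) = ¬in p (h , 0 , n , v)

    N : Chain ℓ
    N = Sub C (λ z → ¬ Deleted z)

    private
      module O = Order N
      module P = Patterns N

    N↪ : N ↪ C
    N↪ = mk↪ val id

    ↪N : C ↪ N
    ↪N = mk↪ (λ z → sub (proj₁ (shift z)) (Shift-kept (proj₂ (shift z)))) λ {x} {y} → Shift-mono (proj₂ (shift x)) (proj₂ (shift y))

    -- A deleted point below `p` can be replaced by one of block 1 of its own pattern. That pattern
    -- lies entirely below `p`, since the left limit `p` could only be its first point.
    kept-below : ∀ {p y} → PatAt p → y ≺ p → Σ A λ y′ → (y ≺ y′ × y′ ≺ p) × ¬ Deleted y′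
    kept-below {p} {y} h y≺p with proj₂ (proj₁ h) y y≺p
    ... | z , a , b with em (Deleted z)
    ...   | no ¬d = z , (a , b) , ¬d
    ...   | yes (p′ , h′ , n , v) = e (pat h′) 1 0 ,
              ( ≺-≼ a (≼-trans (≡⇒≼ (proj₂ v)) (≺⇒≼ (e-out (pat h′) (proj₁ v))))
              , above (h′ , 0 , n , v) (≺⇒≼ b) ¬in (h′ , 1 , 0 , valid-suc , refl)) , block-kept h′ 0 0
      where
      ¬in : ¬ In p p′
      ¬in i = ≺-irr (≺-≼ b (≼-trans (≡⇒≼ (In-limit i (proj₁ h))) (In-first (h′ , 0 , n , v))))

    -- Recovers in `C` a left limit known only for kept points. If `p` belongs to the pattern of
    -- `y`, it lies in a later block and has a kept immediate predecessor, against the hypothesis.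
    not-below : ∀ {y p} → Deleted y → ¬ Deleted p → y ≺ p → (∀ u → u ≺ p → ¬ Deleted u → Σ A λ z → (u ≺ z × z ≺ p) × ¬ Deleted z) →
      Σ A λ z → y ≺ z × z ≺ p
    not-below {y} {p} (p′ , h′ , n , v , refl) kept lt lim with em (In p p′)
    ... | no ¬in = e (pat h′) 1 0 , e-out (pat h′) v , above (h′ , 0 , n , v , refl) (≺⇒≼ lt) ¬in (h′ , 1 , 0 , valid-suc , refl)
    ... | yes (h , zero , n₁ , w) = ⊥-elim (kept (p′ , h , n₁ , w))
    ... | yes (h , suc m , n₁ , w , refl) with lim (e (pat h) (suc m) (suc n₁)) (e-in (pat h) valid-suc) (block-kept h m (suc n₁))
    ...   | z , ab , _ = ⊥-elim (proj₂ (pred-covers (pat h) {suc m} {n₁} valid-suc) z ab)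

    module _ {i : ℕ} {x : Carrier N} (lim : P.Limit x) (h : P.Pat i x) where
      private
        lim-kept : ∀ u → u ≺ val x → ¬ Deleted u → Σ A λ z → (u ≺ z × z ≺ val x) × ¬ Deleted z
        lim-kept u lt ¬d with proj₂ lim (sub u ¬d) lt
        ... | z , a , b = val z , (a , b) , prf′ z

        limit : Limit (val x)
        limit = (val (proj₁ (proj₁ lim)) , proj₂ (proj₁ lim)) , go
          where
          go : ∀ z → z ≺ val x → Σ A λ z′ → z ≺ z′ × z′ ≺ val x
          go z lt with em (Deleted z)
          ... | no ¬d = let (z′ , ab , _) = lim-kept z lt ¬d in z′ , ab
          ... | yes d = not-below d (prf′ x) lt lim-kept

        -- A deleted point inside the pattern would give an ascending sequence in it.
        no-deleted : ∀ {z m n} → Valid i m n → val x ≼ z → z ≼ val (P.e h m n) → ¬ Deleted z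
        no-deleted {z} {m} {n} v a b (p , hp , n₁ , w) = rise m i 0 i (ℕₚ.m≤m+n m 0) ℕₚ.≤-refl (λ _ → ℕₚ.≤-refl)
          (subst (λ t → val t ≺ p) (sym (P.e-first h)) x≺p)
          where
          In-z : In z p
          In-z = hp , 0 , n₁ , w
          z≺ : z ≺ val (P.e h m n)
          z≺ with ≼⇒≺⊎≡ b
          ... | inj₁ lt = lt
          ... | inj₂ refl = ⊥-elim (prf′ (P.e h m n) (p , hp , n₁ , w))
          x≺p : val x ≺ p
          x≺p with split (val x) p
          ... | inj₁ lt = lt
          ... | inj₂ le with convex (pat hp) (proj₁ w) le (≼-trans a (≡⇒≼ (proj₂ w)))
          ...   | suc m′ , n′ , v′ , eq = ⊥-elim (≺-irr (≺-≼ (e-out< (pat hp) (ℕ.s≤s (ℕ.z≤n {m′})) (proj₁ w))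
                    (≼-trans (≡⇒≼ (sym eq)) (≼-trans a (≡⇒≼ (proj₂ w))))))
          ...   | zero , n′ , v′ = ⊥-elim (prf′ x (p , hp , n′ , v′))
          Below : ℕ → Set ℓ
          Below m′ = Σ ℕ λ n′ → Valid i m′ n′ × val (P.e h m′ n′) ≺ p
          -- by kept-below no pattern point is the last one below p
          step : ∀ {m′ n′} → Valid i m′ n′ → val (P.e h m′ n′) ≺ p →
            Σ ℕ λ m″ → Σ ℕ λ n″ → (Valid i m″ n″ × val (P.e h m″ n″) ≺ p) × (m′ ℕ.< m″ ⊎ (m′ ≡ m″ × n″ ℕ.< n′))
          step {m′} {n′} v′ lt with kept-below hp lt
          ... | y , (c , d) , ¬dy with P.convex h {sub y ¬dy} v (≼-trans (P.first≼ h v′) (≺⇒≼ c))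
                                        (≺⇒≼ (≺-≼ d (≼-trans (In-first In-z) (≺⇒≼ z≺))))
          ...   | m″ , n″ , v″ , refl = m″ , n″ , (v″ , d) , P.e-order h v′ v″ c
          -- induction on the distance m ∸ m′ to the last block, then on n′
          rise : ∀ k l m′ n′ → m ℕ.≤ k ℕ.+ m′ → n′ ℕ.≤ l → Valid i m′ n′ → val (P.e h m′ n′) ≺ p → ⊥
          rise k l m′ n′ mk nl v′ lt with step v′ lt
          rise k zero m′ .zero mk ℕ.z≤n v′ lt | m″ , n″ , _ , inj₂ (refl , ())
          rise k (suc l) m′ n′ mk nl v′ lt | m″ , n″ , (v″ , lt″) , inj₂ (refl , q) =
            rise k l m′ n″ mk (ℕₚ.≤-pred (ℕₚ.≤-trans q nl)) v″ lt″
          rise zero l m′ n′ mk nl v′ lt | m″ , n″ , (v″ , lt″) , inj₁ q =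
            ≺-irr (≺-trans (≼-≺ (In-first In-z) z≺) (≺-trans (P.e-out< h (ℕₚ.≤-<-trans mk q) v) lt″))
          rise (suc k) l m′ n′ mk nl v′ lt | m″ , n″ , (v″ , lt″) , inj₁ q =
            rise k n″ m″ n″ (ℕₚ.≤-trans mk (ℕₚ.≤-trans (ℕₚ.≤-reflexive (sym (ℕₚ.+-suc k m′))) (ℕₚ.+-monoʳ-≤ k q))) ℕₚ.≤-refl v″ lt″

      -- With no deleted point in between, the pattern is convex in `C` too; but then its first
      -- point is in block 0 of a pattern of `C` and was deleted.
      contradiction-pattern : ⊥
      contradiction-pattern = prf′ x (val x , hx , index hx , (λ _ → ℕₚ.≤-refl) , sym (e-first (pat hx)))
        where
        hx : PatAt (val x)
        hx = limit , i , record
          { e = λ m n → val (P.e h m n)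
          ; e-first = cong val (P.e-first h)
          ; e-in = λ v → P.e-in h v
          ; e-out = λ v → P.e-out h v
          ; convex = λ {z} {m} {n} v a b → case P.convex h {sub z (no-deleted v a b)} v a b of
              λ (m′ , n′ , v′ , eq) → m′ , n′ , v′ , cong val eq }

    none : ∀ p → ¬ P.PatAt p
    none p (lim , i , h) = contradiction-pattern lim h

    sibInf-of-Big : (f : C ↪ C) (c : A) → Big c (app f c) → SibInf C
    sibInf-of-Big f c big = SibInf-equi ↪N N↪ (InsertPattern.sibInf N none f′ c′ big′)
      where
      f′ : N ↪ N
      f′ = (↪N ∘↪ f) ∘↪ N↪
      c′ : Carrier N
      c′ = app ↪N c
      big′ : P.Big c′ (app f′ c′)
      big′ = record
        { t = λ m n → app ↪N (Big.t big m n)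
        ; t-in = λ m n → app-mono ↪N {Big.t big m (suc n)} {Big.t big m n} (Big.t-in big m n)
        ; t-out = λ m n n′ → app-mono ↪N {Big.t big m n} {Big.t big (suc m) n′} (Big.t-out big m n n′)
        ; t-lower = λ m n → ↪-≼ ↪N {c} {Big.t big m n} (Big.t-lower big m n)
        -- Shifting only raises points, so `f (val c′)` still bounds the given copy.
        ; t-upper = λ m n → ↪-≼ ↪N {Big.t big m n} {app f (val c′)}
            (≼-trans (Big.t-upper big m n) (↪-≼ f {c} {val c′} (Shift-≽ (proj₂ (shift c))))) }

  -- Tame chains; thinning out a growing orbit.

  Tame : Chain ℓ → Set ℓ
  Tame C = (f : C ↪ C) (x : Order.A C) → x ≺ app f x → ¬ (Asc x (app f x) × Desc x (app f x))
    where open Order C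

  module Interval (C : Chain ℓ) where
    open Order C

    [_,_⟩ : A → A → A → Set ℓ
    [ x , y ⟩ z = x ≼ z × z ≺ y

  -- [c k , c 0) embeds ω times in succession in [c (k+1) , c k).  Keeping only the blocks
  -- whose index is a multiple of j + 1 gives pairwise non-isomorphic siblings.
  module Blocks (C : Chain ℓ) (tame : Tame C) (c : ℕ → Carrier C)
    (c-down : ∀ k → _<_ C (c (suc k)) (c k))
    (wo : ∀ k → ¬ Order.Desc C (c k) (c 0))
    (a : ℕ → ℕ → Carrier C)
    (a-up : ∀ k i → _<_ C (a k i) (a k (suc i)))
    (a-lo : ∀ k i → ¬ _<_ C (a k i) (c (suc k)))
    (a-hi : ∀ k i → _<_ C (a k i) (c k))
    (E : ∀ k i → Order.Emb C (Interval.[_,_⟩ C (c k) (c 0)) (Interval.[_,_⟩ C (a k i) (a k (suc i))))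
    where
    open Order C
    open Interval C

    c-anti : ∀ {m n} → m ℕ.≤ n → c n ≼ c m
    c-anti p = Order.mono-seq (op C) c c-down p

    b : A
    b = c 0

    Lo : A → Set ℓ
    Lo z = ∀ n → z ≺ c n

    X : ℕ → A → Set ℓ
    X k z = a k 0 ≼ z × Σ ℕ λ i → z ≺ a k i

    Keep : ℕ → A → Set ℓ
    Keep j z = Lo z ⊎ (b ≼ z ⊎ Σ ℕ λ k → suc j ∣ k × X k z)

    S : ℕ → Chain ℓ
    S j = Sub C (Keep j)

    X-lo : ∀ {k z} → X k z → c (suc k) ≼ z
    X-lo (p , _) = ≼-trans (a-lo _ 0) p

    pt : ∀ j k i → suc j ∣ k → Carrier (S j)
    pt j k i d = sub (a k i) (inj₂ (inj₂ (k , d , mono-seq (a k) (a-up k) ℕ.z≤n , suc i , a-up k i)))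

    incl : ∀ j → S j ↪ C
    incl j = mk↪ val id

    module _ (j : ℕ) where

      -- A kept index, and at least `suc k`, so that the interval below `c k` is in the domain of
      -- `E (K k) 0`.
      K : ℕ → ℕ
      K k = suc j ℕ.* suc k

      K≥ : ∀ k → suc k ℕ.≤ K k
      K≥ k = ℕₚ.m≤m+n (suc k) _

      Move : A → A → Set ℓ
      Move z w = ((Lo z ⊎ b ≼ z) × w ≡ z) ⊎ (Σ ℕ λ k → [ c (suc k) , c k ⟩ z × w ≡ fn (E (K k) 0) z)

      in-domain : ∀ {k z} → [ c (suc k) , c k ⟩ z → [ c (K k) , b ⟩ z
      in-domain {k} (p , q) = ≼-trans (c-anti (K≥ k)) p , ≺-≼ q (c-anti ℕ.z≤n)

      opaque
        move : ∀ z → Σ A (Move z)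
        move z with em (Lo z)
        ... | yes lo = z , inj₁ (inj₁ lo , refl)
        ... | no ¬lo with split z b
        ...   | inj₂ hi = z , inj₁ (inj₂ hi , refl)
        ...   | inj₁ z≺b with leastℕ (λ n → c n ≼ z) (¬∀⇒∃¬ ¬lo)
        ...     | zero , p , _ = ⊥-elim (p z≺b)
        ...     | suc k , p , min = _ , inj₂ (k , (p , dne λ ¬lt → ℕₚ.<-irrefl refl (min k ¬lt)) , refl)

      Move-kept : ∀ {z w} → Move z w → Keep j w
      Move-kept (inj₁ (inj₁ lo , refl)) = inj₁ lo
      Move-kept (inj₁ (inj₂ hi , refl)) = inj₂ (inj₁ hi)
      Move-kept (inj₂ (k , r , refl)) = let (p , q) = into (E (K k) 0) (in-domain r) in
        inj₂ (inj₂ (K k , m∣m*n (suc k) , p , 1 , q))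

      Move-mid : ∀ {k z} → [ c (suc k) , c k ⟩ z → [ c (suc (K k)) , c (K k) ⟩ (fn (E (K k) 0) z)
      Move-mid {k} r = let (p , q) = into (E (K k) 0) (in-domain r) in ≼-trans (a-lo (K k) 0) p , ≺-trans q (a-hi (K k) 1)

      Move-mono : ∀ {x y x′ y′} → Move x x′ → Move y y′ → x ≺ y → x′ ≺ y′
      Move-mono (inj₁ (_ , refl)) (inj₁ (_ , refl)) p = p
      Move-mono (inj₁ (inj₁ lo , refl)) (inj₂ (k , r , refl)) p = ≺-≼ (lo (suc (K k))) (proj₁ (Move-mid r))
      Move-mono (inj₁ (inj₂ hi , refl)) (inj₂ (k , r , refl)) p = ⊥-elim (hi (≺-trans p (proj₂ (in-domain r))))
      Move-mono (inj₂ (k , r , refl)) (inj₁ (inj₁ lo , refl)) p = ⊥-elim (proj₁ r (≺-trans p (lo (suc k))))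
      Move-mono (inj₂ (k , r , refl)) (inj₁ (inj₂ hi , refl)) p = ≺-≼ (proj₂ (Move-mid r)) (≼-trans (c-anti ℕ.z≤n) hi)
      Move-mono {x} {y} (inj₂ (k , r , refl)) (inj₂ (k′ , r′ , refl)) p with ℕₚ.<-cmp k k′
      ... | tri< lt _ _ = ⊥-elim (proj₁ r (≺-≼ (≺-trans p (proj₂ r′)) (c-anti lt)))
      ... | tri≈ _ refl _ = incr (E (K k) 0) (in-domain r) (in-domain r′) p
      ... | tri> _ _ gt = ≺-≼ (proj₂ (Move-mid r)) (≼-trans (c-anti (ℕₚ.*-monoʳ-< (suc j) (ℕ.s≤s gt))) (proj₁ (Move-mid r′)))

      emb : C ↪ S j
      emb = mk↪ (λ z → sub (proj₁ (move z)) (Move-kept (proj₂ (move z)))) λ {x} {y} → Move-mono (proj₂ (move x)) (proj₂ (move y))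

      emb-lo : ∀ {z} → Lo z → val (app emb z) ≡ z
      emb-lo {z} lo with proj₂ (move z)
      ... | inj₁ (_ , eq) = eq
      ... | inj₂ (k , (p , _) , _) = ⊥-elim (p (lo (suc k)))

    -- If the image reached `c n`, the ascending `a n` and the descending rest of `c` would both lie
    -- between a point and its image under a self-embedding of `C`, against tameness.
    keeps-Lo : ∀ {j l} (φ : S j ↪ S l) (z : Carrier (S j)) → Lo (val z) → Lo (val (app φ z))
    keeps-Lo {j} {l} φ z lo = dne λ ¬lo → escape (¬∀⇒∃¬ ¬lo)
      where
      h : C ↪ C
      h = incl l ∘↪ (φ ∘↪ emb j)
      hz : val (app φ z) ≡ app h (val z)
      hz = cong (λ t → val (app φ t)) (sub-≡ {x = z} {app (emb j) (val z)} (sym (emb-lo j lo)))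
      escape : (Σ ℕ λ n → ¬ (val (app φ z) ≺ c n)) → ⊥
      escape (n , p) = tame h (val z) (≺-≼ (lo n) p′)
        ( (a n , a-up n , (λ i → ≺⇒≼ (≺-≼ (lo (suc n)) (a-lo n i))) , λ i → ≼-trans (≺⇒≼ (a-hi n i)) p′)
        , ((λ i → c (i ℕ.+ n)) , (λ i → c-down (i ℕ.+ n)) , (λ i → ≼-trans (c-anti (ℕₚ.m≤n+m n i)) p′) , λ i → ≺⇒≼ (lo (i ℕ.+ n))) )
        where
        p′ : c n ≼ app h (val z)
        p′ = subst (c n ≼_) hz p

    -- The well-ordered `[ c k , b ⟩` goes by `E k i` into one piece of the block and on by `ψ` back
    -- into itself, strictly below its own point `u`. So `u` would be moved down.
    squeeze : ∀ {x y} (ψ : S x ↪ S y) k i (d : suc x ∣ k) → c k ≼ val (app ψ (pt x k i d)) → val (app ψ (pt x k (suc i) d)) ≺ b → ⊥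
    squeeze {x} {y} ψ k i d lo hi =
      inflationary P (interval-NoDesc (wo k) P λ (p , q) → p , ≺⇒≼ q) f
        (λ p → proj₁ (range p)) incr′ u∈ (proj₂ (range u∈))
      where
      P : A → Set ℓ
      P = [ c k , b ⟩
      u : A
      u = val (app ψ (pt x k (suc i) d))
      u∈ : P u
      u∈ = ≼-trans lo (≺⇒≼ (app-mono ψ {pt x k i d} {pt x k (suc i) d} (a-up k i))) , hi
      lift-pt : ∀ z → P z → Carrier (S x)
      lift-pt z p = sub (fn (E k i) z) (inj₂ (inj₂ (k , d ,
        ≼-trans (mono-seq (a k) (a-up k) ℕ.z≤n) (proj₁ (into (E k i) p)) , suc i , proj₂ (into (E k i) p))))
      chosen : Σ (A → A) λ f → ∀ {z} → P z → Σ (P z) λ p → f z ≡ val (app ψ (lift-pt z p))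
      chosen = choose {P = P} {Q = λ z w → Σ (P z) λ p → w ≡ val (app ψ (lift-pt z p))} λ z p → _ , p , refl
      f : A → A
      f = proj₁ chosen
      range : ∀ {z} → P z → P (f z) × f z ≺ u
      range {z} p with proj₂ chosen p
      ... | q , eq rewrite eq = (≼-trans lo (↪-≼ ψ {pt x k i d} {lift-pt z q} (proj₁ (into (E k i) q))) , ≺-trans below hi) , below
        where
        below : val (app ψ (lift-pt z q)) ≺ u
        below = app-mono ψ {lift-pt z q} {pt x k (suc i) d} (proj₂ (into (E k i) q))
      incr′ : ∀ {y z} → P y → P z → y ≺ z → f y ≺ f z
      incr′ {y} {z} p q lt with proj₂ chosen p | proj₂ chosen q
      ... | p′ , eq | q′ , eq′ = subst₂ _≺_ (sym eq) (sym eq′) (app-mono ψ {lift-pt y p′} {lift-pt z q′} (incr (E k i) p′ q′ lt))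

    -- An isomorphism need not respect `b`. Below a point that lies, together with its image,
    -- between some `c t` and `b`, images cannot pass `b`.
    record Pivot {j l} (φ : Iso (S j) (S l)) : Set ℓ where
      field
        q : Carrier (S j)
        t₁ t₂ : ℕ
        q-lo : c t₁ ≼ val q
        q-hi : val q ≺ b
        φq-lo : c t₂ ≼ val (app (fwd φ) q)
        φq-hi : val (app (fwd φ) q) ≺ b

    reaches : ∀ {j l} (φ : Iso (S j) (S l)) z → ¬ Lo (val z) → Σ ℕ λ t → c t ≼ val (app (fwd φ) z)
    reaches {j} {l} φ z ¬lo = ¬∀⇒∃¬ λ lo → ¬lo (subst (λ t → Lo (val t)) (bwd-fwd φ z) (keeps-Lo (bwd φ) (app (fwd φ) z) lo))

    -- Block 0 is kept for every index. If the preimage of its first point is not below `b`, then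
    -- the first point of block 0 on the other side lies below this preimage, and its image is below
    -- `b`.
    pivot : ∀ {j l} (φ : Iso (S j) (S l)) → Pivot φ
    pivot {j} {l} φ = case split (val q′) b of λ where
        (inj₁ q≺b) → record
          { q = q′ ; t₁ = proj₁ r ; t₂ = 1 ; q-lo = proj₂ r ; q-hi = q≺b
          ; φq-lo = subst (λ t → c 1 ≼ val t) (sym (fwd-bwd φ x)) (a-lo 0 0)
          ; φq-hi = subst (λ t → val t ≺ b) (sym (fwd-bwd φ x)) (a-hi 0 0) }
        (inj₂ b≼q) → record
          { q = u ; t₁ = 1 ; t₂ = proj₁ r′ ; q-lo = a-lo 0 0 ; q-hi = a-hi 0 0 ; φq-lo = proj₂ r′
          ; φq-hi = ≺-trans (subst (λ t → val (app (fwd φ) u) ≺ val t) (fwd-bwd φ x)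
              (app-mono (fwd φ) {u} {q′} (≺-≼ (a-hi 0 0) b≼q))) (a-hi 0 0) }
      where
      x = pt l 0 0 (suc l ∣0)
      q′ = app (bwd φ) x
      r = reaches (Iso-sym φ) x λ lo → a-lo 0 0 (lo 1)
      u = pt j 0 0 (suc j ∣0)
      r′ = reaches φ u λ lo → a-lo 0 0 (lo 1)

    -- The first kept point of block `n` cannot rise to `c n`, by `squeeze`, nor sink into a deeper
    -- block, by `squeeze` for the inverse; and `S l` has no block `n` to receive it.
    apart-at : ∀ {j l} (φ : Iso (S j) (S l)) (n : ℕ) → suc j ∣ n → ¬ (suc l ∣ n) → (pv : Pivot φ) →
      Pivot.t₁ pv ℕ.≤ n → Pivot.t₂ pv ℕ.≤ n → ⊥
    apart-at {j} {l} φ n d ¬d pv n≥t₁ n≥t₂ = case split (val φu) (c n) of λ where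
        (inj₁ ≺cn) → deeper ≺cn (prf′ φu)
        (inj₂ cn≼) → squeeze (fwd φ) n 0 d cn≼
          (≺-trans (app-mono (fwd φ) {pt j n 1 d} {q} (≺-≼ (a-hi n 1) (≼-trans (c-anti n≥t₁) q-lo))) φq-hi)
      where
      open Pivot pv
      u = pt j n 0 d
      φu = app (fwd φ) u
      deeper : val φu ≺ c n → Keep l (val φu) → ⊥
      deeper ≺cn (inj₁ lo) = a-lo n 0 (subst (λ t → Lo (val t)) (bwd-fwd φ u) (keeps-Lo (bwd φ) φu lo) (suc n))
      deeper ≺cn (inj₂ (inj₁ hi)) = hi (≺-≼ ≺cn (c-anti ℕ.z≤n))
      deeper ≺cn (inj₂ (inj₂ (m , dm , x@(_ , i , φu≺)))) with ℕₚ.<-cmp m n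
      ... | tri< m<n _ _ = X-lo x (≺-≼ ≺cn (c-anti m<n))
      ... | tri≈ _ m≡n _ = ¬d (subst (suc l ∣_) m≡n dm)
      ... | tri> _ _ n<m = squeeze (bwd φ) m i dm
        (≼-trans (≼-trans (c-anti n<m) (a-lo n 0)) (≺⇒≼ (subst (λ t → val t ≺ val (app (bwd φ) (pt l m i dm))) (bwd-fwd φ u)
          (app-mono (bwd φ) {φu} {pt l m i dm} φu≺))))
        (≺-trans (subst (λ t → val (app (bwd φ) (pt l m (suc i) dm)) ≺ val t) (bwd-fwd φ q)
          (app-mono (bwd φ) {pt l m (suc i) dm} {app (fwd φ) q} (≺-≼ (a-hi m (suc i)) (≼-trans (c-anti (ℕₚ.≤-trans n≥t₂ (ℕₚ.<⇒≤ n<m))) φq-lo)))) q-hi)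

    -- The index `suc j * suc (suc l * t)` is congruent to `suc j` modulo `suc l`, and `suc j` is
    -- positive and smaller than `suc l`. The summand with `t` makes it large enough for the pivot.
    apart : ∀ {j l} → j ℕ.< l → Iso (S j) (S l) → ⊥
    apart {j} {l} j<l φ = apart-at φ (suc j ℕ.* suc (suc l ℕ.* t)) (m∣m*n _) ¬d pv (t≤ (ℕₚ.m≤m+n t₁ t₂)) (t≤ (ℕₚ.m≤n+m t₂ t₁))
      where
      pv : Pivot φ
      pv = pivot φ
      open Pivot pv
      t : ℕ
      t = t₁ ℕ.+ t₂
      t≤ : ∀ {m} → m ℕ.≤ t → m ℕ.≤ suc j ℕ.* suc (suc l ℕ.* t)
      t≤ p = ℕₚ.≤-trans p (ℕₚ.≤-trans (ℕₚ.m≤n*m t (suc l)) (ℕₚ.≤-trans (ℕₚ.n≤1+n _) (ℕₚ.m≤n*m _ (suc j))))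
      eq : suc j ℕ.* suc (suc l ℕ.* t) ≡ suc l ℕ.* (suc j ℕ.* t) ℕ.+ suc j
      eq = trans (ℕₚ.*-suc (suc j) (suc l ℕ.* t)) (trans (ℕₚ.+-comm (suc j) _) (cong (ℕ._+ suc j)
        (trans (sym (ℕₚ.*-assoc (suc j) (suc l) t)) (trans (cong (ℕ._* t) (ℕₚ.*-comm (suc j) (suc l))) (ℕₚ.*-assoc (suc l) (suc j) t)))))
      ¬d : ¬ (suc l ∣ suc j ℕ.* suc (suc l ℕ.* t))
      ¬d dl = ℕₚ.<⇒≱ (ℕ.s≤s j<l) (∣⇒≤ (∣m+n∣m⇒∣n (subst (suc l ∣_) eq dl) (m∣m*n (suc j ℕ.* t))))

    sibInf : SibInf C
    sibInf = S , (λ j → emb j , incl j) , distinct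
      where
      distinct : ∀ m n → Iso (S m) (S n) → m ≡ n
      distinct m n φ with ℕₚ.<-cmp m n
      ... | tri< lt _ _ = ⊥-elim (apart lt φ)
      ... | tri≈ _ eq _ = eq
      ... | tri> _ _ gt = ⊥-elim (apart gt (Iso-sym φ))

  -- Classes of points with well-ordered intervals between them.

  module Classes (C : Chain ℓ) where
    open Order C

    infix 4 _~_

    -- The interval between the two points is well-ordered.
    _~_ : A → A → Set ℓ
    x ~ y = ¬ Desc x y × ¬ Desc y x

    ~-refl : ∀ {x} → x ~ x
    ~-refl = (λ d → ≺-irr (Desc-bounds d)) , λ d → ≺-irr (Desc-bounds d)

    ~-sym : ∀ {x y} → x ~ y → y ~ x
    ~-sym (p , q) = q , p

    ~-trans : ∀ {x y z} → x ~ y → y ~ z → x ~ z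
    ~-trans {x} {y} {z} (p , q) (r , s) =
      (λ d → case Desc-split y d of λ { (inj₁ e) → p e ; (inj₂ e) → r e }) ,
      (λ d → case Desc-split y d of λ { (inj₁ e) → s e ; (inj₂ e) → q e })

    ~-convex : ∀ {x y z w} → x ~ z → x ~ w → z ≼ y → y ≼ w → x ~ y
    ~-convex {x} {y} {z} {w} xz xw z≼y y≼w = ~-trans xz
      ( (λ d → proj₁ zw (Desc-mono ≼-refl y≼w d))
      , (λ d → z≼y (Desc-bounds d)))
      where
      zw : z ~ w
      zw = ~-trans (~-sym xz) xw

    ~-of-≼ : ∀ {x y} → x ≼ y → ¬ Desc x y → x ~ y
    ~-of-≼ le nd = nd , λ d → le (Desc-bounds d)

    above-class : ∀ {x y} → x ≺ y → ¬ (x ~ y) → ∀ {v} → x ~ v → v ≺ y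
    above-class {x} {y} lt ¬xy {v} xv with split v y
    ... | inj₁ p = p
    ... | inj₂ p = ⊥-elim (¬xy (~-convex ~-refl xv (≺⇒≼ lt) p))

    below-class : ∀ {x y} → y ≺ x → ¬ (x ~ y) → ∀ {v} → x ~ v → y ≺ v
    below-class {x} {y} lt ¬xy {v} xv with split y v
    ... | inj₁ p = p
    ... | inj₂ p = ⊥-elim (¬xy (~-convex xv ~-refl p (≺⇒≼ lt)))

  -- Enlarging a class at its top.

  ωk : ℕ → Chain 0ℓ
  ωk k = ω ⊕ upTo k

  top : ∀ k → Carrier (ωk k)
  top k = inj₂ (sub k ℕₚ.≤-refl)

  top-max : ∀ k (y : Carrier (ωk k)) → ¬ _<_ (ωk k) (top k) y
  top-max k (inj₂ (sub a p)) k<a = ⊥-elim-irr (ℕₚ.<⇒≱ k<a p)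

  ωk-no-desc : ∀ k (y : ℕ → Carrier (ωk k)) → ¬ (∀ n → _<_ (ωk k) (y (suc n)) (y n))
  ωk-no-desc k y down = go y down (y 0) refl
    where
    left : ∀ m i (y : ℕ → Carrier (ωk k)) → i ℕ.≤ m → (∀ n → _<_ (ωk k) (y (suc n)) (y n)) → ¬ (y 0 ≡ inj₁ i)
    left m i y i≤m down eq with y 1 in eq₁ | subst (_<_ (ωk k) (y 1)) eq (down 0)
    left zero .zero y ℕ.z≤n down eq | inj₁ j | ()
    left (suc m) i y i≤m down eq | inj₁ j | lt =
      left m j (λ n → y (suc n)) (ℕₚ.≤-pred (ℕₚ.≤-trans lt i≤m)) (λ n → down (suc n)) eq₁
    right : ∀ m (y : ℕ → Carrier (ωk k)) (a : Carrier (upTo k)) → val a ℕ.≤ m → (∀ n → _<_ (ωk k) (y (suc n)) (y n)) → ¬ (y 0 ≡ inj₂ a)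
    right m y a a≤m down eq with y 1 in eq₁ | subst (_<_ (ωk k) (y 1)) eq (down 0)
    ... | inj₁ j | _ = left j j (λ n → y (suc n)) ℕₚ.≤-refl (λ n → down (suc n)) eq₁
    right zero y a a≤m down eq | inj₂ a′ | lt = ℕₚ.<⇒≱ lt (ℕₚ.≤-trans a≤m ℕ.z≤n)
    right (suc m) y a a≤m down eq | inj₂ a′ | lt =
      right m (λ n → y (suc n)) a′ (ℕₚ.≤-pred (ℕₚ.≤-trans lt a≤m)) (λ n → down (suc n)) eq₁
    go : ∀ y → (∀ n → _<_ (ωk k) (y (suc n)) (y n)) → ∀ y₀ → ¬ (y 0 ≡ y₀)
    go y down (inj₁ i) = left i i y ℕₚ.≤-refl down
    go y down (inj₂ a) = right (val a) y a ℕₚ.≤-refl down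

  -- ω + (k + 1) is inserted on top of the class of b.  By tameness an isomorphism preserves the
  -- top of this class, and with it the length of the last finite cluster.
  module TopInsert (C : Chain ℓ) (tame : Tame C) (b b₁ w w₁ w₂ : Carrier C)
    (b₁~b : Classes._~_ C b₁ b) (b₁-asc : Order.Asc C b₁ b)
    (w₂~b : Classes._~_ C w₂ b) (asc₁ : Order.Asc C w w₁) (asc₂ : Order.Asc C w₁ w₂)
    (r : Order.Emb C (Classes._~_ C b) λ z → Classes._~_ C b z × _<_ C z w)
    where
    open Order C
    open Classes C

    Dn : A → Set ℓ
    Dn z = Σ A λ v → b ~ v × z ≼ v

    ins : ∀ k → Insertion C (ωk k)
    ins k = record { Below = λ z _ → Dn z ; below-down = λ p (v , bv , q) → v , bv , ≼-trans (≺⇒≼ p) q ; below-up = λ d _ → d }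

    S : ℕ → Chain ℓ
    S k = Insert (ins k)

    private
      s₁ s₂ : ℕ → A
      s₁ = proj₁ asc₁
      s₂ = proj₁ asc₂

      not-Dn : ∀ {z} → ¬ Dn z → ∀ {v} → b ~ v → v ≺ z
      not-Dn {z} ¬d {v} bv with split v z
      ... | inj₁ p = p
      ... | inj₂ p = ⊥-elim (¬d (v , bv , p))

      Dn-above : ∀ {v z} → b ~ v → v ≼ z → Dn z → b ~ z
      Dn-above bv p (v′ , bv′ , q) = ~-convex bv bv′ p q

      Move : A → A → Set ℓ
      Move z y = (b ~ z × y ≡ fn r z) ⊎ (¬ (b ~ z) × y ≡ z)

      opaque
        move : ∀ z → Σ A (Move z)
        move z with em (b ~ z)
        ... | yes bz = fn r z , inj₁ (bz , refl)
        ... | no ¬bz = z , inj₂ (¬bz , refl)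

      Move-mono : ∀ {x y x′ y′} → Move x x′ → Move y y′ → x ≺ y → x′ ≺ y′
      Move-mono (inj₁ (p , refl)) (inj₁ (q , refl)) lt = incr r p q lt
      Move-mono (inj₁ (p , refl)) (inj₂ (¬q , refl)) lt =
        above-class lt (λ xy → ¬q (~-trans p xy)) (~-trans (~-sym p) (proj₁ (into r p)))
      Move-mono (inj₂ (¬p , refl)) (inj₁ (q , refl)) lt =
        below-class lt (λ yx → ¬p (~-trans q yx)) (~-trans (~-sym q) (proj₁ (into r q)))
      Move-mono (inj₂ (_ , refl)) (inj₂ (_ , refl)) lt = lt

      room : ∀ {k} → Carrier (ωk k) → A
      room (inj₁ i) = s₁ i
      -- Shifted by one to lie strictly above `w₁`, the bound of all `s₁ i`.
      room (inj₂ (sub a _)) = s₂ (suc a)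

      room-lo : ∀ {k} (y : Carrier (ωk k)) → w ≼ room y
      room-lo (inj₁ i) = proj₁ (proj₂ (proj₂ asc₁)) i
      room-lo (inj₂ (sub a _)) = ≼-trans (≼-trans (proj₁ (proj₂ (proj₂ asc₁)) 0) (proj₂ (proj₂ (proj₂ asc₁)) 0)) (proj₁ (proj₂ (proj₂ asc₂)) (suc a))

      room-hi : ∀ {k} (y : Carrier (ωk k)) → room y ≼ w₂
      room-hi (inj₁ i) = ≼-trans (proj₂ (proj₂ (proj₂ asc₁)) i) (≼-trans (proj₁ (proj₂ (proj₂ asc₂)) 0) (proj₂ (proj₂ (proj₂ asc₂)) 0))
      room-hi (inj₂ (sub a _)) = proj₂ (proj₂ (proj₂ asc₂)) (suc a)

      room-mono : ∀ {k} (x y : Carrier (ωk k)) → _<_ (ωk k) x y → room x ≺ room y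
      room-mono (inj₁ i) (inj₁ j) p = mono-seq-< s₁ (proj₁ (proj₂ asc₁)) p
      room-mono (inj₁ i) (inj₂ (sub a _)) _ = ≼-≺ (proj₂ (proj₂ (proj₂ asc₁)) i)
        (≼-≺ (proj₁ (proj₂ (proj₂ asc₂)) 0) (mono-seq-< s₂ (proj₁ (proj₂ asc₂)) (ℕ.s≤s (ℕ.z≤n {a}))))
      room-mono (inj₂ (sub a _)) (inj₂ (sub a′ _)) p = mono-seq-< s₂ (proj₁ (proj₂ asc₂)) (ℕ.s≤s p)

      below-w : ∀ {z z′} → Move z z′ → Dn z → z′ ≺ w
      below-w (inj₁ (bz , refl)) _ = proj₂ (into r bz)
      below-w {z} (inj₂ (¬bz , refl)) d with split z b
      ... | inj₁ lt = ≺-trans (below-class lt ¬bz (proj₁ (into r ~-refl))) (proj₂ (into r ~-refl))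
      ... | inj₂ le = ⊥-elim (¬bz (Dn-above ~-refl le d))

      unmoved : ∀ {z z′} → Move z z′ → ¬ Dn z → z′ ≡ z
      unmoved (inj₁ (bz , _)) ¬d = ⊥-elim (¬d (_ , bz , ≼-refl))
      unmoved (inj₂ (_ , eq)) _ = eq

    -- `r` presses the class below `w`, which frees two successive copies of `ω` between `w` and
    -- `w₂`.
    retract : ∀ k → S k ↪ C
    retract k = mk↪ ρ λ {x} {y} → mono x y
      where
      ρ : Carrier (S k) → A
      ρ (inj₁ z) = proj₁ (move z)
      ρ (inj₂ y) = room y
      mono : ∀ x y → _<_ (S k) x y → ρ x ≺ ρ y
      mono (inj₁ x) (inj₁ y) p = Move-mono (proj₂ (move x)) (proj₂ (move y)) p
      mono (inj₁ x) (inj₂ y) p = ≺-≼ (below-w (proj₂ (move x)) p) (room-lo y)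
      mono (inj₂ x) (inj₁ y) p = ≼-≺ (room-hi x) (subst (w₂ ≺_) (sym (unmoved (proj₂ (move y)) p)) (not-Dn p (~-sym w₂~b)))
      mono (inj₂ x) (inj₂ y) (lift p) = room-mono x y p

    DnS : ∀ {k} → Carrier (S k) → Set ℓ
    DnS (inj₁ z) = Dn z
    DnS (inj₂ _) = Lift ℓ ⊤

    -- A point above the class is separated from `b` by a descending sequence. No term of it is
    -- under the cut, since the remaining terms would then descend inside the class.
    desc-to-Hi : ∀ {k} (u : Carrier (S k)) {z} → DnS u → ¬ Dn z → Order.Desc (S k) u (inj₁ z)
    desc-to-Hi {k} u {z} du ¬d = (λ n → inj₁ (s n)) , d , up , λ n → lo u du n
      where
      module O = Order (S k)
      ds : Desc b z
      ds = dne λ nd → ¬d (z , ~-of-≼ (≺⇒≼ (not-Dn ¬d ~-refl)) nd , ≼-refl)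
      s = proj₁ ds
      d = proj₁ (proj₂ ds)
      up = proj₁ (proj₂ (proj₂ ds))
      s-Hi : ∀ n → ¬ Dn (s n)
      s-Hi n dn = proj₁ (Dn-above ~-refl (proj₂ (proj₂ (proj₂ ds)) n) dn)
        ((λ i → s (i ℕ.+ n)) , (λ i → d (i ℕ.+ n)) , le , λ i → proj₂ (proj₂ (proj₂ ds)) (i ℕ.+ n))
        where
        le : ∀ i → s (i ℕ.+ n) ≼ s n
        le zero = ≼-refl
        le (suc i) = ≼-trans (≺⇒≼ (d (i ℕ.+ n))) (le i)
      lo : ∀ u → DnS u → ∀ n → u O.≼ inj₁ (s n)
      lo (inj₁ u) (v , bv , p) n q = s-Hi n (v , bv , ≼-trans (≺⇒≼ q) p)
      lo (inj₂ y) _ n q = s-Hi n q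

    below-DnS : ∀ {k} (x y : Carrier (S k)) → DnS y → ¬ _<_ (S k) y x → DnS x
    below-DnS (inj₁ x) (inj₁ y) (v , bv , p) q = v , bv , ≼-trans q p
    below-DnS (inj₁ x) (inj₂ y) _ q = dne q
    below-DnS (inj₂ x) y _ q = lift tt

    old? : ∀ {k} (x : Carrier (S k)) → (Σ A λ z → x ≡ inj₁ z) ⊎ (Σ (Carrier (ωk k)) λ y → x ≡ inj₂ y)
    old? (inj₁ z) = inj₁ (z , refl)
    old? (inj₂ y) = inj₂ (y , refl)

    -- A descending sequence either stays among the new points, which are well-ordered, or is old
    -- from some term on, because new points lie above every old point under the cut.
    wo-below : ∀ {k} (v : A) → b ~ v → (x : Carrier (S k)) → DnS x → ¬ Order.Desc (S k) (inj₁ v) x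
    wo-below {k} v bv x dx (s , d , up , lo) with em (Σ ℕ λ n → Σ A λ z → s n ≡ inj₁ z)
    ... | no new = ωk-no-desc k (λ n → proj₁ (y n)) λ n → lower (subst₂ O._≺_ (proj₂ (y (suc n))) (proj₂ (y n)) (d n))
      where
      module O = Order (S k)
      y : ∀ n → Σ (Carrier (ωk k)) λ y → s n ≡ inj₂ y
      y n = case old? (s n) of λ where
        (inj₁ (z , eq)) → ⊥-elim (new (n , z , eq))
        (inj₂ e) → e
    ... | yes (n , z , eq) = proj₁ v~z ((λ i → proj₁ (y i)) ,
        (λ i → subst₂ O._≺_ (proj₁ (proj₂ (y (suc i)))) (proj₁ (proj₂ (y i))) (d (i ℕ.+ n))) ,
        (λ i → proj₂ (proj₂ (y i))) , λ i → subst (inj₁ v O.≼_) (proj₁ (proj₂ (y i))) (lo (i ℕ.+ n)))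
      where
      module O = Order (S k)
      dz : Dn z
      dz = below-DnS (inj₁ z) x dx (subst (O._≼ x) eq (up n))
      v~z : v ~ z
      v~z = ~-trans (~-sym bv) (Dn-above bv (subst (inj₁ v O.≼_) eq (lo n)) dz)
      y : ∀ i → Σ A λ u → s (i ℕ.+ n) ≡ inj₁ u × u ≼ z
      y zero = z , eq , ≼-refl
      y (suc i) = case y i of λ (u , e , le) → case old? (s (suc i ℕ.+ n)) of λ where
        (inj₁ (u′ , e′)) → u′ , e′ , ≼-trans (≺⇒≼ (subst₂ O._≺_ e′ e (d (i ℕ.+ n)))) le
        (inj₂ (y′ , e′)) → ⊥-elim (subst₂ O._≺_ e′ e (d (i ℕ.+ n)) (proj₁ dz , proj₁ (proj₂ dz) , ≼-trans le (proj₂ (proj₂ dz))))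

    -- Tameness keeps the image of `b₁` under the cut. Another point moved above it would then give,
    -- by `desc-to-Hi`, a descending sequence whose preimage contradicts `wo-below`.
    keeps-Dn : ∀ {j l} (φ : Iso (S j) (S l)) x → DnS x → DnS (app (fwd φ) x)
    keeps-Dn {j} {l} φ x dx = go (app (fwd φ) x) refl
      where
      module O = Order (S j)
      module O′ = Order (S l)
      y = app (fwd φ) (inj₁ b₁)
      h : C ↪ C
      h = retract l ∘↪ (fwd φ ∘↪ insert↪ (ins j))
      stays : ∀ y′ → y ≡ y′ → DnS y′
      stays (inj₂ _) _ = lift tt
      stays (inj₁ z) eq = dne λ ¬d →
        let
          hz : z ≡ app h b₁
          hz = trans (sym (unmoved (proj₂ (move z)) ¬d)) (cong (app (retract l)) (sym eq))
          b≺z : b ≺ z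
          b≺z = not-Dn ¬d ~-refl
          Db : Desc b z
          Db = dne λ nd → ¬d (z , ~-of-≼ (≺⇒≼ b≺z) nd , ≼-refl)
          b₁≼b : b₁ ≼ b
          b₁≼b = ≼-trans (proj₁ (proj₂ (proj₂ b₁-asc)) 0) (proj₂ (proj₂ (proj₂ b₁-asc)) 0)
        in tame h b₁ (subst (b₁ ≺_) hz (≼-≺ b₁≼b b≺z))
             ( subst (Asc b₁) hz (Asc-mono ≼-refl (≺⇒≼ b≺z) b₁-asc)
             , subst (Desc b₁) hz (Desc-mono b₁≼b ≼-refl Db))
      go : ∀ x′ → app (fwd φ) x ≡ x′ → DnS x′
      go (inj₂ _) _ = lift tt
      go (inj₁ z) eq = dne λ ¬d → wo-below b₁ (~-sym b₁~b) x dx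
        (subst₂ O.Desc (bwd-fwd φ (inj₁ b₁)) (trans (cong (app (bwd φ)) (sym eq)) (bwd-fwd φ x))
          (↪-Desc (bwd φ) (desc-to-Hi y (stays y refl) ¬d)))

    τ : ∀ k → Carrier (S k)
    τ k = inj₂ (top k)

    τ-max : ∀ {k} (x : Carrier (S k)) → DnS x → ¬ _<_ (S k) (τ k) x
    τ-max (inj₁ x) d p = p d
    τ-max {k} (inj₂ y) _ (lift p) = top-max k y p

    τ-run : ∀ k → Clusters.Run (S k) k (τ k)
    τ-run k = run k ℕₚ.≤-refl
      where
      open Clusters (S k)
      run : ∀ a .(p : a ℕ.≤ k) → Run a (inj₂ (inj₂ (sub a p)))
      run zero p = stop none
        where
        none : ∀ v → ¬ (v ⋖ inj₂ (inj₂ (sub zero p)))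
        none (inj₁ z) (d , nb) = nb (inj₂ (inj₁ 0)) (d , lift tt)
        none (inj₂ (inj₁ i)) (_ , nb) = nb (inj₂ (inj₁ (suc i))) (lift ℕₚ.≤-refl , lift tt)
        none (inj₂ (inj₂ _)) (lift () , _)
      run (suc a) p = step {v = inj₂ (inj₂ (sub a (ℕₚ.≤-trans (ℕₚ.n≤1+n a) p)))}
        (lift ℕₚ.≤-refl , between) (run a (ℕₚ.≤-trans (ℕₚ.n≤1+n a) p))
        where
        between : ∀ z → ¬ (_<_ (S k) (inj₂ (inj₂ (sub a _))) z × _<_ (S k) z (inj₂ (inj₂ (sub (suc a) p))))
        between (inj₁ z) (¬d , d) = ¬d d
        between (inj₂ (inj₁ i)) (lift () , _)
        between (inj₂ (inj₂ (sub i _))) (lift lt , lift lt′) = ℕₚ.<⇒≱ lt (ℕₚ.≤-pred lt′)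

    sibInf : SibInf C
    sibInf = S , (λ k → insert↪ (ins k) , retract k) , distinct
      where
      distinct : ∀ m n → Iso (S m) (S n) → m ≡ n
      distinct m n φ = Clusters.Run-unique (S n) (subst (Clusters.Run (S n) m) eq (Iso-Run φ (τ-run m))) (τ-run n)
        where
        eq : app (fwd φ) (τ m) ≡ τ n
        eq = Order.≼-antisym (S n) {app (fwd φ) (τ m)} {τ n} (τ-max (app (fwd φ) (τ m)) (keeps-Dn φ (τ m) (lift tt)))
          λ p → τ-max (app (bwd φ) (τ n)) (keeps-Dn (Iso-sym φ) (τ n) (lift tt))
            (subst (λ t → _<_ (S m) t (app (bwd φ) (τ n))) (bwd-fwd φ (τ m)) (app-mono (bwd φ) p))

  module Orbit (C : Chain ℓ) (f : C ↪ C) (x : Carrier C) (x≺fx : _<_ C x (app f x)) where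
    open Order C

    X : ℕ → A
    X n = iter n (app f) x

    X-up : ∀ n → X n ≺ X (suc n)
    X-up = orbit-up (app-mono f) x≺fx

    X-≤ : ∀ {m n} → m ℕ.≤ n → X m ≼ X n
    X-≤ = mono-seq X X-up

    Reg : A → Set ℓ
    Reg u = x ≼ u × Σ ℕ λ m → u ≼ X m

    locate : ∀ {u} → Reg u → Σ ℕ λ k → X k ≼ u × u ≺ X (suc k)
    locate {u} (lo , m , hi) with leastℕ (λ n → u ≺ X n) (suc m , ≼-≺ hi (X-up m))
    ... | zero , lt , _ = ⊥-elim (lo lt)
    ... | suc k , lt , min = k , (λ lt′ → ℕₚ.<-irrefl refl (min k lt′)) , lt

  -- Inserting a chain after each term of a sequence cofinal in an orbit.

  module InsertAfter (C : Chain ℓ) (f : C ↪ C) (x : Carrier C) (x≺fx : _<_ C x (app f x))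
    (p : ℕ → Carrier C) (p-up : ∀ n → _<_ C (p n) (p (suc n)))
    (p-reg : ∀ n → Orbit.Reg C f x x≺fx (p n))
    (p-cof : ∀ m → Σ ℕ λ n → ¬ _<_ C (p n) (iter m (app f) x))
    (Z : Chain 0ℓ) (ζ : Carrier Z → Carrier C) (ζ-mono : ∀ {y z} → _<_ Z y z → _<_ C (ζ y) (ζ z))
    (ζ-lo : ∀ z → _<_ C x (ζ z)) (ζ-hi : ∀ z → _<_ C (ζ z) (app f x))
    where
    open Order C
    open Orbit C f x x≺fx

    p-≤ : ∀ {m n} → m ℕ.≤ n → p m ≼ p n
    p-≤ = mono-seq p p-up

    ins : Insertion C (ω ⊗ Z)
    ins = record
      { Below = λ c (n , _) → c ≼ p n
      ; below-down = λ lt le → ≼-trans (≺⇒≼ lt) le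
      ; below-up = λ { le (inj₁ lt) → ≼-trans le (p-≤ (ℕₚ.<⇒≤ lt)) ; le (inj₂ (refl , _)) → le } }

    S : Chain ℓ
    S = Insert ins

    private
      -- Two steps, because the room after `p n` is taken from the orbit interval following the one
      -- that contains `p n`, and `F (p n)` has to clear it.
      F : A → A
      F u = app f (app f u)

      F-mono : Mono F
      F-mono lt = app-mono f (app-mono f lt)

      it : ℕ → A → A
      it n = iter n F

      it-≼ : ∀ n {u v} → u ≼ v → it n u ≼ it n v
      it-≼ n = mono-≼ {it n} (iter-mono F-mono n)

      Reg-F : ∀ {u} → Reg u → u ≺ F u
      Reg-F r with locate r
      ... | k , lo , hi = ≺-≼ (≺-trans hi (X-up (suc k))) (mono-≼ {F} F-mono lo)

      it-incr : ∀ {u} → u ≼ F u → ∀ m n → m ℕ.≤ n → it m u ≼ it n u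
      it-incr {u} le m n m≤n = go (ℕₚ.≤⇒≤′ m≤n)
        where
        step : ∀ n → it n u ≼ it (suc n) u
        step zero = le
        step (suc n) = mono-≼ {F} F-mono (step n)
        go : ∀ {n} → m ℕ.≤′ n → it m u ≼ it n u
        go ℕ.≤′-refl = ≼-refl
        go (ℕ.≤′-step {n = n} q) = ≼-trans (go q) (step n)

      it-bound : ∀ n m {u} → u ≼ X m → Σ ℕ λ m′ → it n u ≼ X m′
      it-bound zero m le = m , le
      it-bound (suc n) m le with it-bound n m le
      ... | m′ , le′ = suc (suc m′) , mono-≼ {F} F-mono le′

      beyond : ∀ {z} → (∀ n → p n ≺ z) → ∀ {u} → (Σ ℕ λ m → u ≼ X m) → u ≺ z
      beyond h (m , le) = let (n , q) = p-cof m in ≼-≺ (≼-trans le q) (h n)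

      w : ℕ → Carrier Z → A
      w n z = iter (suc (proj₁ (locate (p-reg n)))) (app f) (ζ z)

      w-lo : ∀ n z → p n ≺ w n z
      w-lo n z with locate (p-reg n)
      ... | k , lo , hi = ≺-trans hi (iter-mono (app-mono f) (suc k) (ζ-lo z))

      w-hi : ∀ n z → w n z ≺ F (p n)
      w-hi n z with locate (p-reg n)
      ... | k , lo , hi = ≺-≼ (iter-mono (app-mono f) (suc k) (ζ-hi z))
        (subst (_≼ F (p n)) (sym (iter-suc (suc k) (app f) x)) (mono-≼ {F} F-mono lo))

      w-mono : ∀ n {y z} → _<_ Z y z → w n y ≺ w n z
      w-mono n lt = iter-mono (app-mono f) (suc (proj₁ (locate (p-reg n)))) (ζ-mono lt)

      w-Reg : ∀ n z → Reg (w n z)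
      w-Reg n z = ≼-trans (proj₁ (p-reg n)) (≺⇒≼ (w-lo n z)) , suc (suc (proj₁ (proj₂ (p-reg n)))) ,
        ≼-trans (≺⇒≼ (w-hi n z)) (mono-≼ {F} F-mono (proj₂ (proj₂ (p-reg n))))

      -- A point is moved by one `F` for each insertion to its left. The copy inserted after `p n`
      -- then fits between `it n (p n)` and `it (suc n) (p n)`.
      Move : A → A → Set ℓ
      Move z y = (Σ ℕ λ n → (z ≼ p n × (∀ m → z ≼ p m → n ℕ.≤ m)) × y ≡ it n z) ⊎ ((∀ n → p n ≺ z) × y ≡ z)

      opaque
        move : ∀ z → Σ A (Move z)
        move z with em (Σ ℕ λ n → z ≼ p n)
        ... | yes e = let (n , le , min) = leastℕ (λ n → z ≼ p n) e in _ , inj₁ (n , (le , min) , refl)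
        ... | no ¬e = z , inj₂ ((λ n → dne λ ¬lt → ¬e (n , ¬lt)) , refl)

      -- `F` need not raise points outside the orbit region; but a point that is moved at all has an
      -- insertion to its left and lies in the region.
      late-Reg : ∀ {z n n′} → z ≼ p n → (∀ m → z ≼ p m → n ℕ.≤ m) → n′ ℕ.< n → Reg z
      late-Reg {z} {n} {n′} le min lt =
        ≼-trans (proj₁ (p-reg n′)) (λ z≺ → ℕₚ.<⇒≱ lt (min n′ (≺⇒≼ z≺))) , proj₁ (proj₂ (p-reg n)) , ≼-trans le (proj₂ (proj₂ (p-reg n)))

      late-≼ : ∀ {z n} → z ≼ p n → (∀ m → z ≼ p m → n ℕ.≤ m) → ∀ {k} → k ℕ.≤ n → it k z ≼ it n z
      late-≼ {n = n} le min {k} k≤n with ℕₚ.m≤n⇒m<n∨m≡n k≤n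
      ... | inj₂ refl = ≼-refl
      ... | inj₁ k<n = it-incr (≺⇒≼ (Reg-F (late-Reg le min k<n))) k n k≤n

      Move-≽ : ∀ {z y} → Move z y → z ≼ y
      Move-≽ (inj₁ (n , (le , min) , refl)) = late-≼ le min ℕ.z≤n
      Move-≽ (inj₂ (_ , refl)) = ≼-refl

      Move-mono : ∀ {u v u′ v′} → Move u u′ → Move v v′ → u ≺ v → u′ ≺ v′
      Move-mono (inj₁ (m , (_ , min) , refl)) (inj₁ (n , (le , min′) , refl)) lt =
        ≺-≼ (iter-mono F-mono m lt) (late-≼ le min′ (min n (≼-trans (≺⇒≼ lt) le)))
      Move-mono (inj₁ (m , (le , _) , refl)) (inj₂ (hi , refl)) lt =
        beyond hi (it-bound m (proj₁ (proj₂ (p-reg m))) (≼-trans le (proj₂ (proj₂ (p-reg m)))))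
      Move-mono (inj₂ (hi , refl)) (inj₁ (n , (le , _) , refl)) lt = ⊥-elim (le (≺-trans (hi n) lt))
      Move-mono (inj₂ (_ , refl)) (inj₂ (_ , refl)) lt = lt

      r : Carrier S → A
      r (inj₁ z) = proj₁ (move z)
      r (inj₂ (n , z)) = it n (w n z)

      p-F : ∀ n → p n ≼ F (p n)
      p-F n = ≺⇒≼ (Reg-F (p-reg n))

      r-hi : ∀ n z → it n (w n z) ≺ it (suc n) (p n)
      r-hi n z = subst (it n (w n z) ≺_) (iter-suc n F (p n)) (iter-mono F-mono n (w-hi n z))

      r-mono : ∀ u v → _<_ S u v → r u ≺ r v
      r-mono (inj₁ u) (inj₁ v) lt = Move-mono (proj₂ (move u)) (proj₂ (move v)) lt
      r-mono (inj₁ u) (inj₂ (n , z)) le with proj₂ (move u)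
      ... | inj₁ (m , (le′ , min) , eq) = subst (_≺ it n (w n z)) (sym eq)
              (≼-≺ (≼-trans (it-≼ m le) (it-incr (p-F n) m n (min n le))) (iter-mono F-mono n (w-lo n z)))
      ... | inj₂ (hi , _) = ⊥-elim (le (hi n))
      r-mono (inj₂ (n , z)) (inj₁ v) nle with proj₂ (move v)
      ... | inj₁ (m , (le′ , min) , eq) = subst (it n (w n z) ≺_) (sym eq)
              (≺-≼ (r-hi n z) (≼-trans (it-incr (p-F n) (suc n) m n<m) (≺⇒≼ (iter-mono F-mono m (dne nle)))))
        where
        n<m : n ℕ.< m
        n<m = ℕₚ.≰⇒> λ m≤n → nle (≼-trans le′ (p-≤ m≤n))
      ... | inj₂ (hi , eq) = subst (it n (w n z) ≺_) (sym eq) (beyond hi (it-bound n (proj₁ (proj₂ (w-Reg n z))) (proj₂ (proj₂ (w-Reg n z)))))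
      r-mono (inj₂ (n , z)) (inj₂ (n′ , z′)) (lift (inj₁ lt)) =
        ≺-≼ (r-hi n z) (≼-trans (it-incr (p-F n) (suc n) n′ lt) (it-≼ n′ (≺⇒≼ (≼-≺ (p-≤ (ℕₚ.<⇒≤ lt)) (w-lo n′ z′)))))
      r-mono (inj₂ (n , z)) (inj₂ (.n , z′)) (lift (inj₂ (refl , lt))) = iter-mono F-mono n (w-mono n lt)

    old : C ↪ S
    old = insert↪ ins

    retract : S ↪ C
    retract = mk↪ r λ {u} {v} → r-mono u v

    retract-≽ : ∀ z → z ≼ app retract (inj₁ z)
    retract-≽ z = Move-≽ (proj₂ (move z))

    old-retract-≽ : ∀ u → ¬ _<_ S (inj₁ (app retract u)) u
    old-retract-≽ (inj₁ z) = retract-≽ z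
    old-retract-≽ (inj₂ (n , z)) le = le (≺-≼ (w-lo n z) (it-incr (≺⇒≼ (Reg-F (w-Reg n z))) 0 n ℕ.z≤n))

    retract-bound : ∀ z m → z ≼ X m → Σ ℕ λ m′ → app retract (inj₁ z) ≼ X m′
    retract-bound z m le with proj₂ (move z)
    ... | inj₁ (n , _ , eq) = let (m′ , q) = it-bound n m le in m′ , subst (_≼ X m′) (sym eq) q
    ... | inj₂ (_ , eq) = m , subst (_≼ X m) (sym eq) le

  -- In a chain all of whose bounded intervals are reversely well-ordered, tail isomorphisms
  -- admit a cofinal ω-sequence that is closed under them: the points with a tail isomorphic
  -- to a given one, or any sequence when no two tails are isomorphic.
  module Tails (C : Chain ℓ) (M : Carrier C → Set ℓ)
    (no-asc : ∀ u → M u → ¬ Σ (ℕ → Carrier C) λ s → (∀ n → M (s n)) × (∀ n → _<_ C (s n) (s (suc n))) × (∀ n → ¬ _<_ C u (s n)))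
    where
    open Order C

    Tail : A → A → Set ℓ
    Tail a u = M u × a ≼ u

    record TailIso (a b : A) : Set ℓ where
      field
        emb : Emb (Tail a) (Tail b)
        onto : ∀ {v} → Tail b v → Σ A λ u → Tail a u × fn emb u ≡ v

      θ-reflect : ∀ {u v} → Tail a u → Tail a v → fn emb u ≺ fn emb v → u ≺ v
      θ-reflect {u} {v} p q lt with split u v
      ... | inj₁ r = r
      ... | inj₂ r = ⊥-elim (weak emb q p r lt)

    open TailIso

    id-iso : ∀ {a} → TailIso a a
    id-iso = record { emb = record { fn = id ; into = id ; incr = λ _ _ p → p } ; onto = λ {v} p → v , p , refl }

    trans-iso : ∀ {a b c} → TailIso a b → TailIso b c → TailIso a c
    trans-iso s t = record { emb = Emb-trans (emb s) (emb t) ; onto = λ p → case onto t p of λ (v , q , e) →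
      case onto s q of λ (u , q′ , e′) → u , q′ , trans (cong (fn (emb t)) e′) e }

    sym-iso : ∀ {a b} → TailIso a b → TailIso b a
    sym-iso {a} {b} s = record
      { emb = record { fn = proj₁ inv ; into = λ p → proj₁ (proj₂ inv p)
                     ; incr = λ p q lt → θ-reflect s (proj₁ (proj₂ inv p)) (proj₁ (proj₂ inv q))
                         (subst₂ _≺_ (sym (proj₂ (proj₂ inv p))) (sym (proj₂ (proj₂ inv q))) lt) }
      ; onto = λ {v} p → fn (emb s) v , into (emb s) p , back p }
      where
      inv : Σ (A → A) λ g → ∀ {v} → Tail b v → Tail a (g v) × fn (emb s) (g v) ≡ v
      inv = choose {P = Tail b} {Q = λ v u → Tail a u × fn (emb s) u ≡ v} λ v p → onto s p
      back : ∀ {v} → Tail a v → proj₁ inv (fn (emb s) v) ≡ v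
      back {v} p with proj₂ inv (into (emb s) p)
      ... | q , e = ≼-antisym
        (λ lt → ≺-irr (subst (fn (emb s) v ≺_) e (incr (emb s) p q lt)))
        (λ lt → ≺-irr (subst (_≺ fn (emb s) v) e (incr (emb s) q p lt)))

    restrict : ∀ {a b} (s : TailIso a b) {u} → Tail a u → TailIso u (fn (emb s) u)
    restrict s {u} p = record
      { emb = record { fn = fn (emb s)
                     ; into = λ (m , le) → proj₁ (into (emb s) (m , ≼-trans (proj₂ p) le)) , weak (emb s) p (m , ≼-trans (proj₂ p) le) le
                     ; incr = λ (m , le) (m′ , le′) → incr (emb s) (m , ≼-trans (proj₂ p) le) (m′ , ≼-trans (proj₂ p) le′) }
      ; onto = λ {v} (m , le) → case onto s (m , ≼-trans (proj₂ (into (emb s) p)) le) of λ (t , q , e) →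
          t , (proj₁ q , λ lt → le (subst (_≺ fn (emb s) u) e (incr (emb s) q p lt))) , e }

    first : ∀ {a b} (s : TailIso a b) → M a → M b → fn (emb s) a ≡ b
    first {a} {b} s ma mb with onto s (mb , ≼-refl)
    ... | u , (mu , a≼u) , e = ≼-antisym (λ lt → weak (emb s) (ma , ≼-refl) (mu , a≼u) a≼u (subst (_≺ fn (emb s) a) (sym e) lt))
            (proj₂ (into (emb s) (ma , ≼-refl)))

    record Marks : Set ℓ where
      field
        s : ℕ → A
        s-up : ∀ n → s n ≺ s (suc n)
        s-M : ∀ n → M (s n)
        s-cof : ∀ {u} → M u → Σ ℕ λ n → u ≼ s n
        closed : ∀ n {y} → Tail (s 0) y → TailIso (s n) y → Σ ℕ λ m → y ≡ s m

    -- If some tail is isomorphic to that of a later point `u`, take the greatest such point `v`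
    -- before `u` and iterate the isomorphism from `v`. The greatest choice keeps points with an
    -- isomorphic tail out of the gaps.
    marks : (s : ℕ → A) → (∀ n → s n ≺ s (suc n)) → (∀ n → M (s n)) → (∀ {u} → M u → Σ ℕ λ n → u ≼ s n) → Marks
    marks s s-up s-M s-cof with em (Σ A λ d → Σ A λ u → (M d × M u) × d ≺ u × TailIso d u)
    ... | no rigid = record { s = s ; s-up = s-up ; s-M = s-M ; s-cof = s-cof ; closed = cl }
      where
      cl : ∀ n {y} → Tail (s 0) y → TailIso (s n) y → Σ ℕ λ m → y ≡ s m
      cl n {y} (my , _) t with tri (s n) y
      ... | tri< lt _ _ = ⊥-elim (rigid (s n , y , (s-M n , my) , lt , t))
      ... | tri≈ _ eq _ = n , sym eq
      ... | tri> _ _ gt = ⊥-elim (rigid (y , s n , (my , s-M n) , gt , sym-iso t))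
    ... | yes (d , u , (md , mu) , d≺u , t)
      with Order.least (op C) (λ v → M v × v ≺ u × TailIso v u)
             (λ (s , p , up) → no-asc u mu (s , (λ n → proj₁ (p n)) , up , λ n → ≺⇒≼ (proj₁ (proj₂ (p n))))) (d , md , d≺u , t)
    ...   | v , (mv , v≺u , τ) , max = record { s = e ; s-up = e-up ; s-M = λ n → proj₁ (e-T n) ; s-cof = cof ; closed = cl }
      where
      θ : A → A
      θ = fn (emb τ)
      e : ℕ → A
      e n = iter n θ v
      e-T : ∀ n → Tail v (e n)
      e-T zero = mv , ≼-refl
      e-T (suc n) = let (m , le) = into (emb τ) (e-T n) in m , ≼-trans (≺⇒≼ v≺u) le
      e-up : ∀ n → e n ≺ e (suc n)
      e-up zero = subst (v ≺_) (sym (first τ mv mu)) v≺u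
      e-up (suc n) = incr (emb τ) (e-T n) (e-T (suc n)) (e-up n)
      cof : ∀ {y} → M y → Σ ℕ λ n → y ≼ e n
      cof {y} my = dne λ ¬c → no-asc y my (e , (λ n → proj₁ (e-T n)) , e-up , λ n → λ lt → ¬c (n , ≺⇒≼ lt))
      iso : ∀ n → TailIso v (e n)
      iso zero = id-iso
      iso (suc n) = trans-iso (iso n) (restrict τ (e-T n))
      -- Any gap is an image of the first one, so a point in it comes from a point between `v` and
      -- `u` with an isomorphic tail.
      pull : ∀ k {y} → M y → e k ≺ y → y ≺ e (suc k) → Σ A λ y′ → (M y′ × v ≺ y′) × y′ ≺ u × TailIso y′ y
      pull zero {y} my lo hi = y , (my , lo) , subst (y ≺_) (first τ mv mu) hi , id-iso
      pull (suc k) {y} my lo hi with onto τ (my , ≼-trans (proj₂ (into (emb τ) (e-T k))) (≺⇒≼ lo))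
      ... | y₁ , T₁ , refl with pull k (proj₁ T₁) (θ-reflect τ (e-T k) T₁ lo) (θ-reflect τ T₁ (e-T (suc k)) hi)
      ...   | y′ , a , b , t′ = y′ , a , b , trans-iso t′ (restrict τ T₁)
      cl : ∀ n {y} → Tail (e 0) y → TailIso (e n) y → Σ ℕ λ m → y ≡ e m
      cl n {y} (my , v≼y) t with leastℕ (λ m → y ≺ e m) (let (m , le) = cof my in suc m , ≼-≺ le (e-up m))
      ... | zero , lt , _ = ⊥-elim (v≼y lt)
      ... | suc k , lt , min with ≼⇒≺⊎≡ {e k} {y} (λ lt′ → ℕₚ.<-irrefl refl (min k lt′))
      ...   | inj₂ eq = k , sym eq
      ...   | inj₁ gt with pull k my gt lt
      ...     | y′ , (my′ , v≺y′) , y′≺u , t′ = ⊥-elim (max y′ (my′ , y′≺u ,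
                  trans-iso t′ (trans-iso (sym-iso (trans-iso (iso n) t)) τ)) v≺y′)

  -- An isomorphism preserves the supremum of the orbit, so it induces a tail isomorphism between
  -- points without successor and, by closedness, maps some inserted cluster to an inserted one.
  module InsertClusters (C : Chain ℓ) (f : C ↪ C) (x : Carrier C) (x≺fx : _<_ C x (app f x))
    (not-big : (h : C ↪ C) (y : Carrier C) → ¬ Patterns.Big C y (app h y))
    (asc : Order.Asc C x (app f x)) (desc : Order.Desc C x (app f x))
    (cofinal : ∀ m → Σ (Carrier C) λ u →
      (Orbit.Reg C f x x≺fx u × (∀ v → _<_ C u v → Σ (Carrier C) λ w → _<_ C u w × _<_ C w v)) × ¬ _<_ C u (iter m (app f) x))
    where
    open Order C
    open Orbit C f x x≺fx
    open Patterns C using (Big)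

    NoSucc : A → Set ℓ
    NoSucc u = ∀ v → u ≺ v → Σ A λ w → u ≺ w × w ≺ v

    M : A → Set ℓ
    M u = Reg u × NoSucc u

    private
      it↪ : ℕ → C ↪ C
      it↪ n = mk↪ (iter n (app f)) (iter-mono (app-mono f) n)

      -- Within each gap a sequence descends towards the lower point, as that has no successor.
      -- Infinitely many gaps under a bound in the orbit region would form the excluded `ω*·ω`.
      no-asc : ∀ u → M u → ¬ Σ (ℕ → A) λ s → (∀ n → M (s n)) × (∀ n → s n ≺ s (suc n)) × (∀ n → s n ≼ u)
      no-asc u ((_ , m , u≼) , _) (s , s-M , s-up , s-hi) = not-big (it↪ m) x record
        { t = λ i n → t i n
        ; t-in = λ i n → proj₂ (proj₂ (below i (gap i n)))
        ; t-out = λ i n n′ → ≺-trans (t-hi i n) (t-lo (suc i) n′)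
        ; t-lower = λ i n → ≼-trans (proj₁ (proj₁ (s-M i))) (≺⇒≼ (t-lo i n))
        ; t-upper = λ i n → ≼-trans (≺⇒≼ (t-hi i n)) (≼-trans (s-hi (suc i)) u≼) }
        where
        Gap : ℕ → Set ℓ
        Gap i = Σ A λ w → s i ≺ w × w ≺ s (suc i)
        below : ∀ i (g : Gap i) → Σ A λ w → s i ≺ w × w ≺ proj₁ g
        below i (w , lo , hi) = proj₂ (s-M i) w lo
        gap : ∀ i → ℕ → Gap i
        gap i zero = proj₂ (s-M i) (s (suc i)) (s-up i)
        gap i (suc n) = let (w , lo , hi) = below i (gap i n) in w , lo , ≺-trans hi (proj₂ (proj₂ (gap i n)))
        t : ℕ → ℕ → A
        t i n = proj₁ (gap i n)
        t-lo : ∀ i n → s i ≺ t i n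
        t-lo i n = proj₁ (proj₂ (gap i n))
        t-hi : ∀ i n → t i n ≺ s (suc i)
        t-hi i n = proj₂ (proj₂ (gap i n))

      module T = Tails C M no-asc
      open T using (Tail; TailIso; Marks)

      seq : ℕ → Σ A M
      seq zero = let (u , mu , _) = cofinal 0 in u , mu
      seq (suc n) = let (u , mu , _) = cofinal (suc (proj₁ (proj₂ (proj₁ (proj₂ (seq n))))) ℕ.+ n) in u , mu

      bnd : ℕ → ℕ
      bnd n = proj₁ (proj₂ (proj₁ (proj₂ (seq n))))

      seq-≽ : ∀ n → X (suc (bnd n) ℕ.+ n) ≼ proj₁ (seq (suc n))
      seq-≽ n = proj₂ (proj₂ (cofinal (suc (bnd n) ℕ.+ n)))

      mk : Marks
      mk = T.marks (λ n → proj₁ (seq n))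
        (λ n → ≼-≺ (proj₂ (proj₂ (proj₁ (proj₂ (seq n))))) (≺-≼ (X-up (bnd n)) (≼-trans (X-≤ {suc (bnd n)} (ℕₚ.m≤m+n (suc (bnd n)) n)) (seq-≽ n))))
        (λ n → proj₂ (seq n))
        λ {u} ((_ , m , le) , _) → suc m , ≼-trans le (≼-trans (X-≤ {m} (ℕₚ.m≤n+m m (suc (bnd m)))) (seq-≽ m))

      open Marks mk

      -- The `ω` of a cluster is taken from the first orbit interval, its finite part from the
      -- second; the third step gives the strict bound `ζ-hi`.
      f³ : C ↪ C
      f³ = f ∘↪ (f ∘↪ f)

      x≺f³x : x ≺ app f³ x
      x≺f³x = ≺-trans x≺fx (≺-trans (X-up 1) (X-up 2))

      iter-f³-≽ : ∀ m → X m ≼ iter m (app f³) x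
      iter-f³-≽ zero = ≼-refl
      iter-f³-≽ (suc m) = ≼-trans (≺⇒≼ (≺-trans (X-up (suc m)) (X-up (suc (suc m))))) (↪-≼ f³ (iter-f³-≽ m))

      iter-f³-≼ : ∀ m → Σ ℕ λ m′ → iter m (app f³) x ≼ X m′
      iter-f³-≼ zero = 0 , ≼-refl
      iter-f³-≼ (suc m) = let (m′ , le) = iter-f³-≼ m in suc (suc (suc m′)) , ↪-≼ f³ le

      s-Reg³ : ∀ n → Orbit.Reg C f³ x x≺f³x (s n)
      s-Reg³ n = let ((lo , m , hi) , _) = s-M n in lo , m , ≼-trans hi (iter-f³-≽ m)

      s-cof-X : ∀ m → Σ ℕ λ n → X m ≼ s n
      s-cof-X m = let (u , mu , le) = cofinal m ; (n , le′) = s-cof mu in n , ≼-trans le le′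

      s-cof³ : ∀ m → Σ ℕ λ n → iter m (app f³) x ≼ s n
      s-cof³ m = let (m′ , le) = iter-f³-≼ m ; (n , le′) = s-cof-X m′ in n , ≼-trans le le′

      σ : ℕ → A
      σ = proj₁ asc

      σ-up : ∀ n → σ n ≺ σ (suc n)
      σ-up = proj₁ (proj₂ asc)

      σ-lo : ∀ n → x ≼ σ n
      σ-lo = proj₁ (proj₂ (proj₂ asc))

      σ-hi : ∀ n → σ n ≼ app f x
      σ-hi = proj₂ (proj₂ (proj₂ asc))

      ζ : ∀ {k} → Carrier (ωk k) → A
      ζ (inj₁ i) = σ (suc i)
      ζ (inj₂ (sub a _)) = app f (σ (suc a))

      ζ-mono : ∀ {k} (y z : Carrier (ωk k)) → _<_ (ωk k) y z → ζ y ≺ ζ z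
      ζ-mono (inj₁ i) (inj₁ j) lt = mono-seq-< σ σ-up (ℕ.s≤s lt)
      ζ-mono (inj₁ i) (inj₂ (sub a _)) _ = ≼-≺ (≼-trans (σ-hi (suc i)) (↪-≼ f (σ-lo 0))) (app-mono f (mono-seq-< σ σ-up (ℕ.s≤s (ℕ.z≤n {a}))))
      ζ-mono (inj₂ (sub a _)) (inj₂ (sub b _)) lt = app-mono f (mono-seq-< σ σ-up (ℕ.s≤s lt))

      ζ-lo : ∀ {k} (z : Carrier (ωk k)) → x ≺ ζ z
      ζ-lo (inj₁ i) = ≼-≺ (σ-lo i) (σ-up i)
      ζ-lo (inj₂ (sub a _)) = ≺-≼ x≺fx (↪-≼ f (σ-lo (suc a)))

      ζ-hi : ∀ {k} (z : Carrier (ωk k)) → ζ z ≺ app f³ x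
      ζ-hi (inj₁ i) = ≼-≺ (σ-hi (suc i)) (≺-trans (X-up 1) (X-up 2))
      ζ-hi (inj₂ (sub a _)) = ≼-≺ (↪-≼ f (σ-hi (suc a))) (X-up 2)

    module I (k : ℕ) = InsertAfter C f³ x x≺f³x s s-up s-Reg³ s-cof³ (ωk k) ζ (λ {y} {z} → ζ-mono y z) ζ-lo ζ-hi

    S : ℕ → Chain ℓ
    S k = I.S k

    s-≤ : ∀ {m n} → m ℕ.≤ n → s m ≼ s n
    s-≤ = mono-seq s s-up

    s-inj : ∀ {m n} → s m ≡ s n → m ≡ n
    s-inj {m} {n} eq with ℕₚ.<-cmp m n
    ... | tri< lt _ _ = ⊥-elim (≺-irr (subst (s m ≺_) (sym eq) (mono-seq-< s s-up lt)))
    ... | tri≈ _ e _ = e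
    ... | tri> _ _ gt = ⊥-elim (≺-irr (subst (s n ≺_) eq (mono-seq-< s s-up gt)))

    LowS : ∀ {k} → Carrier (S k) → Set ℓ
    LowS (inj₁ g) = Σ ℕ λ n → g ≼ s n
    LowS (inj₂ _) = Lift ℓ ⊤

    LowS-bound : ∀ {k} (u : Carrier (S k)) → LowS u → Σ ℕ λ n → _<_ (S k) u (inj₁ (s n))
    LowS-bound (inj₁ g) (n , le) = suc n , ≼-≺ le (s-up n)
    LowS-bound (inj₂ (n , z)) _ = suc n , λ le → le (s-up n)

    above-High : ∀ {k} {g : A} → (∀ n → s n ≺ g) → (v : Carrier (S k)) → ¬ _<_ (S k) v (inj₁ g) → Σ A λ g′ → v ≡ inj₁ g′ × g ≼ g′
    above-High hi (inj₁ g′) le = g′ , refl , le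
    above-High hi (inj₂ (n , z)) le = ⊥-elim (le λ q → q (hi n))

    -- Every orbit interval contains an image of `desc`, and a point above the whole orbit bounds
    -- `ω` many of them.
    big-beyond : ∀ n {g} → (∀ n → s n ≺ g) → Big (s n) g
    big-beyond n {g} hi = record
      { t = λ i a → iter (i ℕ.+ m) (app f) (δ (suc a))
      ; t-in = λ i a → it-mono (i ℕ.+ m) (δ-down (suc a))
      ; t-out = λ i a a′ → ≺-≼ (it-mono (i ℕ.+ m) (≺-≼ (δ-down a) (δ-hi a)))
          (subst (_≼ iter (suc i ℕ.+ m) (app f) (δ (suc a′))) (sym (iter-suc (i ℕ.+ m) (app f) x)) (mono-≼ (it-mono (suc i ℕ.+ m)) (δ-lo (suc a′))))
      ; t-lower = λ i a → ≼-trans hi-m (≼-trans (X-≤ (ℕₚ.m≤n+m m i)) (mono-≼ (it-mono (i ℕ.+ m)) (δ-lo (suc a))))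
      ; t-upper = λ i a → ≼-trans (mono-≼ (it-mono (i ℕ.+ m)) (δ-hi (suc a)))
          (subst (_≼ g) (sym (iter-suc (i ℕ.+ m) (app f) x)) (let (n′ , q) = s-cof-X (suc (i ℕ.+ m)) in ≼-trans q (≺⇒≼ (hi n′)))) }
      where
      m : ℕ
      m = proj₁ (proj₂ (proj₁ (s-M n)))
      hi-m : s n ≼ X m
      hi-m = proj₂ (proj₂ (proj₁ (s-M n)))
      δ : ℕ → A
      δ = proj₁ desc
      δ-down : ∀ a → δ (suc a) ≺ δ a
      δ-down = proj₁ (proj₂ desc)
      δ-hi : ∀ a → δ a ≼ app f x
      δ-hi = proj₁ (proj₂ (proj₂ desc))
      δ-lo : ∀ a → x ≼ δ a
      δ-lo = proj₂ (proj₂ (proj₂ desc))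
      it-mono : ∀ n → Mono (iter n (app f))
      it-mono n = iter-mono (app-mono f) n

    Big-up : ∀ {y z w} → Big y z → z ≼ w → Big y w
    Big-up b le = record { t = t ; t-in = t-in ; t-out = t-out ; t-lower = t-lower ; t-upper = λ m n → ≼-trans (t-upper m n) le }
      where open Patterns.Big b

    -- Otherwise a self-embedding of `C` carries some `s n` beyond the orbit, and `big-beyond`
    -- contradicts `not-big`.
    keeps-Low : ∀ {j l} (φ : Iso (S j) (S l)) u → LowS u → LowS (app (fwd φ) u)
    keeps-Low {j} {l} φ u low = go (app (fwd φ) u) refl
      where
      h : C ↪ C
      h = I.retract l ∘↪ (fwd φ ∘↪ I.old j)
      contra : ∀ {g} n → (∀ n → s n ≺ g) → (Σ A λ g′ → app (fwd φ) (inj₁ (s n)) ≡ inj₁ g′ × g ≼ g′) → ⊥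
      contra n hi (g′ , eq , le) = not-big h (s n) (Big-up (big-beyond n hi)
        (≼-trans le (subst (λ t → g′ ≼ app (I.retract l) t) (sym eq) (I.retract-≽ l g′))))
      go : ∀ v → app (fwd φ) u ≡ v → LowS v
      go (inj₂ _) _ = lift tt
      go (inj₁ g) eq = dne λ ¬low →
        let
          hi : ∀ n → s n ≺ g
          hi n = dne λ ¬lt → ¬low (n , ¬lt)
          (n , lt) = LowS-bound u low
          moved : _<_ (S l) (inj₁ g) (app (fwd φ) (inj₁ (s n)))
          moved = subst (λ t → _<_ (S l) t (app (fwd φ) (inj₁ (s n)))) eq (app-mono (fwd φ) {u} {inj₁ (s n)} lt)
        in contra n hi (above-High hi (app (fwd φ) (inj₁ (s n)))
             (Order.≺⇒≼ (S l) {inj₁ g} {app (fwd φ) (inj₁ (s n))} moved))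

    NoSuccS : ∀ k → Carrier (S k) → Set ℓ
    NoSuccS k u = ∀ v → _<_ (S k) u v → Σ (Carrier (S k)) λ w → _<_ (S k) u w × _<_ (S k) w v

    Iso-NoSucc : ∀ {j l} (φ : Iso (S j) (S l)) u → NoSuccS j u → NoSuccS l (app (fwd φ) u)
    Iso-NoSucc {j} {l} φ u ns v lt = transport
      (ns (app (bwd φ) v) (subst (λ t → _<_ (S j) t (app (bwd φ) v)) (bwd-fwd φ u) (app-mono (bwd φ) {app (fwd φ) u} {v} lt)))
      where
      transport : (Σ (Carrier (S j)) λ w → _<_ (S j) u w × _<_ (S j) w (app (bwd φ) v)) →
        Σ (Carrier (S l)) λ w → _<_ (S l) (app (fwd φ) u) w × _<_ (S l) w v
      transport (w , a , b) = app (fwd φ) w , app-mono (fwd φ) {u} {w} a ,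
        subst (_<_ (S l) (app (fwd φ) w)) (fwd-bwd φ v) (app-mono (fwd φ) {w} {app (bwd φ) v} b)

    -- A mark now has a successor, so the top of the cluster inserted after it takes its place among
    -- the points without successor; all other points of `M` keep theirs.
    Match : ∀ k → A → Carrier (S k) → Set ℓ
    Match k u v = (Σ ℕ λ n → u ≡ s n × v ≡ inj₂ (n , top k)) ⊎ ((∀ n → ¬ u ≡ s n) × v ≡ inj₁ u)

    match : ∀ k u → Σ (Carrier (S k)) (Match k u)
    match k u = case em (Σ ℕ λ n → u ≡ s n) of λ where
      (yes (n , eq)) → inj₂ (n , top k) , inj₁ (n , eq , refl)
      (no ¬e) → inj₁ u , inj₂ ((λ n eq → ¬e (n , eq)) , refl)

    Match-functional : ∀ {k u v v′} → Match k u v → Match k u v′ → v ≡ v′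
    Match-functional {k} (inj₁ (n , refl , refl)) (inj₁ (n′ , eq , refl)) = cong (λ t → inj₂ (t , top k)) (s-inj eq)
    Match-functional (inj₁ (n , refl , refl)) (inj₂ (ne , _)) = ⊥-elim (ne n refl)
    Match-functional (inj₂ (ne , _)) (inj₁ (n , refl , _)) = ⊥-elim (ne n refl)
    Match-functional (inj₂ (_ , refl)) (inj₂ (_ , refl)) = refl

    Match-mono : ∀ {k u u′ v v′} → Match k u v → Match k u′ v′ → u ≺ u′ → _<_ (S k) v v′
    Match-mono (inj₁ (n , refl , refl)) (inj₁ (n′ , refl , refl)) lt =
      lift (inj₁ (ℕₚ.≰⇒> λ le → s-≤ le lt))
    Match-mono (inj₁ (n , refl , refl)) (inj₂ (_ , refl)) lt = λ le → le lt
    Match-mono (inj₂ (_ , refl)) (inj₁ (n , refl , refl)) lt = ≺⇒≼ lt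
    Match-mono (inj₂ (_ , refl)) (inj₂ (_ , refl)) lt = lt

    Match-reflect : ∀ {k u u′ v v′} → Match k u v → Match k u′ v′ → _<_ (S k) v v′ → u ≺ u′
    Match-reflect {k} {u} {u′} {v} {v′} p q lt = case tri u u′ of λ where
      (tri< a _ _) → a
      (tri≈ _ refl _) → ⊥-elim (Order.≺-irr (S k) {v} (subst (_<_ (S k) v) (Match-functional q p) lt))
      (tri> _ _ c) → ⊥-elim (Order.≺-irr (S k) {v} (Order.≺-trans (S k) {v} {v′} {v} lt (Match-mono q p c)))

    Match-NoSucc : ∀ {k u v} → M u → Match k u v → NoSuccS k v × LowS v
    Match-NoSucc {k} mu (inj₁ (n , refl , refl)) = ns , lift tt
      where
      ns : NoSuccS k (inj₂ (n , top k))
      ns (inj₁ g) p = let (w , a , b) = proj₂ mu g (dne p) in inj₁ w , (λ le → le a) , b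
      ns (inj₂ (n′ , z)) (lift (inj₁ lt)) = inj₁ (s n′) , (λ le → le (mono-seq-< s s-up lt)) , ≼-refl
      ns (inj₂ (.n , z)) (lift (inj₂ (refl , lt))) = ⊥-elim (top-max k z lt)
    Match-NoSucc {k} {u} mu (inj₂ (ne , refl)) = ns , s-cof mu
      where
      ns : NoSuccS k (inj₁ u)
      ns (inj₁ g) lt = let (w , a , b) = proj₂ mu g lt in inj₁ w , a , b
      ns (inj₂ (n , z)) le = inj₁ (s n) , (case ≼⇒≺⊎≡ le of λ { (inj₁ lt) → lt ; (inj₂ eq) → ⊥-elim (ne n eq) }) , ≼-refl

    Empty : ∀ k → Carrier (S k) → Carrier (S k) → Set ℓ
    Empty k u v = ∀ w → ¬ (_<_ (S k) u w × _<_ (S k) w v)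

    between-same : ∀ k n (y z : Carrier (ωk k)) → (∀ w → ¬ (_<_ (ωk k) y w × _<_ (ωk k) w z)) → Empty k (inj₂ (n , y)) (inj₂ (n , z))
    between-same k n y z e (inj₁ g) (a , b) = a b
    between-same k n y z e (inj₂ (m , w)) (lift (inj₁ a) , lift (inj₁ b)) = ℕₚ.<-asym a b
    between-same k n y z e (inj₂ (m , w)) (lift (inj₁ a) , lift (inj₂ (refl , b))) = ℕₚ.<-irrefl refl a
    between-same k n y z e (inj₂ (m , w)) (lift (inj₂ (refl , a)) , lift (inj₁ b)) = ℕₚ.<-irrefl refl b
    between-same k n y z e (inj₂ (m , w)) (lift (inj₂ (refl , a)) , lift (inj₂ (_ , b))) = e w (a , b)

    between-ω : ∀ k i (w : Carrier (ωk k)) → ¬ (_<_ (ωk k) (inj₁ i) w × _<_ (ωk k) w (inj₁ (suc i)))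
    between-ω k i (inj₁ j) (a , b) = ℕₚ.<⇒≱ a (ℕₚ.≤-pred b)

    between-k : ∀ k a .(p : a ℕ.≤ k) .(q : suc a ℕ.≤ k) (w : Carrier (ωk k)) →
      ¬ (_<_ (ωk k) (inj₂ (sub a p)) w × _<_ (ωk k) w (inj₂ (sub (suc a) q)))
    between-k k a p q (inj₂ w) (c , d) = ℕₚ.<⇒≱ c (ℕₚ.≤-pred d)

    between-first : ∀ k n → Empty k (inj₁ (s n)) (inj₂ (n , inj₁ 0))
    between-first k n (inj₁ w) (a , b) = b a
    between-first k n (inj₂ (m , z)) (a , lift (inj₁ lt)) = a (mono-seq-< s s-up lt)
    between-first k n (inj₂ (m , inj₁ i)) (a , lift (inj₂ (refl , ())))
    between-first k n (inj₂ (m , inj₂ i)) (a , lift (inj₂ (refl , ())))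

    blocked : ∀ {k} {u v : Carrier (S k)} → NoSuccS k u → _<_ (S k) u v → Empty k u v → ⊥
    blocked {k} {u} {v} ns lt e = let (w , ab) = ns v lt in e w ab

    old-NoSucc : ∀ {k g} → NoSuccS k (inj₁ g) → (∀ n → ¬ g ≡ s n) → NoSucc g
    old-NoSucc {k} {g} ns ne v lt = sort (ns (inj₁ v) lt)
      where
      sort : (Σ (Carrier (S k)) λ w → _<_ (S k) (inj₁ g) w × _<_ (S k) w (inj₁ v)) → Σ A λ w → g ≺ w × w ≺ v
      sort (inj₁ w , ab) = w , ab
      sort (inj₂ (n , z) , a , b) = s n , (case ≼⇒≺⊎≡ a of λ { (inj₁ q) → q ; (inj₂ eq) → ⊥-elim (ne n eq) }) , dne b

    -- Among new points only cluster tops lack a successor, and the marks have one. The bound `s 1`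
    -- ensures that an old point is in the orbit region.
    unmatch : ∀ {k} (v : Carrier (S k)) → NoSuccS k v → LowS v → ¬ _<_ (S k) v (inj₁ (s 1)) →
      Σ A λ u → (M u × s 1 ≼ u) × Match k u v
    unmatch {k} (inj₂ (n , inj₁ i)) ns _ _ = ⊥-elim (blocked {k} {inj₂ (n , inj₁ i)} {inj₂ (n , inj₁ (suc i))} ns
      (lift (inj₂ (refl , ℕₚ.≤-refl))) (between-same k n (inj₁ i) (inj₁ (suc i)) (between-ω k i)))
    unmatch {k} (inj₂ (n , inj₂ (sub a p))) ns _ le = sort (ℕₚ.<-cmp a k)
      where
      sort : Tri (a ℕ.< k) (a ≡ k) (k ℕ.< a) → Σ A λ u → (M u × s 1 ≼ u) × Match k u (inj₂ (n , inj₂ (sub a p)))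
      sort (tri< a<k _ _) = ⊥-elim (blocked {k} {inj₂ (n , inj₂ (sub a p))} {inj₂ (n , inj₂ (sub (suc a) a<k))} ns
        (lift (inj₂ (refl , ℕₚ.≤-refl))) (between-same k n (inj₂ (sub a p)) (inj₂ (sub (suc a) a<k)) (between-k k a p a<k)))
      sort (tri≈ _ eq _) = s n , (s-M n , dne le) , inj₁ (n , refl , cong (λ t → inj₂ (n , inj₂ t)) (sub-≡ {x = sub a p} {sub k ℕₚ.≤-refl} eq))
      sort (tri> _ _ k<a) = ⊥-elim-irr (ℕₚ.<⇒≱ k<a p)
    unmatch {k} (inj₁ g) ns (n , g≼) le = g ,
        (((≼-trans (proj₁ (proj₁ (s-M 1))) le , m , ≼-trans g≼ hi) , old-NoSucc ns ne) , le) , inj₂ (ne , refl)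
      where
      m : ℕ
      m = proj₁ (proj₂ (proj₁ (s-M n)))
      hi : s n ≼ X m
      hi = proj₂ (proj₂ (proj₁ (s-M n)))
      ne : ∀ n → ¬ g ≡ s n
      ne n eq = blocked {k} {inj₁ (s n)} {inj₂ (n , inj₁ 0)} (subst (λ t → NoSuccS k (inj₁ t)) eq ns) ≼-refl (between-first k n)

    top-run : ∀ k n → Clusters.Run (S k) k (inj₂ (n , top k))
    top-run k n = run k ℕₚ.≤-refl
      where
      open Clusters (S k)
      run : ∀ a .(p : a ℕ.≤ k) → Run a (inj₂ (n , inj₂ (sub a p)))
      run zero p = stop none
        where
        none : ∀ v → ¬ (v ⋖ inj₂ (n , inj₂ (sub zero p)))
        none (inj₁ z) (d , nb) = nb (inj₂ (n , inj₁ 0)) (d , lift (inj₂ (refl , tt)))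
        none (inj₂ (m , z)) (lift (inj₁ lt) , nb) = nb (inj₂ (n , inj₁ 0)) (lift (inj₁ lt) , lift (inj₂ (refl , tt)))
        none (inj₂ (.n , inj₁ i)) (lift (inj₂ (refl , _)) , nb) = nb (inj₂ (n , inj₁ (suc i))) (lift (inj₂ (refl , ℕₚ.≤-refl)) , lift (inj₂ (refl , tt)))
        none (inj₂ (.n , inj₂ _)) (lift (inj₂ (refl , ())) , _)
      run (suc a) p = step {v = inj₂ (n , inj₂ (sub a (ℕₚ.≤-trans (ℕₚ.n≤1+n a) p)))}
        (lift (inj₂ (refl , ℕₚ.≤-refl)) , between-same k n (inj₂ (sub a (ℕₚ.≤-trans (ℕₚ.n≤1+n a) p))) (inj₂ (sub (suc a) p)) (between-k k a (ℕₚ.≤-trans (ℕₚ.n≤1+n a) p) p)) (run a (ℕₚ.≤-trans (ℕₚ.n≤1+n a) p))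

    module _ {j l : ℕ} (φ : Iso (S j) (S l)) where
      private
        module Sl = Order (S l)
        module Sj = Order (S j)

        -- Chosen so that the tail from `s n₀` is sent above `s 1`, where `unmatch` applies.
        n₀ : ℕ
        n₀ = proj₁ (LowS-bound (app (bwd φ) (inj₁ (s 1))) (keeps-Low (Iso-sym φ) (inj₁ (s 1)) (1 , ≼-refl)))

        LowS-pos : ∀ {k} (u : Carrier (S k)) (w : LowS u) → 1 ℕ.≤ proj₁ (LowS-bound u w)
        LowS-pos (inj₁ _) _ = ℕ.s≤s ℕ.z≤n
        LowS-pos (inj₂ _) _ = ℕ.s≤s ℕ.z≤n

        n₀≥1 : 1 ℕ.≤ n₀
        n₀≥1 = LowS-pos (app (bwd φ) (inj₁ (s 1))) (keeps-Low (Iso-sym φ) (inj₁ (s 1)) (1 , ≼-refl))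

        start-≽ : ∀ {v} → ¬ _<_ (S j) v (inj₁ (s n₀)) → ¬ _<_ (S l) (app (fwd φ) v) (inj₁ (s 1))
        start-≽ {v} le lt = le (Sj.≺-trans {v} {app (bwd φ) (inj₁ (s 1))} {inj₁ (s n₀)}
          (subst (λ t → _<_ (S j) t (app (bwd φ) (inj₁ (s 1)))) (bwd-fwd φ v) (app-mono (bwd φ) {app (fwd φ) v} {inj₁ (s 1)} lt))
          (proj₂ (LowS-bound (app (bwd φ) (inj₁ (s 1))) (keeps-Low (Iso-sym φ) (inj₁ (s 1)) (1 , ≼-refl)))))

        Match-≽ : ∀ {k n u v} → s n ≼ u → Match k u v → ¬ _<_ (S k) v (inj₁ (s n))
        Match-≽ le (inj₁ (n′ , refl , refl)) lt = lt le
        Match-≽ le (inj₂ (_ , refl)) lt = le lt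

        Img : A → A → Set ℓ
        Img u u′ = Σ (Carrier (S j)) λ v → Match j u v × (M u′ × s 1 ≼ u′) × Match l u′ (app (fwd φ) v)

        image : ∀ u → Tail (s n₀) u → Σ A (Img u)
        image u (mu , le) = via (match j u)
          where
          via : Σ (Carrier (S j)) (Match j u) → Σ A (Img u)
          via (v , mt) = let
              (ns , low) = Match-NoSucc mu mt
              (u′ , p , mt′) = unmatch (app (fwd φ) v) (Iso-NoSucc φ v ns) (keeps-Low φ v low) (start-≽ {v} (Match-≽ le mt))
            in u′ , v , mt , p , mt′

        opaque
          θ : Σ (A → A) λ θ → ∀ {u} → Tail (s n₀) u → Img u (θ u)
          θ = choose image

        base : Tail (s n₀) (s n₀)
        base = s-M n₀ , ≼-refl

        u₀ : A
        u₀ = proj₁ θ (s n₀)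

        θ-incr : ∀ {u u′} → Tail (s n₀) u → Tail (s n₀) u′ → u ≺ u′ → proj₁ θ u ≺ proj₁ θ u′
        θ-incr {u} {u′} p q lt = step (proj₂ θ p) (proj₂ θ q)
          where
          step : Img u (proj₁ θ u) → Img u′ (proj₁ θ u′) → proj₁ θ u ≺ proj₁ θ u′
          step (v , mt , _ , mt₁) (v′ , mt′ , _ , mt₁′) = Match-reflect mt₁ mt₁′ (app-mono (fwd φ) {v} {v′} (Match-mono mt mt′ lt))

        θ-weak : ∀ {u} → Tail (s n₀) u → u₀ ≼ proj₁ θ u
        θ-weak {u} (m , le) = case ≼⇒≺⊎≡ le of λ where
          (inj₁ lt) → ≺⇒≼ (θ-incr base (m , le) lt)
          (inj₂ eq) → subst (λ t → u₀ ≼ proj₁ θ t) eq ≼-refl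

        tail-iso : TailIso (s n₀) u₀
        tail-iso = record
          { emb = record { fn = proj₁ θ ; into = λ p → (let (_ , _ , (mu , _) , _) = proj₂ θ p in mu) , θ-weak p ; incr = θ-incr }
          ; onto = λ p → preimage p (match l _) }
          where
          preimage : ∀ {y} → Tail u₀ y → Σ (Carrier (S l)) (Match l y) → Σ A λ u → Tail (s n₀) u × proj₁ θ u ≡ y
          preimage {y} (my , le) (v , mt) = finish (proj₂ θ base)
            where
            v′ = app (bwd φ) v
            ns = Match-NoSucc my mt
            above : Img (s n₀) u₀ → ¬ _<_ (S j) v′ (inj₁ (s n₀))
            above (v₀ , mt₀ , _ , mt₁) lt = le (Match-reflect mt mt₁
              (subst (λ t → _<_ (S l) t (app (fwd φ) v₀)) (fwd-bwd φ v)
                (app-mono (fwd φ) {v′} {v₀} (Sj.≺-≼ {v′} {inj₁ (s n₀)} {v₀} lt (Match-≽ ≼-refl mt₀)))))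
            finish : Img (s n₀) u₀ → Σ A λ u → Tail (s n₀) u × proj₁ θ u ≡ y
            finish img = build (unmatch-from v′ (Iso-NoSucc (Iso-sym φ) v (proj₁ ns)) (keeps-Low (Iso-sym φ) v (proj₂ ns)) (above img))
              where
              unmatch-from : ∀ v′ → NoSuccS j v′ → LowS v′ → ¬ _<_ (S j) v′ (inj₁ (s n₀)) → Σ A λ u → (M u × s n₀ ≼ u) × Match j u v′
              unmatch-from v′ ns low ge = case unmatch v′ ns low (λ lt → ge (Sj.≺-≼ {v′} {inj₁ (s 1)} {inj₁ (s n₀)} lt (s-≤ n₀≥1))) of
                λ (u , (mu , _) , mt′) → u , (mu , λ lt → ge (below mt′ lt)) , mt′
                where
                below : ∀ {u} → Match j u v′ → u ≺ s n₀ → _<_ (S j) v′ (inj₁ (s n₀))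
                below (inj₁ (n , refl , refl)) lt = λ le → le lt
                below (inj₂ (_ , refl)) lt = lt
              build : (Σ A λ u → (M u × s n₀ ≼ u) × Match j u v′) → Σ A λ u → Tail (s n₀) u × proj₁ θ u ≡ y
              build (u , t , mt′) = u , t , same (proj₂ θ t)
                where
                same : Img u (proj₁ θ u) → proj₁ θ u ≡ y
                same (v″ , mt″ , _ , mt₂) = ≼-antisym
                  (λ lt → Sl.≺-irr {v} (subst (_<_ (S l) v) eq (Match-mono mt mt₂ lt)))
                  (λ lt → Sl.≺-irr {v} (subst (λ t → _<_ (S l) t v) eq (Match-mono mt₂ mt lt)))
                  where
                  eq : app (fwd φ) v″ ≡ v
                  eq = trans (cong (app (fwd φ)) (Match-functional mt″ mt′)) (fwd-bwd φ v)

      -- By closedness the mark `s n₀` corresponds to a mark, so a cluster top is sent to a cluster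
      -- top and their runs agree.
      same-index : j ≡ l
      same-index = via (proj₂ θ base)
        where
        via : Img (s n₀) u₀ → j ≡ l
        via (v , mt , (mu , s₁≼) , mt′) = Clusters.Run-unique (S l)
            (subst (Clusters.Run (S l) j) at-top (Iso-Run φ (top-run j n₀))) (top-run l (proj₁ m))
          where
          m : Σ ℕ λ m → u₀ ≡ s m
          m = closed n₀ (mu , ≼-trans (≺⇒≼ (s-up 0)) s₁≼) tail-iso
          at-top : app (fwd φ) (inj₂ (n₀ , top j)) ≡ inj₂ (proj₁ m , top l)
          at-top = trans (cong (app (fwd φ)) (Match-functional (inj₁ (n₀ , refl , refl)) mt))
                     (Match-functional mt′ (inj₁ (proj₁ m , proj₂ m , refl)))

    sibInf : SibInf C
    sibInf = S , (λ k → I.old k , I.retract k) , λ m n φ → same-index φ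

  -- Inserting ω* after each orbit point makes the points without successor cofinal.
  module Mixed (C : Chain ℓ) (not-big : (h : C ↪ C) (y : Carrier C) → ¬ Patterns.Big C y (app h y))
    (f : C ↪ C) (x : Carrier C) (x≺fx : _<_ C x (app f x))
    (asc : Order.Asc C x (app f x)) (desc : Order.Desc C x (app f x)) where
    open Order C
    open Orbit C f x x≺fx

    private
      δ : ℕ → A
      δ = proj₁ desc
      δ-down : ∀ n → δ (suc n) ≺ δ n
      δ-down = proj₁ (proj₂ desc)

    module I = InsertAfter C f x x≺fx X X-up (λ n → X-≤ {0} {n} ℕ.z≤n , n , ≼-refl) (λ m → m , ≼-refl) ω*
      (λ n → δ (suc n)) (λ {y} {z} lt → Order.mono-seq-< (op C) δ δ-down (ℕ.s≤s lt))
      (λ n → ≼-≺ (proj₂ (proj₂ (proj₂ desc)) (suc (suc n))) (δ-down (suc n)))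
      (λ n → ≺-≼ (δ-down n) (proj₁ (proj₂ (proj₂ desc)) n))

    G : Chain ℓ
    G = I.S

    private
      module G = Order G

      f′ : G ↪ G
      f′ = I.old ∘↪ (f ∘↪ I.retract)

      x′ : Carrier G
      x′ = inj₁ x

      fx≼ : ∀ u → app f u ≼ app f (app I.retract (inj₁ u))
      fx≼ u = ↪-≼ f (I.retract-≽ u)

      x′≺ : x′ G.≺ app f′ x′
      x′≺ = ≺-≼ x≺fx (fx≼ x)

      X′ : ℕ → Carrier G
      X′ n = iter n (app f′) x′

      X′-≽ : ∀ n → inj₁ (X n) G.≼ X′ n
      X′-≽ zero = ≼-refl
      X′-≽ (suc n) = ≼-trans (fx≼ (X n)) (↪-≼ f (↪-≼ I.retract {inj₁ (X n)} {X′ n} (X′-≽ n)))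

      X′-≼ : ∀ n → Σ ℕ λ m → X′ n G.≼ inj₁ (X m)
      X′-≼ zero = 0 , ≼-refl
      X′-≼ (suc n) = case X′-≼ n of λ (m , le) → case I.retract-bound (X m) m ≼-refl of λ (m′ , le′) →
        suc m′ , ↪-≼ f (≼-trans (↪-≼ I.retract {X′ n} {inj₁ (X m)} le) le′)

      no-succ : ∀ n v → inj₁ (X n) G.≺ v → Σ (Carrier G) λ w → inj₁ (X n) G.≺ w × w G.≺ v
      no-succ n (inj₁ v) lt = inj₂ (n , 0) , ≼-refl , λ le → le lt
      no-succ n (inj₂ (m , i)) le = inj₂ (n , suc i) , ≼-refl , lift (sort (ℕₚ.m≤n⇒m<n∨m≡n n≤m))
        where
        n≤m : n ℕ.≤ m
        n≤m = ℕₚ.≮⇒≥ λ m<n → le (mono-seq-< X X-up m<n)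
        sort : n ℕ.< m ⊎ n ≡ m → _<_ (ω ⊗ ω*) (n , suc i) (m , i)
        sort (inj₁ lt) = inj₁ lt
        sort (inj₂ refl) = inj₂ (refl , ℕₚ.≤-refl)

      -- `retract` carries the copy into `C`; since it never lowers an old point and raises new ones
      -- above their place, the conjugate of `h` still moves past that copy.
      not-big′ : (h : G ↪ G) (y : Carrier G) → ¬ Patterns.Big G y (app h y)
      not-big′ h y b = not-big (I.retract ∘↪ (h ∘↪ I.old)) (app I.retract y) record
        { t = λ m n → app I.retract (t m n)
        ; t-in = λ m n → app-mono I.retract {t m (suc n)} {t m n} (t-in m n)
        ; t-out = λ m n n′ → app-mono I.retract {t m n} {t (suc m) n′} (t-out m n n′)
        ; t-lower = λ m n → ↪-≼ I.retract {y} {t m n} (t-lower m n)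
        ; t-upper = λ m n → ≼-trans (↪-≼ I.retract {t m n} {app h y} (t-upper m n))
            (↪-≼ I.retract {app h y} {app h (inj₁ (app I.retract y))} (↪-≼ h {y} {inj₁ (app I.retract y)} (I.old-retract-≽ y))) }
        where open Patterns.Big b

    sibInf : SibInf C
    sibInf = SibInf-equi I.old I.retract (InsertClusters.sibInf G f′ x′ x′≺ not-big′
      (G.Asc-mono {x′} {x′} {inj₁ (app f x)} {app f′ x′} ≼-refl (fx≼ x) asc′) (G.Desc-mono {x′} {x′} {inj₁ (app f x)} {app f′ x′} ≼-refl (fx≼ x) desc′)
      λ m → case X′-≼ m of λ (n , le) → inj₁ (X n) , ((X-≤ {0} {n} ℕ.z≤n , n , X′-≽ n) , no-succ n) , le)
      where
      asc′ : G.Asc x′ (inj₁ (app f x))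
      asc′ = ↪-Asc I.old asc
      desc′ : G.Desc x′ (inj₁ (app f x))
      desc′ = ↪-Desc I.old desc

  -- The least inflationary embedding φ into D is automatically onto: if d is missed, φ can be
  -- lowered to d at the first x with d ≺ φ x.
  module RightMoved (C : Chain ℓ) (g : C ↪ C) (D : Carrier C → Set ℓ) (gD : ∀ x → D (app g x)) where
    open Order C

    it : ℕ → A → A
    it n = iter n (app g)

    Rw : A → Set ℓ
    Rw z = z ≺ app g z × (∀ n → ¬ Desc z (it n z))

    Rw-between : ∀ {x z} → Rw x → x ≼ z → z ≼ app g x → Rw z
    Rw-between {x} {z} (lt , wo) x≼z z≼gx = z≺gz , λ n d →
      wo (suc n) (Desc-mono x≼z (subst (it n z ≼_) (iter-suc n (app g) x) (mono-≼ (iter-mono (app-mono g) n) z≼gx)) d)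
      where
      z≺gz : z ≺ app g z
      z≺gz with ≼⇒≺⊎≡ x≼z
      ... | inj₁ p = ≼-≺ z≼gx (app-mono g p)
      ... | inj₂ refl = lt

    private
      -- Competitors live on the whole chain and agree with `g` off `Rw`, so that monotonicity
      -- across the border of `Rw` is available when a value is lowered.
      record H (h : A → A) : Set ℓ where
        field
          h-mono : Mono h
          h-D : ∀ z → D (h z)
          h-lo : ∀ {z} → Rw z → z ≼ h z
          h-hi : ∀ {z} → Rw z → h z ≼ app g z
          h-off : ∀ {z} → ¬ Rw z → h z ≡ app g z
      open H

      g-H : H (app g)
      g-H = record { h-mono = app-mono g ; h-D = gD ; h-lo = λ r → ≺⇒≼ (proj₁ r) ; h-hi = λ _ → ≼-refl ; h-off = λ _ → refl }

      Least : A → A → Set ℓ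
      Least z w = (Σ (A → A) λ h → H h × w ≡ h z) × (∀ h → H h → w ≼ h z)

      opaque
        chosen : Σ (A → A) λ φ → ∀ {z} → Rw z → Least z (φ z)
        chosen = choose {P = Rw} {Q = Least} λ z r →
          let (w , a , min) = least (λ w → Σ (A → A) λ h → H h × w ≡ h z)
                (interval-NoDesc (proj₂ r 1) (λ w → Σ (A → A) λ h → H h × w ≡ h z) λ { (h , hh , refl) → h-lo hh r , h-hi hh r }) (app g z , app g , g-H , refl)
          in w , a , λ h hh → min (h z) (h , hh , refl)

    φ : A → A
    φ = proj₁ chosen

    φ-D : ∀ {z} → Rw z → D (φ z)
    φ-D {z} r = let ((h , hh , eq) , _) = proj₂ chosen r in subst D (sym eq) (h-D hh z)

    φ-lo : ∀ {z} → Rw z → z ≼ φ z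
    φ-lo {z} r = let ((h , hh , eq) , _) = proj₂ chosen r in subst (z ≼_) (sym eq) (h-lo hh r)

    φ-hi : ∀ {z} → Rw z → φ z ≼ app g z
    φ-hi {z} r = proj₂ (proj₂ chosen r) (app g) g-H

    φ-above : ∀ {x y} → Rw y → x ≺ y → (h : A → A) → H h → φ y ≡ h y → h x ≺ φ y
    φ-above r lt h hh eq = subst (h _ ≺_) (sym eq) (h-mono hh lt)

    φ-mono : ∀ {x y} → Rw x → Rw y → x ≺ y → φ x ≺ φ y
    φ-mono {x} {y} rx ry lt = let ((h , hh , eq) , _) = proj₂ chosen ry in
      ≼-≺ (proj₂ (proj₂ chosen rx) h hh) (φ-above ry lt h hh eq)

    φ-onto : ∀ {d} → Rw d → D d → Σ A λ x → Rw x × φ x ≡ d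
    φ-onto {d} rd Dd = x₁ , rx₁ , ≼-antisym (≼-trans (proj₂ (proj₂ chosen rx₁) h h-H) (≡⇒≼ h-x₁)) (proj₂ (proj₂ (proj₁ (proj₂ first))))
      where
      P : A → Set ℓ
      P x = Rw x × (x ≼ d × d ≼ φ x)
      -- The images under `φ` would descend between `d` and `g d`.
      P-NoDesc : NoDesc P
      P-NoDesc (s , p , down) = proj₂ (proj₁ (p 0)) 1 (Desc-mono (proj₁ (proj₂ (p 0))) (φ-hi (proj₁ (p 0)))
        ((λ n → φ (s n)) , (λ n → φ-mono (proj₁ (p (suc n))) (proj₁ (p n)) (down n)) , up , λ n → proj₂ (proj₂ (p n))))
        where
        up : ∀ n → φ (s n) ≼ φ (s 0)
        up zero = ≼-refl
        up (suc n) = ≼-trans (≺⇒≼ (φ-mono (proj₁ (p (suc n))) (proj₁ (p n)) (down n))) (up n)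
      opaque
        first : Σ A λ x → P x × (∀ z → P z → x ≼ z)
        first = least P P-NoDesc (d , rd , ≼-refl , φ-lo rd)
      x₁ : A
      x₁ = proj₁ first
      rx₁ : Rw x₁
      rx₁ = proj₁ (proj₁ (proj₂ first))
      x₁≼d : x₁ ≼ d
      x₁≼d = proj₁ (proj₂ (proj₁ (proj₂ first)))
      V : A → A → Set ℓ
      V z w = (z ≡ x₁ × w ≡ d) ⊎ (¬ (z ≡ x₁) × ((Rw z × w ≡ φ z) ⊎ (¬ Rw z × w ≡ app g z)))
      opaque
        vs : ∀ z → Σ A (V z)
        vs z with em (z ≡ x₁) | em (Rw z)
        ... | yes eq | _ = d , inj₁ (eq , refl)
        ... | no ne | yes r = φ z , inj₂ (ne , inj₁ (r , refl))
        ... | no ne | no ¬r = app g z , inj₂ (ne , inj₂ (¬r , refl))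
      h : A → A
      h z = proj₁ (vs z)
      h-x₁ : h x₁ ≡ d
      h-x₁ with proj₂ (vs x₁)
      ... | inj₁ (_ , eq) = eq
      ... | inj₂ (ne , _) = ⊥-elim (ne refl)
      pre-d : ∀ {z w} → z ≺ x₁ → (Rw z × w ≡ φ z) ⊎ (¬ Rw z × w ≡ app g z) → w ≺ d
      pre-d {z} lt (inj₁ (r , refl)) with split (φ z) d
      ... | inj₁ p = p
      ... | inj₂ p = ⊥-elim (proj₂ (proj₂ first) z (r , ≼-trans (≺⇒≼ lt) x₁≼d , p) lt)
      pre-d {z} lt (inj₂ (¬r , refl)) with split (app g z) d
      ... | inj₁ p = p
      -- Now `z ≼ d ≼ g z`, so a descent along the orbit of `z`, moved by `g`, would be one along
      -- the orbit of `d`. Hence `z` would be in `Rw`.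
      ... | inj₂ p = ⊥-elim (¬r (z≺gz , λ n ds → proj₂ rd (suc n) (Desc-mono p
              (mono-≼ (app-mono g) (mono-≼ (iter-mono (app-mono g) n) z≼d)) (Desc-map (app-mono g) ds))))
        where
        z≼d : z ≼ d
        z≼d = ≼-trans (≺⇒≼ lt) x₁≼d
        z≺gz : z ≺ app g z
        z≺gz = ≺-≼ (≺-≼ lt x₁≼d) p
      V-mono : ∀ {u v u′ v′} → V u u′ → V v v′ → u ≺ v → u′ ≺ v′
      V-mono (inj₁ (refl , refl)) (inj₁ (refl , refl)) lt = ⊥-elim (≺-irr lt)
      V-mono (inj₁ (refl , refl)) (inj₂ (_ , inj₁ (r , refl))) lt = ≼-≺ (proj₂ (proj₂ (proj₁ (proj₂ first)))) (φ-mono rx₁ r lt)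
      V-mono (inj₁ (refl , refl)) (inj₂ (_ , inj₂ (_ , refl))) lt =
        ≼-≺ (≼-trans (proj₂ (proj₂ (proj₁ (proj₂ first)))) (φ-hi rx₁)) (app-mono g lt)
      V-mono (inj₂ (_ , c)) (inj₁ (refl , refl)) lt = pre-d lt c
      V-mono (inj₂ (_ , inj₁ (r , refl))) (inj₂ (_ , inj₁ (r′ , refl))) lt = φ-mono r r′ lt
      V-mono (inj₂ (_ , inj₁ (r , refl))) (inj₂ (_ , inj₂ (_ , refl))) lt = ≼-≺ (φ-hi r) (app-mono g lt)
      V-mono {u} (inj₂ (_ , inj₂ (¬r , refl))) (inj₂ (_ , inj₁ (r′ , refl))) lt =
        let ((k , kh , eq) , _) = proj₂ chosen r′ in subst (_≺ φ _) (h-off kh ¬r) (φ-above r′ lt k kh eq)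
      V-mono (inj₂ (_ , inj₂ (_ , refl))) (inj₂ (_ , inj₂ (_ , refl))) lt = app-mono g lt
      V-D : ∀ {z w} → V z w → D w
      V-D (inj₁ (_ , refl)) = Dd
      V-D (inj₂ (_ , inj₁ (r , refl))) = φ-D r
      V-D (inj₂ (_ , inj₂ (_ , refl))) = gD _
      V-lo : ∀ {z w} → V z w → Rw z → z ≼ w
      V-lo (inj₁ (refl , refl)) _ = x₁≼d
      V-lo (inj₂ (_ , inj₁ (r , refl))) _ = φ-lo r
      V-lo (inj₂ (_ , inj₂ (¬r , _))) r = ⊥-elim (¬r r)
      V-hi : ∀ {z w} → V z w → Rw z → w ≼ app g z
      V-hi (inj₁ (refl , refl)) _ = ≼-trans (proj₂ (proj₂ (proj₁ (proj₂ first)))) (φ-hi rx₁)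
      V-hi (inj₂ (_ , inj₁ (r , refl))) _ = φ-hi r
      V-hi (inj₂ (_ , inj₂ (¬r , _))) r = ⊥-elim (¬r r)
      V-off : ∀ {z w} → V z w → ¬ Rw z → w ≡ app g z
      V-off (inj₁ (refl , _)) ¬r = ⊥-elim (¬r rx₁)
      V-off (inj₂ (_ , inj₁ (r , _))) ¬r = ⊥-elim (¬r r)
      V-off (inj₂ (_ , inj₂ (_ , eq))) _ = eq
      h-H : H h
      h-H = record { h-mono = λ {u} {v} → V-mono (proj₂ (vs u)) (proj₂ (vs v)) ; h-D = λ z → V-D (proj₂ (vs z))
                   ; h-lo = λ {z} → V-lo (proj₂ (vs z)) ; h-hi = λ {z} → V-hi (proj₂ (vs z)) ; h-off = λ {z} → V-off (proj₂ (vs z)) }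

  -- Left-moving orbits and the classes that they meet.

  module Gluing (C : Chain ℓ) where
    open Order C

    Emb-glue : {X Y Y₁ Y₂ : A → Set ℓ} (q : A) → Emb (λ z → X z × z ≺ q) Y₁ → Emb (λ z → X z × q ≼ z) Y₂ →
      (∀ {y z} → Y₁ y → Y₂ z → y ≺ z) → (∀ {y} → Y₁ y → Y y) → (∀ {y} → Y₂ y → Y y) → Emb X Y
    Emb-glue {X} {Y} q e₁ e₂ sep i₁ i₂ = record { fn = h ; into = h-into ; incr = h-incr }
      where
      h : A → A
      h z with split z q
      ... | inj₁ _ = fn e₁ z
      ... | inj₂ _ = fn e₂ z
      h-into : ∀ {z} → X z → Y (h z)
      h-into {z} xz with split z q
      ... | inj₁ lt = i₁ (into e₁ (xz , lt))
      ... | inj₂ le = i₂ (into e₂ (xz , le))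
      h-incr : ∀ {y z} → X y → X z → y ≺ z → h y ≺ h z
      h-incr {y} {z} xy xz lt with split y q | split z q
      ... | inj₁ p | inj₁ p′ = incr e₁ (xy , p) (xz , p′) lt
      ... | inj₁ p | inj₂ p′ = sep (into e₁ (xy , p)) (into e₂ (xz , p′))
      ... | inj₂ p | inj₁ p′ = ⊥-elim (p (≺-trans lt p′))
      ... | inj₂ p | inj₂ p′ = incr e₂ (xy , p) (xz , p′) lt

  module LeftOrbits (C : Chain ℓ) (g : C ↪ C) where
    open Order C
    open Classes C
    open Interval C

    it : ℕ → A → A
    it n = iter n (app g)

    it↪ : ℕ → C ↪ C
    it↪ n = mk↪ (it n) (iter-mono (app-mono g) n)

    Lw : A → Set ℓ
    Lw b = app g b ≺ b × Σ ℕ λ n → Asc (it n b) b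

    Folds : A → Set ℓ
    Folds b = Σ ℕ λ m → Emb (λ v → b ~ v × b ≼ v) [ it m b , b ⟩

    -- `ω` successive copies of `[ u , v ⟩`. The dividing points are part of the data, so even an
    -- empty interval demands an `ω`.
    Seq : A → A → A → A → Set ℓ
    Seq x y u v = Σ (ℕ → A) λ a → (∀ i → a i ≺ a (suc i)) × (∀ i → x ≼ a i × a i ≺ y) × (∀ i → Emb [ u , v ⟩ [ a i , a (suc i) ⟩)

    Grows : A → Set ℓ
    Grows b = ∀ n → Σ ℕ λ m → Seq (it m b) (it n b) (it n b) b

    -- Leaves out the points with only finitely many class members above them, for which tameness
    -- gives no control of the image under `g`.
    UpInf : A → Set ℓ
    UpInf v = Σ (ℕ → A) λ s → (∀ n → s n ≺ s (suc n)) × v ≼ s 0 × (∀ n → v ~ s n)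

    UpInf-down : ∀ {u v} → u ≼ v → u ~ v → UpInf v → UpInf u
    UpInf-down le uv (s , up , lo , cl) = s , up , ≼-trans le lo , λ n → ~-trans uv (cl n)

    UpInf-tail : ∀ {v} ((s , _) : UpInf v) → ∀ n → UpInf (s n)
    UpInf-tail (s , up , lo , cl) n = (λ i → s (i ℕ.+ n)) , (λ i → up (i ℕ.+ n)) , ≼-refl , λ i → ~-trans (~-sym (cl n)) (cl (i ℕ.+ n))

  module AtLeft (C : Chain ℓ) (g : C ↪ C) (tame : Tame C) (tame* : Tame (op C)) (b : Carrier C) (lw : LeftOrbits.Lw C g b) where
    open Order C
    open Classes C
    open Interval C
    open Gluing C
    open LeftOrbits C g

    B : ℕ → A
    B n = it n b

    B-down : ∀ n → B (suc n) ≺ B n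
    B-down zero = proj₁ lw
    B-down (suc n) = app-mono g (B-down n)

    B-anti : ∀ {m n} → m ℕ.≤ n → B n ≼ B m
    B-anti = Order.mono-seq (op C) B B-down

    it-mono : ∀ n → Mono (it n)
    it-mono n = iter-mono (app-mono g) n

    it-B : ∀ m n → it m (B n) ≡ B (m ℕ.+ n)
    it-B m n = sym (iter-+ m n (app g) b)

    n₀ : ℕ
    n₀ = proj₁ (proj₂ lw)

    B-asc : Asc (B n₀) b
    B-asc = proj₂ (proj₂ lw)

    -- Up to a sufficiently high power of `g` the orbit interval contains the `ω` given by `Lw`; a
    -- descent in it would violate tameness of the opposite chain.
    B-wo : ∀ n → ¬ Desc (B n) b
    B-wo n d = tame* (op↪ (it↪ (n₀ ℕ.+ suc n))) b below-b
      ( Desc-mono (B-anti (ℕₚ.≤-trans (ℕₚ.n≤1+n n) (ℕₚ.m≤n+m (suc n) n₀))) ≼-refl d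
      , Asc-mono (B-anti (ℕₚ.m≤m+n n₀ (suc n))) ≼-refl B-asc)
      where
      below-b : B (n₀ ℕ.+ suc n) ≺ b
      below-b = subst (λ t → B t ≺ b) (sym (ℕₚ.+-suc n₀ n)) (≺-≼ (B-down (n₀ ℕ.+ n)) (B-anti {0} {n₀ ℕ.+ n} ℕ.z≤n))

    B~b : ∀ n → b ~ B n
    B~b n = ~-sym (~-of-≼ (B-anti {0} {n} ℕ.z≤n) (B-wo n))

    -- Otherwise the orbit itself would descend between `v` and `b`.
    coinitial : ∀ {v} → b ~ v → Σ ℕ λ n → B n ≼ v
    coinitial {v} bv = dne λ ¬n → proj₂ bv
      (B , B-down , (λ n → B-anti {0} {n} ℕ.z≤n) , λ n → λ lt → ¬n (n , ≺⇒≼ lt))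

    class-NoDesc : ∀ x → b ~ x → (P : A → Set ℓ) → (∀ {z} → P z → x ≼ z × b ~ z) → NoDesc P
    class-NoDesc x bx P h (s , p , d) = proj₁ (~-trans (~-sym bx) (proj₂ (h (p 0)))) (s , d , up , λ n → proj₁ (h (p n)))
      where
      up : ∀ n → s n ≼ s 0
      up zero = ≼-refl
      up (suc n) = ≼-trans (≺⇒≼ (d n)) (up n)

    it-class : ∀ k {v} → b ~ v → v ≼ b → b ~ it k v
    it-class k {v} bv v≼b = let (n , le) = coinitial bv in
      ~-convex (B~b (k ℕ.+ n)) (B~b k) (subst (_≼ it k v) (it-B k n) (mono-≼ (it-mono k) le)) (mono-≼ (it-mono k) v≼b)

    -- The points `B (n₀ + n₀)`, `B n₀` and `b` enclose two copies of `ω`. The class is first folded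
    -- below `b` and then pushed below the lowest of them by `g`.
    Folds⇒sibInf : Folds b → SibInf C
    Folds⇒sibInf (m , e) = TopInsert.sibInf C tame b (B n₀) (B (n₀ ℕ.+ n₀)) (B n₀) b
      (~-sym (B~b n₀)) B-asc ~-refl
      (subst (λ t → Asc t (B n₀)) (it-B n₀ n₀) (Asc-map (it-mono n₀) B-asc)) B-asc
      (Emb-trans down record
        { fn = it (n₀ ℕ.+ n₀) ; into = λ (bz , lt) → it-class (n₀ ℕ.+ n₀) bz (≺⇒≼ lt) , it-mono (n₀ ℕ.+ n₀) lt
        ; incr = λ _ _ → it-mono (n₀ ℕ.+ n₀) })
      where
      down : Emb (b ~_) (λ z → b ~ z × z ≺ b)
      down = Emb-glue {Y₁ = λ z → b ~ z × z ≺ B m} {Y₂ = [ B m , b ⟩} b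
        (record { fn = it m ; into = λ (bz , lt) → it-class m bz (≺⇒≼ lt) , it-mono m lt ; incr = λ _ _ → it-mono m })
        e (λ (_ , lt) (le , _) → ≺-≼ lt le)
        (λ (bz , lt) → bz , ≺-≼ lt (B-anti {0} {m} ℕ.z≤n))
        (λ (le , lt) → ~-convex (B~b m) ~-refl le (≺⇒≼ lt) , lt)

    Grows⇒sibInf : Grows b → SibInf C
    Grows⇒sibInf gr = Blocks.sibInf C tame (λ k → B (idx k)) (λ k → ≼-≺ (proj₁ (bounds k 0)) (proj₂ (bounds k 0)))
      (λ k → B-wo (idx k)) a (λ k → proj₁ (proj₂ (proj₂ (gr (idx k))))) (λ k i → proj₁ (bounds k i)) (λ k i → proj₂ (bounds k i))
      (λ k i → proj₂ (proj₂ (proj₂ (proj₂ (gr (idx k))))) i)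
      where
      idx : ℕ → ℕ
      idx zero = 0
      idx (suc k) = proj₁ (gr (idx k))
      a : ℕ → ℕ → A
      a k = proj₁ (proj₂ (gr (idx k)))
      bounds : ∀ k i → B (idx (suc k)) ≼ a k i × a k i ≺ B (idx k)
      bounds k = proj₁ (proj₂ (proj₂ (proj₂ (gr (idx k)))))

  -- If the part of the class above b embeds in no [ B m , b ⟩, then ω copies of [ B (n + 1) , b ⟩
  -- fit above b in succession, so that this interval is absorbed.
  module Absorb (C : Chain ℓ) (g : C ↪ C) (tame : Tame C) (tame* : Tame (op C)) (b : Carrier C) (lw : LeftOrbits.Lw C g b)
    (¬folds : ¬ LeftOrbits.Folds C g b) where
    open Order C
    open Classes C
    open Interval C
    open Gluing C
    open LeftOrbits C g
    open AtLeft C g tame tame* b lw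

    module _ (n : ℕ) where
      β : A → Set ℓ
      β = [ B (suc n) , b ⟩

      β-NoDesc : NoDesc β
      β-NoDesc = interval-NoDesc (B-wo (suc n)) β λ (p , q) → p , ≺⇒≼ q

      β-first : β (B (suc n))
      β-first = ≼-refl , ≺-≼ (B-down n) (B-anti {0} {n} ℕ.z≤n)

      -- `packed` records that the part of the class passed so far fits below `b`; if the rest
      -- fitted into `β`, `pack` would make the class fold.
      record State : Set ℓ where
        field
          q : A
          b~q : b ~ q
          b≼q : b ≼ q
          m : ℕ
          packed : Emb [ b , q ⟩ [ B m , b ⟩

        pack : {X : A → Set ℓ} → (∀ {z} → X z → b ≼ z) → Emb (λ z → X z × q ≼ z) β → Emb X [ B (suc n ℕ.+ m) , b ⟩
        pack {X} lo e = Emb-glue {Y₁ = [ B (suc n ℕ.+ m) , B (suc n) ⟩} {Y₂ = β} q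
          (Emb-trans (Emb-mono (λ (xz , lt) → lo xz , lt) id packed)
            (Emb-map (it (suc n)) (it-mono (suc n)) λ {z} (p , lt) →
              subst (_≼ it (suc n) z) (it-B (suc n) m) (mono-≼ (it-mono (suc n)) p) , it-mono (suc n) lt))
          e (λ (_ , lt) (le , _) → ≺-≼ lt le)
          (λ (le , lt) → le , ≺-≼ lt (B-anti {0} {suc n} ℕ.z≤n))
          (λ (le , lt) → ≼-trans (B-anti (ℕₚ.m≤m+n (suc n) m)) le , lt)
      open State

      record Next (s : State) : Set ℓ where
        field
          q′ : A
          b~q′ : b ~ q′
          q≺q′ : q s ≺ q′
          wide : Emb β [ q s , q′ ⟩
          thin : Emb [ q s , q′ ⟩ β
      open Next

      private
        proper : ∀ {x y} → Emb β (λ z → x ≼ z × z ≺ y) → x ≺ y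
        proper e = let (p , lt) = into e β-first in ≼-≺ p lt

      opaque
        -- Room for `β` above `q s` exists, as otherwise the rest of the class embeds in `β` and the
        -- class folds. Taking the least end point makes the interval embed back into `β`.
        next : ∀ s → Next s
        next s = case em (Σ A Fits) of λ where
            (yes fit) → smallest (least Fits (class-NoDesc (q s) (b~q s) Fits λ (bz , lt , _) → ≺⇒≼ lt , bz) fit)
            (no none) → ⊥-elim (stuck none (compare-wo (λ v → b ~ v × q s ≼ v) β
              (class-NoDesc (q s) (b~q s) (λ v → b ~ v × q s ≼ v) λ (bz , le) → le , bz) β-NoDesc))
          where
          Fits : A → Set ℓ
          Fits z = b ~ z × q s ≺ z × Emb β [ q s , z ⟩
          smallest : (Σ A λ z → Fits z × (∀ y → Fits y → z ≼ y)) → Next s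
          smallest (q″ , (bq , lt , e) , min) = record { q′ = q″ ; b~q′ = bq ; q≺q′ = lt ; wide = e
            ; thin = thin′ (compare-wo [ q s , q″ ⟩ β
                (class-NoDesc (q s) (b~q s) [ q s , q″ ⟩ λ (p , p′) → p , ~-convex (b~q s) bq p (≺⇒≼ p′)) β-NoDesc) }
            where
            thin′ : Emb [ q s , q″ ⟩ β ⊎ (Σ A λ y → [ q s , q″ ⟩ y × Emb β (λ z → [ q s , q″ ⟩ z × z ≺ y)) → Emb [ q s , q″ ⟩ β
            thin′ (inj₁ e′) = e′
            thin′ (inj₂ (y , (p , p′) , e′)) = ⊥-elim (min y
              ( ~-convex (b~q s) bq p (≺⇒≼ p′) , proper (Emb-mono id (λ ((r , _) , r′) → r , r′) e′)
              , Emb-mono id (λ ((r , _) , r′) → r , r′) e′) p′)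
          stuck : ¬ Σ A Fits → ¬ (Emb (λ v → b ~ v × q s ≼ v) β ⊎
            (Σ A λ y → (b ~ y × q s ≼ y) × Emb β (λ z → (b ~ z × q s ≼ z) × z ≺ y)))
          stuck none (inj₁ e) = ¬folds (suc n ℕ.+ m s , pack s {λ v → b ~ v × b ≼ v} proj₂
            (Emb-mono (λ ((bz , _) , le) → bz , le) id e))
          stuck none (inj₂ (y , (by , le) , e)) = none (y , by , proper e″ , e″)
            where
            e″ : Emb β [ q s , y ⟩
            e″ = Emb-mono id (λ ((_ , r) , r′) → r , r′) e

      advance : State → State
      advance s = record { q = q′ x ; b~q = b~q′ x ; b≼q = ≼-trans (b≼q s) (≺⇒≼ (q≺q′ x)) ; m = suc n ℕ.+ m s
                         ; packed = pack s proj₁ (Emb-mono (λ ((_ , lt) , le) → le , lt) id (thin x)) }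
        where x = next s

      state : ℕ → State
      state zero = record { q = b ; b~q = ~-refl ; b≼q = ≼-refl ; m = 0
                          ; packed = record { fn = id ; into = λ (p , lt) → ⊥-elim (p lt) ; incr = λ _ _ p → p } }
      state (suc i) = advance (state i)

      qs : ℕ → A
      qs i = q (state i)

      qs-up : ∀ i → qs i ≺ qs (suc i)
      qs-up i = q≺q′ (next (state i))

      qs-UpInf : ∀ i → UpInf (qs i)
      qs-UpInf i = (λ j → qs (j ℕ.+ i)) , (λ j → qs-up (j ℕ.+ i)) , ≼-refl ,
        λ j → ~-trans (~-sym (b~q (state i))) (b~q (state (j ℕ.+ i)))

    T : A → Set ℓ
    T v = b ~ v × UpInf v

    T-b : T b
    T-b = ~-refl , qs-UpInf 0 0

    T-convex : ∀ {x y z} → T x → T y → x ≼ z → z ≼ y → T z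
    T-convex (bx , _) (by , iy) p p′ = let bz = ~-convex bx by p p′ in bz , UpInf-down p′ (~-trans (~-sym bz) by) iy

    T-low : ∀ {v} → b ~ v → v ≼ b → T v
    T-low bv le = bv , UpInf-down le (~-sym bv) (proj₂ T-b)

    T-B : ∀ n → T (B n)
    T-B n = T-low (B~b n) (B-anti {0} {n} ℕ.z≤n)

    -- If `g v` exceeds the ascending sequence of `UpInf`, that sequence lies between `v` and `g v`,
    -- and tameness excludes a descent there.
    g-class : ∀ {v} → T v → b ~ app g v
    g-class {v} (bv , s , up , lo , cl) with split v (app g v)
    ... | inj₂ gv≼v = let (n , le) = coinitial bv in ~-convex (B~b (suc n)) bv (↪-≼ g le) gv≼v
    ... | inj₁ v≺gv with em (Σ ℕ λ i → app g v ≼ s i)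
    ...   | yes (i , le) = ~-convex bv (~-trans bv (cl i)) (≺⇒≼ v≺gv) le
    ...   | no none = ~-trans bv (~-of-≼ (≺⇒≼ v≺gv) λ d → tame g v v≺gv
              ((s , up , (λ i → ≼-trans lo (mono-seq s up ℕ.z≤n)) , λ i → ≺⇒≼ (dne λ ¬lt → none (i , ¬lt))) , d))

    T-g : ∀ {v} → T v → T (app g v)
    T-g {v} t@(bv , u@(s , up , lo , cl)) = g-class t , (λ i → app g (s i)) , (λ i → app-mono g (up i)) , ↪-≼ g lo ,
      λ i → ~-trans (~-sym (g-class t)) (g-class (~-trans bv (cl i) , UpInf-tail u i))

    T-it : ∀ k {v} → T v → T (it k v)
    T-it zero t = t
    T-it (suc k) t = T-g (T-it k t)

    module _ (n : ℕ) where
      private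
        r : ℕ → A
        r zero = B (suc n)
        r (suc i) = qs n i

        r≺q : ∀ i → r i ≺ qs n i
        r≺q zero = proj₂ (β-first n)
        r≺q (suc i) = qs-up n i

        block : ∀ i → Emb [ r i , r (suc i) ⟩ [ qs n i , qs n (suc i) ⟩
        block zero = Next.wide (next n (state n 0))
        block (suc i) = Emb-trans (Next.thin (next n (state n i))) (Next.wide (next n (state n (suc i))))

        r-up : ∀ i → r i ≺ r (suc i)
        r-up = r≺q

        Move : A → A → Set ℓ
        Move z y = (Σ ℕ λ i → [ r i , r (suc i) ⟩ z × y ≡ fn (block i) z) ⊎ ((∀ i → r i ≼ z) × y ≡ z)

        move : ∀ z → r 0 ≼ z → Σ A (Move z)
        move z lo with em (Σ ℕ λ i → z ≺ r i)
        ... | no none = z , inj₂ ((λ i lt → none (i , lt)) , refl)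
        ... | yes e with leastℕ (λ i → z ≺ r i) e
        ...   | zero , lt , _ = ⊥-elim (lo lt)
        ...   | suc i , lt , min = fn (block i) z , inj₁ (i , ((λ lt′ → ℕₚ.<-irrefl refl (min i lt′)) , lt) , refl)

        Move-mono : ∀ {u v u′ v′} → Move u u′ → Move v v′ → u ≺ v → u′ ≺ v′
        Move-mono (inj₁ (i , p , refl)) (inj₁ (j , p′ , refl)) lt with ℕₚ.<-cmp i j
        ... | tri< i<j _ _ = ≺-≼ (proj₂ (into (block i) p)) (≼-trans (mono-seq (qs n) (qs-up n) i<j) (proj₁ (into (block j) p′)))
        ... | tri≈ _ refl _ = incr (block i) p p′ lt
        ... | tri> _ _ j<i = ⊥-elim (proj₁ p (≺-≼ (≺-trans lt (proj₂ p′)) (mono-seq r r-up j<i)))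
        Move-mono (inj₁ (i , p , refl)) (inj₂ (hi , refl)) lt = ≺-≼ (proj₂ (into (block i) p)) (hi (suc (suc i)))
        Move-mono (inj₂ (hi , refl)) (inj₁ (j , p′ , refl)) lt = ⊥-elim (hi (suc j) (≺-trans lt (proj₂ p′)))
        Move-mono (inj₂ (_ , refl)) (inj₂ (_ , refl)) lt = lt

        Move-T : ∀ {z y} → T z → Move z y → T y × b ≼ y
        Move-T t (inj₁ (i , p , refl)) = let (q , q′) = into (block i) p in
          T-convex (State.b~q (state n i) , qs-UpInf n i) (State.b~q (state n (suc i)) , qs-UpInf n (suc i)) q (≺⇒≼ q′) ,
          ≼-trans (State.b≼q (state n i)) q
        Move-T t (inj₂ (hi , refl)) = t , hi 1

      -- The identity `1 + ω = ω`: with `[ B (suc n) , b ⟩` counted as a first block, each block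
      -- moves into the next, and points beyond all blocks stay.
      absorb : Emb (λ z → T z × B (suc n) ≼ z) (λ z → T z × b ≼ z)
      absorb = record
        { fn = proj₁ chosen
        ; into = λ (t , lo) → Move-T t (proj₂ chosen lo)
        ; incr = λ (_ , lo) (_ , lo′) → Move-mono (proj₂ chosen lo) (proj₂ chosen lo′) }
        where
        chosen : Σ (A → A) λ φ → ∀ {z} → r 0 ≼ z → Move z (φ z)
        chosen = choose {P = r 0 ≼_} {Q = Move} move

  -- Decomposing a stalled class into indecomposable pieces.

  module DescGlue (C : Chain ℓ) where
    open Order C
    open Interval C

    record Pieces (X Y : A → Set ℓ) : Set ℓ where
      field
        e o : ℕ → A
        e-down : ∀ k → e (suc k) ≺ e k
        o-down : ∀ k → o (suc k) ≺ o k
        e-coinitial : ∀ {x} → X x → Σ ℕ λ k → e k ≼ x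
        head : Emb (λ x → X x × e 0 ≼ x) (λ y → Y y × o 0 ≼ y)
        block : ∀ k → Emb (λ x → X x × [ e (suc k) , e k ⟩ x) (λ y → Y y × [ o (suc k) , o k ⟩ y)

      Spec : A → A → Set ℓ
      Spec x y = (e 0 ≼ x × y ≡ fn head x) ⊎ (Σ ℕ λ k → [ e (suc k) , e k ⟩ x × y ≡ fn (block k) x)

      private
        o-anti : ∀ {m n} → m ℕ.≤ n → o n ≼ o m
        o-anti = Order.mono-seq (op C) o o-down

        e-anti : ∀ {m n} → m ℕ.≤ n → e n ≼ e m
        e-anti = Order.mono-seq (op C) e e-down

        place : ∀ x → X x → Σ A (Spec x)
        place x xx with split x (e 0)
        ... | inj₂ le = _ , inj₁ (le , refl)
        ... | inj₁ lt with leastℕ (λ k → e k ≼ x) (e-coinitial xx)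
        ...   | zero , le , _ = ⊥-elim (le lt)
        ...   | suc k , le , min = _ , inj₂ (k , (le , dne λ ¬lt → ℕₚ.<-irrefl refl (min k ¬lt)) , refl)

        Spec-mono : ∀ {u v u′ v′} → X u → X v → Spec u u′ → Spec v v′ → u ≺ v → u′ ≺ v′
        Spec-mono xu xv (inj₁ (p , refl)) (inj₁ (p′ , refl)) lt = incr head (xu , p) (xv , p′) lt
        Spec-mono xu xv (inj₁ (p , refl)) (inj₂ (k , (_ , q) , refl)) lt = ⊥-elim (p (≺-trans lt (≺-≼ q (e-anti ℕ.z≤n))))
        Spec-mono xu xv (inj₂ (k , p , refl)) (inj₁ (p′ , refl)) lt =
          ≺-≼ (proj₂ (proj₂ (into (block k) (xu , p)))) (≼-trans (o-anti ℕ.z≤n) (proj₂ (into head (xv , p′))))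
        Spec-mono xu xv (inj₂ (k , p , refl)) (inj₂ (k′ , p′ , refl)) lt with ℕₚ.<-cmp k k′
        ... | tri< k<k′ _ _ = ⊥-elim (proj₁ p (≺-≼ (≺-trans lt (proj₂ p′)) (e-anti k<k′)))
        ... | tri≈ _ refl _ = incr (block k) (xu , p) (xv , p′) lt
        ... | tri> _ _ k′<k = ≺-≼ (proj₂ (proj₂ (into (block k) (xu , p))))
                (≼-trans (o-anti k′<k) (proj₁ (proj₂ (into (block k′) (xv , p′)))))

        Spec-Y : ∀ {x y} → X x → Spec x y → Y y
        Spec-Y xx (inj₁ (p , refl)) = proj₁ (into head (xx , p))
        Spec-Y xx (inj₂ (k , p , refl)) = proj₁ (into (block k) (xx , p))

      opaque
        chosen : Σ (A → A) λ φ → ∀ {x} → X x → Spec x (φ x)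
        chosen = choose {P = X} {Q = Spec} place

      glued : Emb X Y
      glued = record { fn = proj₁ chosen ; into = λ xx → Spec-Y xx (proj₂ chosen xx)
                     ; incr = λ xu xv → Spec-mono xu xv (proj₂ chosen xu) (proj₂ chosen xv) }

      spec : ∀ {x} → X x → Spec x (fn glued x)
      spec = proj₂ chosen

  -- Since the orbit does not grow, T is, towards its left end, a sum of copies of one
  -- indecomposable well-ordered set P, and so is T ∩ D.
  module Piece (C : Chain ℓ) (g : C ↪ C) (tame : Tame C) (tame* : Tame (op C)) (b : Carrier C) (lw : LeftOrbits.Lw C g b)
    (¬folds : ¬ LeftOrbits.Folds C g b) (¬grows : ¬ LeftOrbits.Grows C g b)
    (D : Carrier C → Set ℓ) (gD : ∀ x → D (app g x)) where
    open Order C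
    open Classes C
    open Interval C
    open Gluing C
    open DescGlue C
    open LeftOrbits C g
    open AtLeft C g tame tame* b lw
    open Absorb C g tame tame* b lw ¬folds

    opaque
      stall : Σ ℕ λ n → ¬ Σ ℕ λ m → Seq (B m) (B n) (B n) b
      stall = ¬∀⇒∃¬ ¬grows

    n₁ : ℕ
    n₁ = proj₁ stall

    -- At 0 the interval to be repeated is empty, and `B-asc` provides the dividing points.
    n₁≥1 : 1 ℕ.≤ n₁
    n₁≥1 with n₁ in eq
    ... | suc _ = ℕ.s≤s ℕ.z≤n
    ... | zero = ⊥-elim (subst (λ n → ¬ Σ ℕ λ m → Seq (B m) (B n) (B n) b) eq (proj₂ stall)
            (n₀ , proj₁ B-asc , proj₁ (proj₂ B-asc) ,
             (λ i → proj₁ (proj₂ (proj₂ B-asc)) i , ≺-≼ (proj₁ (proj₂ B-asc) i) (proj₂ (proj₂ (proj₂ B-asc)) (suc i))) ,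
             λ i → record { fn = id ; into = λ (p , q) → ⊥-elim (p q) ; incr = λ _ _ p → p }))

    a : A
    a = B n₁

    a≺b : a ≺ b
    a≺b = ≼-≺ (B-anti n₁≥1) (B-down 0)

    Stalls : A → Set ℓ
    Stalls p = (a ≺ p × p ≼ b) × (∀ m → ¬ Seq (B m) a a p)

    opaque
      smallest : Σ A λ p → Stalls p × (∀ z → Stalls z → p ≼ z)
      smallest = least Stalls (class-NoDesc a (B~b n₁) Stalls λ ((lt , le) , _) → ≺⇒≼ lt , ~-convex (B~b n₁) ~-refl (≺⇒≼ lt) le)
        (b , (a≺b , ≼-refl) , λ m s → proj₂ stall (m , s))

    p : A
    p = proj₁ smallest

    a≺p : a ≺ p
    a≺p = proj₁ (proj₁ (proj₁ (proj₂ smallest)))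

    p≼b : p ≼ b
    p≼b = proj₂ (proj₁ (proj₁ (proj₂ smallest)))

    p-stalls : ∀ m → ¬ Seq (B m) a a p
    p-stalls = proj₂ (proj₁ (proj₂ smallest))

    P : A → Set ℓ
    P = [ a , p ⟩

    p-class : b ~ p
    p-class = ~-convex (B~b n₁) ~-refl (≺⇒≼ a≺p) p≼b

    P-class : ∀ {v} → P v → b ~ v
    P-class (le , lt) = ~-convex (B~b n₁) ~-refl le (≼-trans (≺⇒≼ lt) p≼b)

    P-T : ∀ {v} → P v → T v
    P-T r@(le , lt) = T-low (P-class r) (≼-trans (≺⇒≼ lt) p≼b)

    P-NoDesc : NoDesc P
    P-NoDesc = class-NoDesc a (B~b n₁) P λ r → proj₁ r , P-class r

    -- Otherwise `[ u , p ⟩` embeds in `[ a , p′ ⟩` with `p′ ≺ p`. The larger of `u` and `p′` is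
    -- still below `p` and so, by minimality of `p`, does not stall.
    indecomposable : ∀ u → a ≼ u → u ≺ p → Emb P [ u , p ⟩
    indecomposable u a≼u u≺p = case compare-wo P [ u , p ⟩ P-NoDesc
        (class-NoDesc a (B~b n₁) [ u , p ⟩ λ (q , q′) → ≼-trans a≼u q , P-class (≼-trans a≼u q , q′)) of λ where
        (inj₁ e) → e
        (inj₂ (p′ , (a≼p′ , p′≺p) , e)) → case split a u of λ where
          (inj₂ u≼a) → Emb-mono id (λ (q , q′) → ≼-trans u≼a q , q′) (record { fn = id ; into = id ; incr = λ _ _ r → r })
          (inj₁ a≺u) → ⊥-elim (case ≼-total u p′ of λ where
            (inj₁ u≼p′) → doubled a≺u (≺-≼ a≺u u≼p′) p′≺p u≼p′ (Emb-mono id (λ ((q , _) , q′) → q , q′) e)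
            (inj₂ p′≼u) → doubled a≺u a≺u u≺p ≼-refl (Emb-mono id (λ ((q , _) , q′) → q , ≺-≼ q′ p′≼u) e))
      where
      -- both halves of P embed in [a , m) with m ≺ p, which can be repeated ω times
      doubled : ∀ {m} → a ≺ u → a ≺ m → m ≺ p → u ≼ m → Emb [ u , p ⟩ [ a , m ⟩ → ⊥
      doubled {m} a≺u a≺m m≺p u≼m e = proj₂ (proj₂ smallest) m ((a≺m , ≼-trans (≺⇒≼ m≺p) p≼b) , no-seq) m≺p
        where
        no-seq : ∀ k → ¬ Seq (B k) a a m
        -- Two consecutive copies, numbered `i + i` and `suc (i + i)`, hold the two halves of one
        -- copy of `P`.
        no-seq k (s , up , bd , f) = p-stalls k ((λ i → s (i ℕ.+ i)) , (λ i → mono-seq-< s up (ℕₚ.+-mono-<-≤ (ℕₚ.n<1+n i) (ℕₚ.n≤1+n i))) ,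
          (λ i → bd (i ℕ.+ i)) , λ i → Emb-glue {Y₁ = [ s (i ℕ.+ i) , s (suc (i ℕ.+ i)) ⟩} {Y₂ = [ s (suc (i ℕ.+ i)) , s (suc (suc (i ℕ.+ i))) ⟩} u
            (Emb-mono (λ ((q , _) , q′) → q , ≺-≼ q′ u≼m) id (f (i ℕ.+ i)))
            (Emb-mono (λ ((_ , q) , q′) → q′ , q) id (Emb-trans e (f (suc (i ℕ.+ i)))))
            (λ (_ , lt) (le , _) → ≺-≼ lt le)
            (λ (q , lt) → q , ≺-≼ lt (mono-seq s up (ℕ.s≤s (ℕₚ.+-monoʳ-≤ i (ℕₚ.n≤1+n i)))))
            (λ {y} (q , lt) → ≼-trans (≺⇒≼ (up (i ℕ.+ i))) q , subst (λ t → y ≺ s t) (cong suc (sym (ℕₚ.+-suc i i))) lt))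

    module Cuts (S : A → Set ℓ) (S-T : ∀ {v} → S v → T v)
      (recurs : ∀ m → Σ A λ z → Σ A λ z′ → (S z × S z′) × z′ ≼ B m × Emb P (λ y → S y × [ z , z′ ⟩ y)) where

      -- The candidates for division points of `S` into summands equimorphic to `P`.
      Cut : A → Set ℓ
      Cut y = S y × (∀ z → S z → z ≺ y → Emb P (λ v → S v × [ z , y ⟩ v))

      proper : ∀ {z y} → Emb P (λ v → S v × [ z , y ⟩ v) → z ≺ y
      proper e = let (_ , q , q′) = into e (≼-refl , a≺p) in ≼-≺ q q′

      -- Take the least end `c` of a copy started at `z`. A later start either leaves a final part
      -- of the copy, which contains `P` by indecomposability, or lies above the whole copy, against
      -- minimality.
      cut-of : ∀ {z y} → S z → S y → Emb P (λ v → S v × [ z , y ⟩ v) → Σ A λ c → Cut c × c ≼ y × z ≺ c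
      cut-of {z} {y} sz sy e = found (least Q (class-NoDesc z (proj₁ (S-T sz)) Q λ (sv , e′) → ≺⇒≼ (proper e′) , proj₁ (S-T sv)) (y , sy , e))
        where
        Q : A → Set ℓ
        Q c = S c × Emb P (λ v → S v × [ z , c ⟩ v)
        found : (Σ A λ c → Q c × (∀ c′ → Q c′ → c ≼ c′)) → Σ A λ c → Cut c × c ≼ y × z ≺ c
        found (c , (sc , ec) , min) = c , (sc , cut) , min y (sy , e) , proper ec
          where
          cut : ∀ z₂ → S z₂ → z₂ ≺ c → Emb P (λ v → S v × [ z₂ , c ⟩ v)
          cut z₂ sz₂ z₂≺c = case em (Σ A λ u → P u × z₂ ≼ fn ec u) of λ where
            (yes (u , pu , le)) → Emb-trans (indecomposable u (proj₁ pu) (proj₂ pu)) record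
              { fn = fn ec
              ; into = λ (q , q′) → let pv = (≼-trans (proj₁ pu) q , q′) in
                  proj₁ (into ec pv) , ≼-trans le (weak ec pu pv q) , proj₂ (proj₂ (into ec pv))
              ; incr = λ (q , q′) (r , r′) → incr ec (≼-trans (proj₁ pu) q , q′) (≼-trans (proj₁ pu) r , r′) }
            (no none) → ⊥-elim (min z₂ (sz₂ , record
              { fn = fn ec
              ; into = λ {u} pu → proj₁ (into ec pu) , proj₁ (proj₂ (into ec pu)) , dne λ ¬lt → none (u , pu , ¬lt)
              ; incr = incr ec }) z₂≺c)

      cut-below : ∀ m → Σ A λ c → Cut c × c ≼ B m
      cut-below m = let (z , z′ , (sz , sz′) , le , e) = recurs m ; (c , cut , c≼ , _) = cut-of sz sz′ e in c , cut , ≼-trans c≼ le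

      Last : A → A → Set ℓ
      Last w c = (Cut c × c ≺ w) × (∀ y → Cut y × y ≺ w → y ≼ c)

      -- An ascending sequence of cuts would yield `ω` successive copies of `P` below `a`, which
      -- `p-stalls` forbids.
      last : ∀ w → b ~ w → w ≼ a → Σ A (Last w)
      last w bw w≼a = Order.least (op C) (λ c → Cut c × c ≺ w) no-asc start
        where
        start : Σ A λ c → Cut c × c ≺ w
        start = let (m , le) = coinitial bw ; (c , cut , c≼) = cut-below (suc m) in c , cut , ≼-≺ c≼ (≺-≼ (B-down m) le)
        no-asc : Order.NoDesc (op C) (λ c → Cut c × c ≺ w)
        no-asc (s , cs , up) = let (m , le) = coinitial (proj₁ (S-T (proj₁ (proj₁ (cs 0))))) in
          p-stalls m (s , up , (λ i → ≼-trans le (mono-seq s up ℕ.z≤n) , ≺-≼ (proj₂ (cs i)) w≼a) ,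
            λ i → Emb-mono id proj₂ (proj₂ (proj₁ (cs (suc i))) (s i) (proj₁ (proj₁ (cs i))) (up i)))

      module Sequence (w : A) (bw : b ~ w) (w≼a : w ≼ a) where
        private
          Stage : Set ℓ
          Stage = Σ A λ v → b ~ v × v ≼ a

          lastS : (v : Stage) → Σ A (Last (proj₁ v))
          lastS (v , bv , le) = last v bv le

          stage : ℕ → Stage
          stage zero = w , bw , w≼a
          stage (suc k) = let v = stage k ; (c , ((sc , _) , lt) , _) = lastS v in
            c , proj₁ (S-T sc) , ≼-trans (≺⇒≼ lt) (proj₂ (proj₂ v))

        opaque
          sequence : Σ (ℕ → A) λ c → Last w (c 0) × (∀ k → Last (c k) (c (suc k)))
          sequence = (λ k → proj₁ (stage (suc k))) , proj₂ (lastS (stage 0)) , λ k → proj₂ (lastS (stage (suc k)))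

        c : ℕ → A
        c = proj₁ sequence

        c-Cut : ∀ k → Cut (c k)
        c-Cut zero = proj₁ (proj₁ (proj₁ (proj₂ sequence)))
        c-Cut (suc k) = proj₁ (proj₁ (proj₂ (proj₂ sequence) k))

        c-start : c 0 ≺ w
        c-start = proj₂ (proj₁ (proj₁ (proj₂ sequence)))

        c-down : ∀ k → c (suc k) ≺ c k
        c-down k = proj₂ (proj₁ (proj₂ (proj₂ sequence) k))

        c-next : ∀ k y → Cut y → y ≺ c k → y ≼ c (suc k)
        c-next k y cut lt = proj₂ (proj₂ (proj₂ sequence) k) y (cut , lt)

        c-anti : ∀ {m n} → m ℕ.≤ n → c n ≼ c m
        c-anti = Order.mono-seq (op C) c c-down

        c-S : ∀ k → S (c k)
        c-S k = proj₁ (c-Cut k)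

        c-coinitial : ∀ {v} → b ~ v → Σ ℕ λ k → c k ≼ v
        c-coinitial {v} bv = dne λ none → proj₁ (~-trans (~-sym bv) (proj₁ (S-T (c-S 0))))
          (c , c-down , (λ n → c-anti ℕ.z≤n) , λ n lt → none (n , ≺⇒≼ lt))

        wide : ∀ k → Emb P (λ v → S v × [ c (suc k) , c k ⟩ v)
        wide k = proj₂ (c-Cut k) (c (suc k)) (c-S (suc k)) (c-down k)

        -- Otherwise `P` embeds in a proper initial segment, and `cut-of` finds a cut strictly
        -- between two consecutive ones.
        thin : ∀ k → Emb (λ v → S v × [ c (suc k) , c k ⟩ v) P
        thin k = case compare-wo X P (class-NoDesc (c (suc k)) (proj₁ (S-T (c-S (suc k)))) X λ (sv , le , _) → le , proj₁ (S-T sv)) P-NoDesc of λ where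
            (inj₁ e) → e
            (inj₂ (y , (sy , le , lt) , e)) → ⊥-elim (
              let (c′ , cut , c′≼y , lt′) = cut-of (c-S (suc k)) sy (Emb-mono id (λ ((sv , q , _) , q′) → sv , q , q′) e)
              in c-next k c′ cut (≼-≺ c′≼y lt) lt′)
          where
          X : A → Set ℓ
          X v = S v × [ c (suc k) , c k ⟩ v

    TD : A → Set ℓ
    TD v = T v × D v

    T-recurs : ∀ m → Σ A λ z → Σ A λ z′ → (T z × T z′) × z′ ≼ B m × Emb P (λ y → T y × [ z , z′ ⟩ y)
    T-recurs m = it m a , it m p , (T-it m (T-B n₁) , T-it m (T-low p-class p≼b)) , mono-≼ (it-mono m) p≼b , record
      { fn = it m
      ; into = λ pv → T-it m (P-T pv) , mono-≼ (it-mono m) (proj₁ pv) , it-mono m (proj₂ pv)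
      ; incr = λ _ _ → it-mono m }

    TD-recurs : ∀ m → Σ A λ z → Σ A λ z′ → (TD z × TD z′) × z′ ≼ B m × Emb P (λ y → TD y × [ z , z′ ⟩ y)
    TD-recurs m = let (z , z′ , (tz , tz′) , le , e) = T-recurs m in
      app g z , app g z′ , ((T-g tz , gD z) , (T-g tz′ , gD z′)) , ≼-trans (↪-≼ g le) (≺⇒≼ (B-down m)) ,
      Emb-trans e (Emb-map (app g) (app-mono g) λ {y} (t , q , q′) → (T-g t , gD y) , ↪-≼ g q , app-mono g q′)

    module CT = Cuts T id T-recurs
    module CD = Cuts TD proj₁ TD-recurs

    module SD = CD.Sequence a (B~b n₁) ≼-refl

    d : ℕ → A
    d = SD.c

    m₀ : ℕ
    m₀ = proj₁ (coinitial (proj₁ (proj₁ (SD.c-S 1))))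

    Bm₀≼d₁ : B m₀ ≼ d 1
    Bm₀≼d₁ = proj₂ (coinitial (proj₁ (proj₁ (SD.c-S 1))))

    module ST = CT.Sequence (B m₀) (B~b m₀) (≼-trans Bm₀≼d₁ (≺⇒≼ (≺-trans (SD.c-down 0) SD.c-start)))

    c : ℕ → A
    c = ST.c

    c≺d₁ : ∀ k → c k ≺ d 1
    c≺d₁ k = ≼-≺ (ST.c-anti ℕ.z≤n) (≺-≼ ST.c-start Bm₀≼d₁)

    -- `g` carries the copy of `P` between two cuts of `T` into `TD`, where `cut-of` finds a cut; so
    -- each step on the side of `T` passes at least one `d k`.
    gc≺d : ∀ k → app g (c (suc k)) ≺ d k
    gc≺d zero = ≺-trans (app-mono g (≺-trans (ST.c-down 0) ST.c-start)) (≺-trans (≺-≼ (B-down m₀) Bm₀≼d₁) (SD.c-down 0))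
    gc≺d (suc k) =
      let (c′ , cut , c′≼ , lt) = CD.cut-of (T-g (ST.c-S (suc (suc k))) , gD _) (T-g (ST.c-S (suc k)) , gD _)
            (Emb-trans (ST.wide (suc k)) record
              { fn = app g ; into = λ (t , q , q′) → (T-g t , gD _) , ↪-≼ g q , app-mono g q′ ; incr = λ _ _ → app-mono g })
      in ≺-≼ lt (SD.c-next k c′ cut (≼-≺ c′≼ (gc≺d k)))

    private
      nc : ℕ
      nc = proj₁ (coinitial (proj₁ (ST.c-S 3)))

      tail : Emb (λ x → T x × c 3 ≼ x) (λ y → TD y × d 0 ≼ y)
      tail = Emb-trans (Emb-mono (λ (t , le) → t , ≼-trans (≺⇒≼ (B-down nc)) (≼-trans (proj₂ (coinitial (proj₁ (ST.c-S 3)))) le)) id (absorb nc))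
        (Emb-map (app g) (app-mono g) λ (t , le) → (T-g t , gD _) ,
          ≼-trans (≼-trans (≺⇒≼ SD.c-start) (B-anti n₁≥1)) (↪-≼ g le))

      -- The offset 3 serves `floor`: if `φ x` is in block `k` of `jp`, then `x ≺ c (3 + k)` and
      -- `d (2 + k) ≼ φ x`, so `gc≺d (2 + k)` gives `g x ≺ φ x`.
      hp : Pieces T TD
      hp = record
        { e = λ k → c (3 ℕ.+ k) ; o = d ; e-down = λ k → ST.c-down (3 ℕ.+ k) ; o-down = SD.c-down
        ; e-coinitial = λ t → let (k , le) = ST.c-coinitial (proj₁ t) in k , ≼-trans (ST.c-anti (ℕₚ.m≤n+m k 3)) le
        ; head = tail ; block = λ k → Emb-trans (ST.thin (3 ℕ.+ k)) (SD.wide k) }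

      -- Starting at `d 1` instead of `d 0`, the way back gains one block, which makes `j` after `h`
      -- inflationary.
      jp : Pieces TD T
      jp = record
        { e = λ k → d (1 ℕ.+ k) ; o = λ k → c (3 ℕ.+ k) ; e-down = λ k → SD.c-down (1 ℕ.+ k) ; o-down = λ k → ST.c-down (3 ℕ.+ k)
        ; e-coinitial = λ t → let (k , le) = SD.c-coinitial (proj₁ (proj₁ t)) in k , ≼-trans (SD.c-anti (ℕₚ.n≤1+n k)) le
        ; head = record { fn = id ; into = λ (t , le) → proj₁ t , ≼-trans (≺⇒≼ (c≺d₁ 3)) le ; incr = λ _ _ lt → lt }
        ; block = λ k → Emb-trans (SD.thin (1 ℕ.+ k)) (ST.wide (3 ℕ.+ k)) }

      module HP = Pieces hp
      module JP = Pieces jp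

      h : Emb T TD
      h = HP.glued

      j : Emb TD T
      j = JP.glued

      tail-infl : ∀ {x} → T x × c 3 ≼ x → x ≼ fn tail x
      tail-infl {x} = inflationary (λ x → T x × c 3 ≼ x)
        (class-NoDesc (c 3) (proj₁ (ST.c-S 3)) (λ x → T x × c 3 ≼ x) λ (t , le) → le , proj₁ t) (fn tail)
        (λ r → let (q , q′) = into tail r in proj₁ q , ≼-trans (≺⇒≼ (≺-trans (c≺d₁ 3) (SD.c-down 0))) q′)
        (incr tail)

      jh : ∀ {x} → T x → x ≼ fn j (fn h x)
      jh {x} t = step (HP.spec t) (JP.spec (into h t))
        where
        step : HP.Spec x (fn h x) → JP.Spec (fn h x) (fn j (fn h x)) → x ≼ fn j (fn h x)
        step (inj₁ (le , eq)) (inj₁ (_ , eq′)) = subst (x ≼_) (sym (trans eq′ eq)) (tail-infl (t , le))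
        step (inj₁ (le , eq)) (inj₂ (k , (_ , lt) , _)) = ⊥-elim (subst (d 0 ≼_) (sym eq) (proj₂ (into tail (t , le))) (≺-≼ lt (SD.c-anti ℕ.z≤n)))
        step (inj₂ (k , (_ , lt) , eq)) (inj₁ (le , eq′)) = subst (x ≼_) (sym eq′) (≼-trans (≺⇒≼ (≺-trans lt (c≺d₁ (3 ℕ.+ k)))) le)
        step (inj₂ (k , r@(_ , lt) , eq)) (inj₂ (k′ , r′ , eq′)) = subst (x ≼_) (sym eq′)
            (≼-trans (≺⇒≼ lt) (≼-trans (ST.c-anti (ℕₚ.+-monoʳ-≤ 3 k′<k)) (proj₁ (proj₂ (into (JP.block k′) (into h t , r′))))))
          where
          k′<k : k′ ℕ.< k
          k′<k = ℕₚ.≰⇒> λ k≤k′ → subst (d (suc k) ≼_) (sym eq) (proj₁ (proj₂ (into (HP.block k) (t , r))))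
            (≺-≼ (proj₂ r′) (SD.c-anti (ℕ.s≤s k≤k′)))

    record Onto : Set ℓ where
      field
        emb : Emb T TD
        onto : ∀ {d} → TD d → Σ A λ x → T x × fn emb x ≡ d
        floor : ∀ {x} → T x → x ≼ fn emb x ⊎ app g x ≼ fn emb x

    -- The least embedding φ with x ≼ j (φ x) is onto, since it can be lowered at the first x with d ≼ φ x.
    onto : Onto
    onto = record { emb = φe ; onto = hits ; floor = λ t → bound t (JP.spec (into φe t)) (proj₂ (proj₁ (φ-spec t))) }
      where
      H : (A → A) → Set ℓ
      H f = ((∀ {x} → T x → TD (f x)) × (∀ {x y} → T x → T y → x ≺ y → f x ≺ f y)) × (∀ {x} → T x → x ≼ fn j (f x))
      Least : A → A → Set ℓ
      Least x y = ((Σ (A → A) λ f → H f × y ≡ f x) × x ≼ fn j y) × (∀ f → H f → y ≼ f x)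
      best : ∀ x → T x → Σ A (Least x)
      best x t = let (y , r@(f , hf , eq) , min) = least Q nd (fn h x , fn h , h-H , refl) in
          y , ((r , subst (λ y → x ≼ fn j y) (sym eq) (proj₂ hf t)) , λ f hf → min (f x) (f , hf , refl))
        where
        Q : A → Set ℓ
        Q y = Σ (A → A) λ f → H f × y ≡ f x
        h-H : H (fn h)
        h-H = (into h , incr h) , jh
        Q-TD : ∀ {y} → Q y → TD y × x ≼ fn j y
        Q-TD (f , hf , refl) = proj₁ (proj₁ hf) t , proj₂ hf t
        -- `j` turns descending candidate values into a descent inside the class above `x`.
        nd : NoDesc Q
        nd (s , q , down) = class-NoDesc x (proj₁ t) (λ z → T z × x ≼ z) (λ (tz , le) → le , proj₁ tz)
          ((λ n → fn j (s n)) , (λ n → into j (proj₁ (Q-TD (q n))) , proj₂ (Q-TD (q n))) ,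
           λ n → incr j (proj₁ (Q-TD (q (suc n)))) (proj₁ (Q-TD (q n))) (down n))
      opaque
        chosen : Σ (A → A) λ φ → ∀ {x} → T x → Least x (φ x)
        chosen = choose {P = T} {Q = Least} best
      φ : A → A
      φ = proj₁ chosen
      φ-spec : ∀ {x} → T x → Least x (φ x)
      φ-spec = proj₂ chosen
      φe : Emb T TD
      φe = record
        { fn = φ
        ; into = λ t → let ((f , hf , eq) , _) = proj₁ (φ-spec t) in subst TD (sym eq) (proj₁ (proj₁ hf) t)
        ; incr = λ {x} {y} t t′ lt → let ((f , hf , eq) , _) = proj₁ (φ-spec t′) in
            ≼-≺ (proj₂ (φ-spec t) f hf) (subst (f x ≺_) (sym eq) (proj₂ (proj₁ hf) t t′ lt)) }
      bound : ∀ {x} → T x → JP.Spec (φ x) (fn j (φ x)) → x ≼ fn j (φ x) → x ≼ φ x ⊎ app g x ≼ φ x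
      bound {x} t (inj₁ (_ , eq)) le = inj₁ (subst (x ≼_) eq le)
      bound {x} t (inj₂ (k , r , eq)) le = inj₂ (≼-trans (≺⇒≼ (≺-trans (app-mono g x≺) (gc≺d (2 ℕ.+ k)))) (proj₁ r))
        where
        x≺ : x ≺ c (3 ℕ.+ k)
        x≺ = ≼-≺ (subst (x ≼_) eq le) (proj₂ (proj₂ (into (JP.block k) (into φe t , r))))
      hits : ∀ {d} → TD d → Σ A λ x → T x × φ x ≡ d
      hits {d} td = lower-to (least Q class-NoDesc-Q (fn j d , into j td , d≼))
        where
        Q : A → Set ℓ
        Q x = T x × d ≼ φ x
        class-NoDesc-Q : NoDesc Q
        class-NoDesc-Q (s , q , down) = class-NoDesc d (proj₁ (proj₁ td)) (λ z → T z × d ≼ z) (λ (tz , le) → le , proj₁ tz)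
          ((λ n → φ (s n)) , (λ n → proj₁ (into φe (proj₁ (q n))) , proj₂ (q n)) , λ n → incr φe (proj₁ (q (suc n))) (proj₁ (q n)) (down n))
        d≼ : d ≼ φ (fn j d)
        d≼ lt = proj₂ (proj₁ (φ-spec (into j td))) (incr j (into φe (into j td)) td lt)
        lower-to : (Σ A λ x → Q x × (∀ z → Q z → x ≼ z)) → Σ A λ x → T x × φ x ≡ d
        lower-to (x₁ , (t₁ , le₁) , min) = x₁ , t₁ , ≼-antisym (≼-trans (proj₂ (φ-spec t₁) f f-H) (≡⇒≼ f-x₁)) le₁
          where
          V : A → A → Set ℓ
          V z w = (z ≡ x₁ × w ≡ d) ⊎ (¬ (z ≡ x₁) × w ≡ φ z)
          opaque
            vs : ∀ z → Σ A (V z)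
            vs z = case em (z ≡ x₁) of λ where
              (yes eq) → d , inj₁ (eq , refl)
              (no ne) → φ z , inj₂ (ne , refl)
          f : A → A
          f z = proj₁ (vs z)
          f-x₁ : f x₁ ≡ d
          f-x₁ = case proj₂ (vs x₁) of λ where
            (inj₁ (_ , eq)) → eq
            (inj₂ (ne , _)) → ⊥-elim (ne refl)
          V-TD : ∀ {z w} → T z → V z w → TD w
          V-TD t (inj₁ (_ , refl)) = td
          V-TD t (inj₂ (_ , refl)) = into φe t
          V-j : ∀ {z w} → T z → V z w → z ≼ fn j w
          -- The point `fn j d` also satisfies `d ≼ φ (fn j d)`, so the first such point `x₁` is at
          -- most `fn j d`, as a competitor with value `d` at `x₁` requires.
          V-j t (inj₁ (refl , refl)) = min (fn j d) (into j td , d≼)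
          V-j t (inj₂ (_ , refl)) = proj₂ (proj₁ (φ-spec t))
          V-mono : ∀ {u v u′ v′} → T u → T v → V u u′ → V v v′ → u ≺ v → u′ ≺ v′
          V-mono t t′ (inj₁ (refl , refl)) (inj₁ (refl , refl)) lt = ⊥-elim (≺-irr lt)
          V-mono t t′ (inj₁ (refl , refl)) (inj₂ (_ , refl)) lt = ≼-≺ le₁ (incr φe t t′ lt)
          V-mono t t′ (inj₂ (_ , refl)) (inj₁ (refl , refl)) lt = dne λ ¬lt → min _ (t , ¬lt) lt
          V-mono t t′ (inj₂ (_ , refl)) (inj₂ (_ , refl)) lt = incr φe t t′ lt
          f-H : H f
          f-H = ((λ t → V-TD t (proj₂ (vs _))) , λ t t′ → V-mono t t′ (proj₂ (vs _)) (proj₂ (vs _))) , λ t → V-j t (proj₂ (vs _))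

  Tame-op : {C : Chain ℓ} → Tame C → Tame (op (op C))
  Tame-op t f = t (mk↪ (app f) (app-mono f))

  -- The classes met by well-ordered infinite orbits to the left.  Isomorphisms of such a class
  -- onto its trace on D are not unique and classes have no canonical base point, so the
  -- pointwise least isomorphism bounded below by min (x, g x) is taken.
  module Half (C : Chain ℓ) (g : C ↪ C) (tame : Tame C) (tame* : Tame (op C))
    (D : Carrier C → Set ℓ) (gD : ∀ x → D (app g x))
    (no-folds : ∀ b → LeftOrbits.Lw C g b → ¬ LeftOrbits.Folds C g b)
    (no-grows : ∀ b → LeftOrbits.Lw C g b → ¬ LeftOrbits.Grows C g b) where
    open Order C
    open Classes C
    open LeftOrbits C g public
    open RightMoved C g D gD public using (Rw; Rw-between; φ; φ-D; φ-lo; φ-hi; φ-mono; φ-onto)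

    W : A → Set ℓ
    W x = UpInf x × Σ A λ b → b ~ x × Lw b

    T : A → A → Set ℓ
    T x v = x ~ v × UpInf v

    W-self : ∀ {x} → W x → T x x
    W-self w = ~-refl , proj₁ w

    W-~ : ∀ {x y} → W x → T x y → W y
    W-~ (_ , b , bx , lw) (xy , u) = u , b , ~-trans bx xy , lw

    T-~ : ∀ {x y v} → x ~ y → T x v → T y v
    T-~ xy (xv , u) = ~-trans (~-sym xy) xv , u

    record Fam (x : A) (f : A → A) : Set ℓ where
      field
        f-T : ∀ {v} → T x v → T x (f v)
        f-D : ∀ {v} → T x v → D (f v)
        f-incr : ∀ {u v} → T x u → T x v → u ≺ v → f u ≺ f v
        f-onto : ∀ {d} → T x d → D d → Σ A λ v → T x v × f v ≡ d
        f-floor : ∀ {v} → T x v → v ≼ f v ⊎ app g v ≼ f v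
    open Fam

    Fam-~ : ∀ {x y f} → x ~ y → Fam x f → Fam y f
    Fam-~ xy F = record
      { f-T = λ t → T-~ xy (f-T F (T-~ (~-sym xy) t))
      ; f-D = λ t → f-D F (T-~ (~-sym xy) t)
      ; f-incr = λ t t′ → f-incr F (T-~ (~-sym xy) t) (T-~ (~-sym xy) t′)
      ; f-onto = λ t dd → let (v , t′ , eq) = f-onto F (T-~ (~-sym xy) t) dd in v , T-~ xy t′ , eq
      ; f-floor = λ t → f-floor F (T-~ (~-sym xy) t) }

    private
      module At (b : A) (lw : Lw b) where
        module Ab = Absorb C g tame tame* b lw (no-folds b lw)
        module Pc = Piece C g tame tame* b lw (no-folds b lw) (no-grows b lw) D gD

        family : Σ (A → A) (Fam b)
        family = fn emb , record
          { f-T = λ t → proj₁ (into emb t) ; f-D = λ t → proj₂ (into emb t) ; f-incr = incr emb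
          ; f-onto = λ t dd → onto (t , dd) ; f-floor = floor }
          where open Pc.Onto Pc.onto

    Lw⇒W : ∀ {b} → Lw b → W b
    Lw⇒W {b} lw = proj₂ (At.Ab.T-b b lw) , b , ~-refl , lw

    family : ∀ {x} → W x → Σ (A → A) (Fam x)
    family (_ , b , bx , lw) = let (f , F) = At.family b lw in f , Fam-~ bx F

    g-~ : ∀ {x} → W x → x ~ app g x
    g-~ (u , b , bx , lw) = ~-trans (~-sym bx) (At.Ab.g-class b lw (bx , u))

    class-wo : ∀ {x y} → x ~ y → (P : A → Set ℓ) → (∀ {z} → P z → y ≼ z × x ~ z) → NoDesc P
    class-wo {x} {y} xy P h (s , p , d) = proj₁ (~-trans (~-sym xy) (proj₂ (h (p 0)))) (s , d , up , λ n → proj₁ (h (p n)))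
      where
      up : ∀ n → s n ≼ s 0
      up zero = ≼-refl
      up (suc n) = ≼-trans (≺⇒≼ (d n)) (up n)

    Least : A → A → Set ℓ
    Least x y = (Σ (A → A) λ f → Fam x f × y ≡ f x) × (∀ f → Fam x f → y ≼ f x)

    private
      best : ∀ x → W x → Σ A (Least x)
      best x w = let (y , r , min) = least Q nd (let (f , F) = family w in f x , f , F , refl) in
          y , r , λ f F → min (f x) (f , F , refl)
        where
        Q : A → Set ℓ
        Q y = Σ (A → A) λ f → Fam x f × y ≡ f x
        Q-T : ∀ {y} → Q y → x ~ y × (x ≼ y ⊎ app g x ≼ y)
        Q-T (f , F , refl) = proj₁ (f-T F (W-self w)) , f-floor F (W-self w)
        nd : NoDesc Q
        nd = case split (app g x) x of λ where
          (inj₁ lt) → class-wo (g-~ w) Q λ q → (case proj₂ (Q-T q) of λ where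
            (inj₁ le) → ≼-trans (≺⇒≼ lt) le
            (inj₂ le) → le) , proj₁ (Q-T q)
          (inj₂ ge) → class-wo ~-refl Q λ q → (case proj₂ (Q-T q) of λ where
            (inj₁ le) → le
            (inj₂ le) → ≼-trans ge le) , proj₁ (Q-T q)

      opaque
        chosen : Σ (A → A) λ ψ → ∀ {x} → W x → Least x (ψ x)
        chosen = choose {P = W} {Q = Least} best

    ψ : A → A
    ψ = proj₁ chosen

    ψ-spec : ∀ {x} → W x → Least x (ψ x)
    ψ-spec = proj₂ chosen

    ψ-T : ∀ {x} → W x → T x (ψ x)
    ψ-T {x} w = let ((f , F , eq) , _) = ψ-spec w in subst (T x) (sym eq) (f-T F (W-self w))

    ψ-D : ∀ {x} → W x → D (ψ x)
    ψ-D {x} w = let ((f , F , eq) , _) = ψ-spec w in subst D (sym eq) (f-D F (W-self w))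

    ψ-mono-~ : ∀ {x y} → W x → W y → x ~ y → x ≺ y → ψ x ≺ ψ y
    ψ-mono-~ {x} {y} wx wy xy lt = let ((f , F , eq) , _) = ψ-spec wy in
      ≼-≺ (proj₂ (ψ-spec wx) f (Fam-~ (~-sym xy) F)) (subst (f x ≺_) (sym eq) (f-incr F (xy′ , proj₁ wx) (W-self wy) lt))
      where
      xy′ : y ~ x
      xy′ = ~-sym xy

    ψ-mono : ∀ {x y} → W x → W y → x ≺ y → ψ x ≺ ψ y
    ψ-mono {x} {y} wx wy lt = case em (x ~ y) of λ where
      (yes xy) → ψ-mono-~ wx wy xy lt
      (no ¬xy) → let ψx≺y = above-class lt ¬xy (proj₁ (ψ-T wx)) in
        below-class ψx≺y (λ yx → ¬xy (~-trans (proj₁ (ψ-T wx)) (~-sym yx))) (proj₁ (ψ-T wy))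

    -- Least values at different points may come from different isomorphisms. But one that attains
    -- the least value at `x₀` also attains it at later points of the class, in particular at its
    -- preimage `x` of `d`.
    ψ-onto : ∀ {d} → W d → D d → Σ A λ x → W x × ψ x ≡ d
    ψ-onto {d} w dd = x , wx , ≼-antisym ψx≼d d≼ψx
      where
      F₀ : Σ (A → A) (Fam d)
      F₀ = family w
      pre₀ : Σ A λ v → T d v × proj₁ F₀ v ≡ d
      pre₀ = f-onto (proj₂ F₀) (W-self w) dd
      x₀ : A
      x₀ = proj₁ pre₀
      t₀ : T d x₀
      t₀ = proj₁ (proj₂ pre₀)
      w₀ : W x₀
      w₀ = W-~ w t₀
      f : A → A
      f = proj₁ (proj₁ (ψ-spec w₀))
      F : Fam d f
      F = Fam-~ (~-sym (proj₁ t₀)) (proj₁ (proj₂ (proj₁ (ψ-spec w₀))))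
      ψx₀≡ : ψ x₀ ≡ f x₀
      ψx₀≡ = proj₂ (proj₂ (proj₁ (ψ-spec w₀)))
      pre : Σ A λ v → T d v × f v ≡ d
      pre = f-onto F (W-self w) dd
      x : A
      x = proj₁ pre
      t : T d x
      t = proj₁ (proj₂ pre)
      fx≡ : f x ≡ d
      fx≡ = proj₂ (proj₂ pre)
      wx : W x
      wx = W-~ w t
      f-reflect : ∀ {u v} → T d u → T d v → f u ≼ f v → u ≼ v
      f-reflect tu tv le lt = le (f-incr F tv tu lt)
      x₀≼x : x₀ ≼ x
      x₀≼x = f-reflect t₀ t (subst₂ _≼_ ψx₀≡ (trans (proj₂ (proj₂ pre₀)) (sym fx≡))
        (proj₂ (ψ-spec w₀) (proj₁ F₀) (Fam-~ (proj₁ t₀) (proj₂ F₀))))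
      ψx≼d : ψ x ≼ d
      ψx≼d = subst (ψ x ≼_) fx≡ (proj₂ (ψ-spec wx) f (Fam-~ (proj₁ t) F))
      f′ : A → A
      f′ = proj₁ (proj₁ (ψ-spec wx))
      F′ : Fam d f′
      F′ = Fam-~ (~-sym (proj₁ t)) (proj₁ (proj₂ (proj₁ (ψ-spec wx))))
      -- τ = f⁻¹ ∘ f′ maps the part of the class above x₀ into itself, so it is inflationary
      P : A → Set ℓ
      P v = T d v × x₀ ≼ v
      τ : Σ (A → A) λ τ → ∀ {v} → P v → T d (τ v) × f (τ v) ≡ f′ v
      τ = choose {P = P} {Q = λ v u → T d u × f u ≡ f′ v} λ v (tv , _) → f-onto F (f-T F′ tv) (f-D F′ tv)
      f′-weak : ∀ {v} → P v → f′ x₀ ≼ f′ v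
      f′-weak (tv , le) = case ≼⇒≺⊎≡ le of λ where
        (inj₁ lt) → ≺⇒≼ (f-incr F′ t₀ tv lt)
        (inj₂ eq) → ≡⇒≼ (cong f′ eq)
      τ-P : ∀ {v} → P v → P (proj₁ τ v)
      τ-P {v} pv = let (tτ , eq) = proj₂ τ pv in tτ , f-reflect t₀ tτ (subst (f x₀ ≼_) (sym eq)
        (≼-trans (subst (_≼ f′ x₀) ψx₀≡ (proj₂ (ψ-spec w₀) f′ (Fam-~ (proj₁ t₀) F′))) (f′-weak pv)))
      τ-incr : ∀ {u v} → P u → P v → u ≺ v → proj₁ τ u ≺ proj₁ τ v
      τ-incr {u} {v} pu pv lt = let (tu , eu) = proj₂ τ pu ; (tv , ev) = proj₂ τ pv in
        case split (proj₁ τ u) (proj₁ τ v) of λ where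
          (inj₁ r) → r
          (inj₂ r) → ⊥-elim (case ≼⇒≺⊎≡ r of λ where
            (inj₁ r′) → ≺-irr (≺-trans (f-incr F′ (proj₁ pu) (proj₁ pv) lt) (subst₂ _≺_ ev eu (f-incr F tv tu r′)))
            (inj₂ r′) → ≺-irr (subst (f′ u ≺_) (trans (sym ev) (trans (cong f r′) eu)) (f-incr F′ (proj₁ pu) (proj₁ pv) lt)))
      d≼ψx : d ≼ ψ x
      d≼ψx lt = inflationary P (class-wo (proj₁ t₀) P λ (tv , le) → le , proj₁ tv) (proj₁ τ) τ-P τ-incr (t , x₀≼x)
        (case split (proj₁ τ x) x of λ where
          (inj₁ r) → r
          (inj₂ r) → ⊥-elim (case ≼⇒≺⊎≡ r of λ where
            (inj₁ r′) → ≺-irr (≺-trans (subst₂ _≺_ fx≡ (proj₂ (proj₂ τ (t , x₀≼x))) (f-incr F t (proj₁ (proj₂ τ (t , x₀≼x))) r′)) f′x≺d)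
            (inj₂ r′) → ≺-irr (subst (_≺ d) (trans (sym (proj₂ (proj₂ τ (t , x₀≼x)))) (trans (cong f (sym r′)) fx≡)) f′x≺d)))
        where
        f′x≺d : f′ x ≺ d
        f′x≺d = subst (_≺ d) (proj₂ (proj₂ (proj₁ (ψ-spec wx)))) lt

    Between : A → A → A → Set ℓ
    Between x y z = (x ≼ z × z ≼ y) ⊎ (y ≼ z × z ≼ x)

    W-between : ∀ {x z} → W x → Between x (ψ x) z → W z
    W-between {x} {z} w (inj₁ (p , q)) = W-~ w (xz , UpInf-down q (~-trans (~-sym xz) (proj₁ (ψ-T w))) (proj₂ (ψ-T w)))
      where
      xz : x ~ z
      xz = ~-convex ~-refl (proj₁ (ψ-T w)) p q
    W-between {x} {z} w (inj₂ (p , q)) = W-~ w (xz , UpInf-down q (~-sym xz) (proj₁ w))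
      where
      xz : x ~ z
      xz = ~-convex (proj₁ (ψ-T w)) ~-refl p q

    Free : A → Set ℓ
    Free x = Rw x × ¬ W x

    Rw-~ : ∀ {x z} → Rw x → x ≼ z → z ≼ app g x → x ~ z
    Rw-~ (_ , wo) p q = ~-of-≼ p λ ds → wo 1 (Desc-mono ≼-refl q ds)

    Rw-UpInf : ∀ {x} → Rw x → UpInf x
    Rw-UpInf {x} (lt , wo) = (λ n → it n x) , orbit-up (app-mono g) lt , ≼-refl ,
      λ n → ~-of-≼ (mono-seq (λ n → it n x) (orbit-up (app-mono g) lt) {0} {n} ℕ.z≤n) (wo n)

    Free-between : ∀ {x z} → Free x → Between x (φ x) z → Free z
    Free-between {x} {z} (rw , ¬w) (inj₂ (p , q)) = subst Free (≼-antisym (≼-trans (φ-lo rw) p) q) (rw , ¬w)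
    Free-between {x} {z} (rw , ¬w) (inj₁ (p , q)) = Rw-between rw p (≼-trans q (φ-hi rw)) , λ wz →
      ¬w (W-~ wz (~-sym xz , UpInf-down p xz (proj₁ wz)))
      where
      xz : x ~ z
      xz = Rw-~ rw p (≼-trans q (φ-hi rw))

    Free-onto : ∀ {d} → Free d → D d → Σ A λ x → Free x × φ x ≡ d
    Free-onto {d} (rw , ¬w) dd = let (x , rx , eq) = φ-onto rw dd in x , (rx , λ wx →
      ¬w (W-~ wx (Rw-~ rx (subst (x ≼_) eq (φ-lo rx)) (subst (_≼ app g x) eq (φ-hi rx)) , Rw-UpInf rw))) , eq

    Lr : A → Set ℓ
    Lr z = app g z ≺ z × (∀ n → ¬ Asc (it n z) z)

    -- Orbits in the class of b eventually pass below the orbit of b.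
    Lr-W : ∀ {z} → Lr z → ¬ W z
    Lr-W {z} (lt , noasc) (_ , b , bz , lw) = noasc (n₀ ℕ.+ m) (Asc-mono
        (subst (_≼ it n₀ (B n)) (sym (iter-+ n₀ m (app g) z)) (≺⇒≼ (it-mono n₀ below)))
        Bn≼z asc)
      where
      open AtLeft C g tame tame* b lw
      n : ℕ
      n = proj₁ (coinitial bz)
      Bn≼z : B n ≼ z
      Bn≼z = proj₂ (coinitial bz)
      passes : Σ ℕ λ m → it m z ≺ B n
      passes = dne λ none → proj₁ (~-trans (~-sym (B~b n)) bz)
        ((λ m → it m z) , Order.orbit-up (op C) (app-mono g) lt , (λ m → Order.mono-seq (op C) (λ m → it m z) (Order.orbit-up (op C) (app-mono g) lt) {0} {m} ℕ.z≤n) , λ m q → none (m , q))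
      m : ℕ
      m = proj₁ passes
      below : it m z ≺ B n
      below = proj₂ passes
      asc : Asc (it n₀ (B n)) (B n)
      asc = subst (λ t → Asc t (B n)) (trans (it-B n n₀) (trans (cong (λ k → it k b) (ℕₚ.+-comm n n₀)) (sym (it-B n₀ n)))) (Asc-map (it-mono n) B-asc)

  -- wl, wr: points of the classes treated by Half in C and in its opposite; rw, lr: other points
  -- moved to the right and to the left; fx: other fixed points.
  data Kind : Set where
    wl wr rw lr fx : Kind

  -- Assembling one map from the five kinds of points.

  module Assemble (C : Chain ℓ) (g : C ↪ C) (tame : Tame C) (tame* : Tame (op C))
    (D : Carrier C → Set ℓ) (gD : ∀ x → D (app g x))
    (nf : ∀ b → LeftOrbits.Lw C g b → ¬ LeftOrbits.Folds C g b)
    (ng : ∀ b → LeftOrbits.Lw C g b → ¬ LeftOrbits.Grows C g b)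
    (nf* : ∀ b → LeftOrbits.Lw (op C) (op↪ g) b → ¬ LeftOrbits.Folds (op C) (op↪ g) b)
    (ng* : ∀ b → LeftOrbits.Lw (op C) (op↪ g) b → ¬ LeftOrbits.Grows (op C) (op↪ g) b) where
    open Order C
    private
      tame** : Tame (op (op C))
      tame** = Tame-op tame
      module L = Half C g tame tame* D gD nf ng
      module R = Half (op C) (op↪ g) tame* tame** D gD nf* ng*

    -- Otherwise an ω in the one class and an orbit cofinal in the other would cross.
    disjoint : ∀ {x} → L.W x → ¬ R.W x
    disjoint {x} ((s , up , lo , cl) , _) (_ , b , bx , lw) = case em (∀ i → s i ≼ B k) of λ where
        (yes all) → proj₁ (O.~-trans (O.~-sym (Rt.B~b k)) bx) (s , up , (λ i → ≼-trans lo (mono-seq s up ℕ.z≤n)) , all)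
        (no ¬all) → let (i , ¬le) = ¬∀⇒∃¬ ¬all in
          proj₁ (cl i) (Desc-mono x≼Bn (≺⇒≼ (dne ¬le)) desc)
      where
      module O = Classes (op C)
      module Rt = AtLeft (op C) (op↪ g) tame* tame** b lw
      B : ℕ → A
      B = Rt.B
      n : ℕ
      n = proj₁ (Rt.coinitial bx)
      x≼Bn : x ≼ B n
      x≼Bn = proj₂ (Rt.coinitial bx)
      k : ℕ
      k = n ℕ.+ Rt.n₀
      desc : Desc (B n) (B k)
      desc = subst (Desc (B n)) (Rt.it-B n Rt.n₀) (Desc-map (Rt.it-mono n) Rt.B-asc)

    Is : Kind → A → Set ℓ
    Is wl x = L.W x
    Is wr x = R.W x
    Is rw x = L.Free x
    Is lr x = R.Free x
    Is fx x = app g x ≡ x × (¬ L.W x × ¬ R.W x)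

    value : Kind → A → A
    value wl = L.ψ
    value wr = R.ψ
    value rw = L.φ
    value lr = R.φ
    value fx x = x

    kind : ∀ x → Σ Kind λ k → Is k x
    kind x = case em (L.W x) of λ where
      (yes w) → wl , w
      (no ¬l) → case em (R.W x) of λ where
        (yes w) → wr , w
        (no ¬r) → case tri x (app g x) of λ where
          (tri≈ _ eq _) → fx , sym eq , ¬l , ¬r
          -- An `ω*` on this orbit is an `ω` on a left-moving orbit of the opposite chain, which
          -- would put `x` in `R.W`.
          (tri< lt _ _) → rw , (lt , λ n d → ¬r (R.Lw⇒W (lt , n , d))) , ¬l
          (tri> _ _ gt) → lr , (gt , λ n d → ¬l (L.Lw⇒W (gt , n , d))) , ¬r

    exclusive : ∀ {x} k k′ → Is k x → Is k′ x → k ≡ k′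
    exclusive wl wl p q = refl
    exclusive wl wr p q = ⊥-elim (disjoint p q)
    exclusive wl rw p q = ⊥-elim (proj₂ q p)
    exclusive wl lr p q = ⊥-elim (L.Lr-W (proj₁ q) p)
    exclusive wl fx p q = ⊥-elim (proj₁ (proj₂ q) p)
    exclusive wr wl p q = ⊥-elim (disjoint q p)
    exclusive wr wr p q = refl
    exclusive wr rw p q = ⊥-elim (R.Lr-W (proj₁ q) p)
    exclusive wr lr p q = ⊥-elim (proj₂ q p)
    exclusive wr fx p q = ⊥-elim (proj₂ (proj₂ q) p)
    exclusive rw wl p q = ⊥-elim (proj₂ p q)
    exclusive rw wr p q = ⊥-elim (R.Lr-W (proj₁ p) q)
    exclusive rw rw p q = refl
    exclusive rw lr p q = ⊥-elim (≺⇒≼ (proj₁ (proj₁ p)) (proj₁ (proj₁ q)))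
    exclusive {x} rw fx p q = ⊥-elim (≺-irr (subst (x ≺_) (proj₁ q) (proj₁ (proj₁ p))))
    exclusive lr wl p q = ⊥-elim (L.Lr-W (proj₁ p) q)
    exclusive lr wr p q = ⊥-elim (proj₂ p q)
    exclusive lr rw p q = ⊥-elim (≺⇒≼ (proj₁ (proj₁ q)) (proj₁ (proj₁ p)))
    exclusive lr lr p q = refl
    exclusive {x} lr fx p q = ⊥-elim (≺-irr (subst (_≺ x) (proj₁ q) (proj₁ (proj₁ p))))
    exclusive fx wl p q = ⊥-elim (proj₁ (proj₂ p) q)
    exclusive fx wr p q = ⊥-elim (proj₂ (proj₂ p) q)
    exclusive {x} fx rw p q = ⊥-elim (≺-irr (subst (x ≺_) (proj₁ p) (proj₁ (proj₁ q))))
    exclusive {x} fx lr p q = ⊥-elim (≺-irr (subst (_≺ x) (proj₁ p) (proj₁ (proj₁ q))))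
    exclusive fx fx p q = refl

    flip-between : ∀ {x y z} → L.Between x y z → R.Between x y z
    flip-between (inj₁ (p , q)) = inj₂ (q , p)
    flip-between (inj₂ (p , q)) = inj₁ (q , p)

    -- This makes the maps on the five kinds of points fit together.
    connected : ∀ {x z} k → Is k x → L.Between x (value k x) z → Is k z
    connected wl p q = L.W-between p q
    connected wr p q = R.W-between p (flip-between q)
    connected rw p q = L.Free-between p q
    connected lr p q = R.Free-between p (flip-between q)
    connected fx p (inj₁ (q , q′)) = subst (Is fx) (≼-antisym q q′) p
    connected fx p (inj₂ (q , q′)) = subst (Is fx) (≼-antisym q q′) p

    value-D : ∀ {x} k → Is k x → D (value k x)
    value-D wl p = L.ψ-D p
    value-D wr p = R.ψ-D p
    value-D rw p = L.φ-D (proj₁ p)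
    value-D lr p = R.φ-D (proj₁ p)
    value-D {x} fx p = subst D (proj₁ p) (gD x)

    value-mono : ∀ {x y} k → Is k x → Is k y → x ≺ y → value k x ≺ value k y
    value-mono wl p q lt = L.ψ-mono p q lt
    value-mono wr p q lt = R.ψ-mono q p lt
    value-mono rw p q lt = L.φ-mono (proj₁ p) (proj₁ q) lt
    value-mono lr p q lt = R.φ-mono (proj₁ q) (proj₁ p) lt
    value-mono fx p q lt = lt

    value-onto : ∀ {d} k → Is k d → D d → Σ A λ x → Is k x × value k x ≡ d
    value-onto wl p dd = L.ψ-onto p dd
    value-onto wr p dd = R.ψ-onto p dd
    value-onto rw p dd = L.Free-onto p dd
    value-onto lr p dd = R.Free-onto p dd
    value-onto {d} fx p dd = d , p , refl

    value-kind : ∀ {x} k → Is k x → Is k (value k x)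
    value-kind {x} k p = case ≼-total x (value k x) of λ where
      (inj₁ le) → connected k p (inj₁ (le , ≼-refl))
      (inj₂ le) → connected k p (inj₂ (≼-refl , le))

    -- For different kinds, reversed values would make `x` lie between `y` and its value, or the
    -- value of `y` between `x` and its value; by `connected` that point would have two kinds.
    value-mono′ : ∀ {x y} k k′ → Is k x → Is k′ y → x ≺ y → value k x ≺ value k′ y
    value-mono′ {x} {y} k k′ p q lt = case em (Lift ℓ (k ≡ k′)) of λ where
        (yes (lift refl)) → value-mono k p q lt
        (no ne) → separate λ eq → ne (lift eq)
      where
      separate : ¬ k ≡ k′ → value k x ≺ value k′ y
      separate ne = case split (value k x) (value k′ y) of λ where
          (inj₁ r) → r
          (inj₂ r) → ⊥-elim (ne (exclusive k k′
            (connected k p (inj₁ (≺⇒≼ x≺ , r))) (value-kind k′ q)))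
        where
        x≺ : x ≺ value k′ y
        x≺ = dne λ ¬lt → ne (exclusive k k′ p (connected k′ q (inj₂ (¬lt , ≺⇒≼ lt))))

    Ψ : A → A
    Ψ x = value (proj₁ (kind x)) x

    Ψ-mono : ∀ {x y} → x ≺ y → Ψ x ≺ Ψ y
    Ψ-mono {x} {y} lt = value-mono′ (proj₁ (kind x)) (proj₁ (kind y)) (proj₂ (kind x)) (proj₂ (kind y)) lt

    Ψ-D : ∀ x → D (Ψ x)
    Ψ-D x = value-D (proj₁ (kind x)) (proj₂ (kind x))

    Ψ-onto : ∀ {d} → D d → Σ A λ x → Ψ x ≡ d
    Ψ-onto {d} dd = let (k , p) = kind d ; (x , q , eq) = value-onto k p dd in
      x , trans (cong (λ k → value k x) (exclusive (proj₁ (kind x)) k (proj₂ (kind x)) q)) eq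

  -- The case distinction.

  module Dichotomy (C : Chain ℓ) where
    open Order C

    private
      BigMove : Chain ℓ → Set ℓ
      BigMove X = Σ (X ↪ X) λ f → Σ (Carrier X) λ c → Patterns.Big X c (app f c)

      big : (X : Chain ℓ) → BigMove X → SibInf X
      big X (f , c , b) = Normalise.sibInf-of-Big X f c b

      MixedMove : Chain ℓ → Set ℓ
      MixedMove X = Σ (X ↪ X) λ f → Σ (Carrier X) λ x → _<_ X x (app f x) × (Order.Asc X x (app f x) × Order.Desc X x (app f x))

      mixed : (X : Chain ℓ) → ¬ BigMove X → MixedMove X → SibInf X
      mixed X nb (f , x , lt , asc , desc) = Mixed.sibInf X (λ h y b → nb (h , y , b)) f x lt asc desc

      Bad : Chain ℓ → Set ℓ
      Bad X = Σ (X ↪ X) λ g → Σ (Carrier X) λ b → LeftOrbits.Lw X g b × (LeftOrbits.Folds X g b ⊎ LeftOrbits.Grows X g b)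

      bad : (X : Chain ℓ) → Tame X → Tame (op X) → Bad X → SibInf X
      bad X t t* (g , b , lw , inj₁ f) = AtLeft.Folds⇒sibInf X g t t* b lw f
      bad X t t* (g , b , lw , inj₂ f) = AtLeft.Grows⇒sibInf X g t t* b lw f

      to-tame : (X : Chain ℓ) → ¬ MixedMove X → Tame X
      to-tame X nm f x lt p = nm (f , x , lt , p)

      -- With the image of `X` in `C` as `D`, the straightened map has image exactly `D`, so it can
      -- be pulled back along `j` to a map onto `X`.
      one : Tame C → Tame (op C) → ¬ Bad C → ¬ Bad (op C) → SibIsOne C
      one t t* nb nb* X (e , e′) = toIsomorphic F onto
        where
        i : C ↪ X
        i = fromEmbedding e
        j : X ↪ C
        j = fromEmbedding e′
        D : A → Set ℓ
        D x = Σ (Carrier X) λ y → app j y ≡ x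
        module Z = Assemble C (j ∘↪ i) t t* D (λ x → app i x , refl)
          (λ b lw f → nb (j ∘↪ i , b , lw , inj₁ f)) (λ b lw f → nb (j ∘↪ i , b , lw , inj₂ f))
          (λ b lw f → nb* (op↪ (j ∘↪ i) , b , lw , inj₁ f)) (λ b lw f → nb* (op↪ (j ∘↪ i) , b , lw , inj₂ f))
        F : C ↪ X
        F = mk↪ (λ x → proj₁ (Z.Ψ-D x)) λ {x} {y} lt →
          ↪-reflect j (subst₂ _≺_ (sym (proj₂ (Z.Ψ-D x))) (sym (proj₂ (Z.Ψ-D y))) (Z.Ψ-mono lt))
        onto : ∀ y → Σ A λ x → app F x ≡ y
        onto y = let (x , eq) = Z.Ψ-onto (y , refl) in
          x , Embedding.injective e′ (trans (proj₂ (Z.Ψ-D x)) eq)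

      decide : {P : Set ℓ} → (P → SibInf C) → (¬ P → SibIsOne C ⊎ SibInfinite C) → SibIsOne C ⊎ SibInfinite C
      decide {P} f k = case em P of λ where
        (yes p) → inj₂ (toSibInfinite (f p))
        (no ¬p) → k ¬p

    dichotomy : SibIsOne C ⊎ SibInfinite C
    dichotomy =
      decide (big C) λ nb →
      decide (SibInf-op ∘ big (op C)) λ nb* →
      decide (mixed C nb) λ nm →
      decide (SibInf-op ∘ mixed (op C) nb*) λ nm* →
      decide (bad C (to-tame C nm) (to-tame (op C) nm*)) λ nd →
      decide (SibInf-op ∘ bad (op C) (to-tame (op C) nm*) (Tame-op (to-tame C nm))) λ nd* →
      inj₁ (one (to-tame C nm) (to-tame (op C) nm*) nd nd*)

theorem1 : {ℓ : Level} → ExcludedMiddle (lsuc ℓ) →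
    (C : Chain ℓ) → SibIsOne C ⊎ SibInfinite C
theorem1 em C = Classical.Dichotomy.dichotomy em C
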